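{- Let $n_0,n_1\ge 1$ be integers. Let $G$ be a connected bipartite graph with bipartition $(A_0,A_1)$, where $|A_0|=n_0$ and $|A_1|=n_1$. Let $H=H(u;n_0,n_1)$ be the tree with bipartition $(B_0,B_1)$, $|B_0|=n_0$, $|B_1|=n_1$, containing a node $u\in B_0$ whose neighborhood is exactly $B_1$, and such that every node $w\in B_1$ has degree $\deg_H(w)\in\left\{1+\left\lceil \frac{n_0-1}{n_1}\right\rceil,\ 1+\left\lfloor \frac{n_0-1}{n_1}\right\rfloor\right\}$. Then for every node $v\in A_0$, \[ C_1(u;H)\ \ge\ C_1(v;G). \]
   Context: For a connected graph $G$ and a node $v$, let $\mathrm{dist}_G(v,x)$ denote the length of a shortest $v$–$x$ path, $W_G(v)=\sum_{x\in V(G)}\mathrm{dist}_G(v,x)$, and the closeness of $v$ is $C_G(v)=1/W_G(v)$. The closeness centralization of $v$ in $G$ is $C_1(v;G)=\sum_{x\in V(G)}\big[C_G(v)-C_G(x)\big]$. The tree $H(u;n_0,n_1)$ (a rooted tree of depth at most 2 whose root $u$ is adjacent to all of one side, with the remaining $n_0-1$ nodes of $u$'s side distributed as leaves as evenly as possible among the $n_1$ neighbors of $u$) is determined up to isomorphism; $u$ is called its root. -}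

module Defs where

open import Data.Bool using (Bool; true; false; T; _∧_; _∨_; not; if_then_else_)
open import Data.Nat using (ℕ; zero; suc; _+_; _∸_; _/_; _≤_)
open import Data.Fin using (Fin; _≟_)
open import Data.List using (List; []; _∷_; _++_; [_]; allFin; foldr; map; length; filter)
open import Data.List.Relation.Unary.Linked using (Linked)
open import Data.List.Relation.Unary.Unique.Propositional using (Unique)
open import Data.Product using (Σ; ∃; _×_)
open import Data.Integer using (+_)
open import Relation.Binary.PropositionalEquality using (_≡_)
open import Relation.Nullary using (¬_; does)
import Data.Rational as ℚ
open ℚ using (ℚ)

record Graph (N : ℕ) : Set where
  field
    adj    : Fin N → Fin N → Bool
    sym    : ∀ x y → adj x y ≡ adj y x
    irrefl : ∀ x → adj x x ≡ false
open Graph public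

module _ {N : ℕ} (G : Graph N) where

  data Walk : Fin N → Fin N → ℕ → Set where
    here : ∀ {x} → Walk x x 0
    step : ∀ {x y z k} → T (adj G x y) → Walk y z k → Walk x z (suc k)

  Connected : Set
  Connected = ∀ x y → ∃ λ k → Walk x y k

  HasCycle : Set
  HasCycle = Σ (Fin N) λ x → Σ (List (Fin N)) λ ys →
    (2 ≤ length ys) × Unique (x ∷ ys) × Linked (λ a b → T (adj G a b)) (x ∷ ys ++ [ x ])

  IsTree : Set
  IsTree = Connected × ¬ HasCycle

  countV : (Fin N → Bool) → ℕ
  countV p = length (filter (λ x → T? (p x)) (allFin N))
    where
    open import Data.Bool.Properties using () renaming (T? to T?)

  degree : Fin N → ℕ
  degree x = countV (adj G x)

  -- G is bipartite with bipartition (A₀, A₁) = (c⁻¹ false, c⁻¹ true),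
  -- |A₀| = n₀, |A₁| = n₁.
  IsBipartition : (Fin N → Bool) → ℕ → ℕ → Set
  IsBipartition c n₀ n₁ =
    (∀ x y → T (adj G x y) → ¬ (c x ≡ c y)) ×
    (countV (λ x → not (c x)) ≡ n₀) × (countV c ≡ n₁)

  reach : ℕ → Fin N → Fin N → Bool
  reach zero    x y = does (x ≟ y)
  reach (suc k) x y = foldr _∨_ false (map (λ z → adj G x z ∧ reach k z y) (allFin N))

  -- least k < bound with reach k x y (returns the bound if none)
  private
    search : ℕ → ℕ → Fin N → Fin N → ℕ
    search k zero    x y = k
    search k (suc b) x y = if reach k x y then k else search (suc k) b x y

  -- shortest-path distance (correct for connected graphs, where the
  -- distance is always < N)
  dist : Fin N → Fin N → ℕ
  dist x y = search 0 N x y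

  W : Fin N → ℕ
  W v = foldr _+_ 0 (map (dist v) (allFin N))

  -- closeness C_G(v) = 1 / W_G(v)  (W > 0 whenever N ≥ 2 and G connected;
  -- the value 0 for W = 0 is an irrelevant convention)
  closeness : Fin N → ℚ
  closeness v with W v
  ... | zero  = ℚ.0ℚ
  ... | suc w = (+ 1) ℚ./ suc w

  C₁ : Fin N → ℚ
  C₁ v = foldr ℚ._+_ ℚ.0ℚ (map (λ x → closeness v ℚ.- closeness x) (allFin N))

-- ⌊a/b⌋ and ⌈a/b⌉ (b = 0 never used)
floorDiv : ℕ → ℕ → ℕ
floorDiv a zero    = 0
floorDiv a (suc b) = a / suc b

ceilDiv : ℕ → ℕ → ℕ
ceilDiv a zero    = 0
ceilDiv a (suc b) = (a + b) / suc b

{-# OPTIONS --safe #-}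
module Submission where

-- Put n = n₀ ∸ 1, m = n₁, N = m + n + 1. Attach every vertex of G other than v to a neighbour that is
-- one step closer to v, and let w ∈ A₁ have e vertices of A₀ attached to it and distance 2j + 1 from v;
-- a vertex of A₀ inherits e and j from the vertex it is attached to. If k is the sum of j over all
-- vertices other than v, then W(v) = T where T = m + 2n + 2k. Passing to y from the vertex y is attached
-- to raises W by at most N − 2s, where s counts the vertices with a geodesic from v through y. Hence
-- W(w) ≤ T + N − 2(e + 1) + 2j(N − 4), and a vertex attached to w exceeds this bound by at most N − 2.
-- For H these are equalities, with j = 0 and e ∈ {h, h + 1}. Bounding 1/z from below by the secant
-- through two consecutive values of z of the same parity is exact on H and makes the bound on Σ 1/W
-- linear in the pairs (e, j). The amount by which j > 0 lowers this bound is outweighed by the decrease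
-- of (N − 1)/W(v): this is an inequality between rational functions of m, n, k which, once the
-- denominators are cleared, holds coefficient by coefficient. For m ≤ 3 it also uses the convexity gap
-- created by an uneven distribution of the e's. If n = 0, both graphs are stars.

open import Defs renaming (sym to adj-sym)
open import Algebra.Bundles using (CommutativeRing)
import Algebra.Properties.Semiring.Sum as Sum
open import Data.Bool using (Bool; true; false; T; not; _∧_; _∨_; if_then_else_)
open import Data.Bool.Properties using (T?; T-∧; T-∨; not-involutive)
open import Data.Fin as Fin using (Fin; zero; suc; toℕ)
import Data.Fin.Properties as Finₚ
import Data.Integer as ℤ
import Data.Integer.Properties as ℤₚ
open import Data.List using (List; []; _∷_; map; foldr; filter; length; allFin; tabulate)
open import Data.List.Properties using (map-tabulate)
open import Data.List.Relation.Unary.All using ([]; _∷_)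
open import Data.List.Relation.Unary.AllPairs using ([]; _∷_)
open import Data.List.Relation.Unary.Linked using ([-]; _∷_)
open import Data.Nat
open import Data.Nat.DivMod using (m*n/n≡m; m<n⇒m/n≡0; +-distrib-/-∣ˡ; m≡m%n+[m/n]*n; m%n<n)
open import Data.Nat.Divisibility using (divides)
open import Data.Nat.Induction using (<-rec)
open import Data.Nat.Properties
open import Algebra.Properties.CommutativeSemigroup +-commutativeSemigroup using (interchange)
open import Data.Product using (∃; ∃₂; _×_; _,_; proj₁; proj₂)
open import Data.Rational as ℚ using (ℚ; 0ℚ)
import Data.Rational.Properties as ℚₚ
open import Data.Rational.Solver using (module +-*-Solver)
open import Data.Rational.Unnormalised as ℚᵘ using (mkℚᵘ; *≡*; *≤*)
import Data.Rational.Unnormalised.Properties as ℚᵘₚ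
open import Data.Sum using (_⊎_; inj₁; inj₂)
open import Data.Unit using (tt)
open import Data.Vec as Vec using (Vec; []; _∷_; lookup)
open import Data.Vec.Properties using (lookup-map)
open import Function using (_∘_; id)
open import Function.Bundles using (_⇔_; Equivalence)
open import Relation.Binary.PropositionalEquality
open import Relation.Nullary using (¬_; does; yes; no; contradiction)

-- The secant is safe only because of parity: 1/z is convex, so it drops below a secant strictly
-- between the two nodes, and no bound of the right parity falls there. For H the nodes are the
-- values that belong to e = h + 1 and e = h; for G they move up by 2k together with W(v). A vertex
-- w of A₁ hands its e down to e vertices of A₀, so the sum over A₀ produces Σ e(e + 1), which is
-- not linear. Integrality repairs this: (e - h)(e - h - 1) ≥ 0, with equality for the degrees in H.
-- The gap is used in the form (e - h)(e - h - 1) + (e - h)t ≥ 0, valid for all e and h when 0 ≤ t ≤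
-- 2. At t = qj it gains qh Σ j and costs q Σ ej, which helps when the deep vertices of A₁ have few
-- vertices attached. As j may reach m - 1, it needs q(m - 1) ≤ 2, hence q = 0 from m = 4 on. With k
-- treated as a parameter of its own, what remains is linear in Σ j over A₁ and in Σ ej, whose total
-- is k; so it splits into one polynomial inequality for each of them.

open Sum +-*-semiring using (sum; sum-cong-≗; ∑-distrib-+; ∑-comm; *-distribˡ-sum; *-distribʳ-sum)
module ℚΣ = Sum (CommutativeRing.semiring ℚₚ.+-*-commutativeRing)

-- Polynomial inequalities over ℕ by comparison of coefficients

data Expr (n : ℕ) : Set where
  var       : Fin n → Expr n
  con       : ℕ → Expr n
  _⊕_ _⊗_   : Expr n → Expr n → Expr n

infixl 6 _⊕_
infixl 7 _⊗_

⟦_⟧ : ∀ {n} → Expr n → Vec ℕ n → ℕ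
⟦ var i ⟧ ρ = lookup ρ i
⟦ con a ⟧ ρ = a
⟦ e ⊕ f ⟧ ρ = ⟦ e ⟧ ρ + ⟦ f ⟧ ρ
⟦ e ⊗ f ⟧ ρ = ⟦ e ⟧ ρ * ⟦ f ⟧ ρ

Poly : ℕ → Set
Poly zero    = ℕ
Poly (suc n) = List (Poly n)

evalᵖ : ∀ {n} → Poly n → Vec ℕ n → ℕ
evalᵖ {zero}  a        []      = a
evalᵖ {suc n} []       (x ∷ ρ) = 0
evalᵖ {suc n} (p ∷ ps) (x ∷ ρ) = evalᵖ p ρ + x * evalᵖ ps (x ∷ ρ)

constᵖ : ∀ {n} → ℕ → Poly n
constᵖ {zero}  a = a
constᵖ {suc n} a = constᵖ a ∷ []

varᵖ : ∀ {n} → Fin n → Poly n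
varᵖ zero    = constᵖ 0 ∷ constᵖ 1 ∷ []
varᵖ (suc i) = varᵖ i ∷ []

addᵖ : ∀ {n} → Poly n → Poly n → Poly n
addᵖ {zero}  a        b        = a + b
addᵖ {suc n} []       qs       = qs
addᵖ {suc n} (p ∷ ps) []       = p ∷ ps
addᵖ {suc n} (p ∷ ps) (q ∷ qs) = addᵖ p q ∷ addᵖ ps qs

mulᵖ : ∀ {n} → Poly n → Poly n → Poly n
mulᵖ {zero}  a        b  = a * b
mulᵖ {suc n} []       qs = []
mulᵖ {suc n} (p ∷ ps) qs = addᵖ (map (mulᵖ p) qs) (constᵖ 0 ∷ mulᵖ ps qs)

-- A sufficient test: at natural arguments every monomial is nonnegative, so domination of all
-- coefficients implies domination of the values. Coefficients missing on the right count as 0.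
leqᵖ : ∀ {n} → Poly n → Poly n → Bool
leqᵖ {zero}  a        b        = a ≤ᵇ b
leqᵖ {suc n} []       qs       = true
leqᵖ {suc n} (p ∷ ps) []       = leqᵖ p (constᵖ 0) ∧ leqᵖ ps []
leqᵖ {suc n} (p ∷ ps) (q ∷ qs) = leqᵖ p q ∧ leqᵖ ps qs

normalise : ∀ {n} → Expr n → Poly n
normalise (var i) = varᵖ i
normalise (con a) = constᵖ a
normalise (e ⊕ f) = addᵖ (normalise e) (normalise f)
normalise (e ⊗ f) = mulᵖ (normalise e) (normalise f)

constᵖ-sound : ∀ {n} a (ρ : Vec ℕ n) → evalᵖ (constᵖ {n} a) ρ ≡ a
constᵖ-sound a []      = refl
constᵖ-sound a (x ∷ ρ) = trans (cong₂ _+_ (constᵖ-sound a ρ) (*-zeroʳ x)) (+-identityʳ a)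

varᵖ-sound : ∀ {n} (i : Fin n) ρ → evalᵖ (varᵖ i) ρ ≡ lookup ρ i
varᵖ-sound {suc n} zero (x ∷ ρ)
  rewrite constᵖ-sound {n} 0 ρ | constᵖ-sound {n} 1 ρ | *-zeroʳ x = *-identityʳ x
varᵖ-sound (suc i) (x ∷ ρ) = trans (cong₂ _+_ (varᵖ-sound i ρ) (*-zeroʳ x)) (+-identityʳ _)

addᵖ-sound : ∀ {n} (p q : Poly n) ρ → evalᵖ (addᵖ p q) ρ ≡ evalᵖ p ρ + evalᵖ q ρ
addᵖ-sound {zero}  a        b        []      = refl
addᵖ-sound {suc n} []       qs       (x ∷ ρ) = refl
addᵖ-sound {suc n} (p ∷ ps) []       (x ∷ ρ) = sym (+-identityʳ _)
addᵖ-sound {suc n} (p ∷ ps) (q ∷ qs) (x ∷ ρ)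
  rewrite addᵖ-sound p q ρ | addᵖ-sound ps qs (x ∷ ρ)
        | *-distribˡ-+ x (evalᵖ ps (x ∷ ρ)) (evalᵖ qs (x ∷ ρ)) = interchange (evalᵖ p ρ) _ _ _

mulᵖ-sound : ∀ {n} (p q : Poly n) ρ → evalᵖ (mulᵖ p q) ρ ≡ evalᵖ p ρ * evalᵖ q ρ

scaleᵖ-sound : ∀ {n} (p : Poly n) qs x ρ → evalᵖ (map (mulᵖ p) qs) (x ∷ ρ) ≡ evalᵖ p ρ * evalᵖ qs (x ∷ ρ)
scaleᵖ-sound p []       x ρ = sym (*-zeroʳ (evalᵖ p ρ))
scaleᵖ-sound p (q ∷ qs) x ρ
  rewrite mulᵖ-sound p q ρ | scaleᵖ-sound p qs x ρ
        | *-distribˡ-+ (evalᵖ p ρ) (evalᵖ q ρ) (x * evalᵖ qs (x ∷ ρ))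
        | sym (*-assoc x (evalᵖ p ρ) (evalᵖ qs (x ∷ ρ)))
        | *-comm x (evalᵖ p ρ)
        | *-assoc (evalᵖ p ρ) x (evalᵖ qs (x ∷ ρ)) = refl

mulᵖ-sound {zero}  a        b  []      = refl
mulᵖ-sound {suc n} []       qs (x ∷ ρ) = refl
mulᵖ-sound {suc n} (p ∷ ps) qs (x ∷ ρ)
  rewrite addᵖ-sound (map (mulᵖ p) qs) (constᵖ 0 ∷ mulᵖ ps qs) (x ∷ ρ)
        | scaleᵖ-sound p qs x ρ | constᵖ-sound {n} 0 ρ | mulᵖ-sound ps qs (x ∷ ρ)
        | *-distribʳ-+ (evalᵖ qs (x ∷ ρ)) (evalᵖ p ρ) (x * evalᵖ ps (x ∷ ρ))
        | *-assoc x (evalᵖ ps (x ∷ ρ)) (evalᵖ qs (x ∷ ρ)) = refl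

leqᵖ-sound : ∀ {n} (p q : Poly n) → T (leqᵖ p q) → ∀ ρ → evalᵖ p ρ ≤ evalᵖ q ρ
leqᵖ-sound {zero}  a        b        t []      = ≤ᵇ⇒≤ a b t
leqᵖ-sound {suc n} []       qs       t (x ∷ ρ) = z≤n
leqᵖ-sound {suc n} (p ∷ ps) []       t (x ∷ ρ)
  with t₁ , t₂ ← Equivalence.to T-∧ t
  = +-mono-≤ (≤-trans (leqᵖ-sound p (constᵖ 0) t₁ ρ) (≤-reflexive (constᵖ-sound 0 ρ)))
             (≤-trans (*-monoʳ-≤ x (leqᵖ-sound ps [] t₂ (x ∷ ρ))) (≤-reflexive (*-zeroʳ x)))
leqᵖ-sound {suc n} (p ∷ ps) (q ∷ qs) t (x ∷ ρ)
  with t₁ , t₂ ← Equivalence.to T-∧ t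
  = +-mono-≤ (leqᵖ-sound p q t₁ ρ) (*-monoʳ-≤ x (leqᵖ-sound ps qs t₂ (x ∷ ρ)))

normalise-sound : ∀ {n} (e : Expr n) ρ → evalᵖ (normalise e) ρ ≡ ⟦ e ⟧ ρ
normalise-sound (var i) ρ = varᵖ-sound i ρ
normalise-sound (con a) ρ = constᵖ-sound a ρ
normalise-sound (e ⊕ f) ρ = trans (addᵖ-sound (normalise e) (normalise f) ρ)
                                  (cong₂ _+_ (normalise-sound e ρ) (normalise-sound f ρ))
normalise-sound (e ⊗ f) ρ = trans (mulᵖ-sound (normalise e) (normalise f) ρ)
                                  (cong₂ _*_ (normalise-sound e ρ) (normalise-sound f ρ))

poly≤ : ∀ {n} (e f : Expr n) {_ : T (leqᵖ (normalise e) (normalise f))} ρ → ⟦ e ⟧ ρ ≤ ⟦ f ⟧ ρ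
poly≤ e f {t} ρ = subst₂ _≤_ (normalise-sound e ρ) (normalise-sound f ρ)
                    (leqᵖ-sound (normalise e) (normalise f) t ρ)

poly≡ : ∀ {n} (e f : Expr n) {_ : T (leqᵖ (normalise e) (normalise f))}
        {_ : T (leqᵖ (normalise f) (normalise e))} ρ → ⟦ e ⟧ ρ ≡ ⟦ f ⟧ ρ
poly≡ e f {s} {t} ρ = ≤-antisym (poly≤ e f {s} ρ) (poly≤ f e {t} ρ)


-- Over six independent variables the comparison for `Key` cannot succeed, since `rhs₀` does not
-- contain c. The relations between the variables, such as the value N - 4 of c, and shifts such as
-- m = 4 + x have to be substituted before coefficients are compared.
inst : ∀ {k n} → Expr k → Vec (Expr n) k → Expr n
inst (var i) σ = lookup σ i
inst (con a) σ = con a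
inst (e ⊕ f) σ = inst e σ ⊕ inst f σ
inst (e ⊗ f) σ = inst e σ ⊗ inst f σ

inst-sound : ∀ {k n} (e : Expr k) (σ : Vec (Expr n) k) ρ → ⟦ inst e σ ⟧ ρ ≡ ⟦ e ⟧ (Vec.map (λ s → ⟦ s ⟧ ρ) σ)
inst-sound (var i) σ ρ = sym (lookup-map i (λ s → ⟦ s ⟧ ρ) σ)
inst-sound (con a) σ ρ = refl
inst-sound (e ⊕ f) σ ρ = cong₂ _+_ (inst-sound e σ ρ) (inst-sound f σ ρ)
inst-sound (e ⊗ f) σ ρ = cong₂ _*_ (inst-sound e σ ρ) (inst-sound f σ ρ)

poly≤-inst : ∀ {k n} (e f : Expr k) (σ : Vec (Expr n) k)
             {_ : T (leqᵖ (normalise (inst e σ)) (normalise (inst f σ)))} ρ →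
             ⟦ e ⟧ (Vec.map (λ s → ⟦ s ⟧ ρ) σ) ≤ ⟦ f ⟧ (Vec.map (λ s → ⟦ s ⟧ ρ) σ)
poly≤-inst e f σ {t} ρ = subst₂ _≤_ (inst-sound e σ ρ) (inst-sound f σ ρ) (poly≤ (inst e σ) (inst f σ) {t} ρ)

x₀ : ∀ {n} → Expr (1 + n)
x₀ = var zero
x₁ : ∀ {n} → Expr (2 + n)
x₁ = var (suc zero)
x₂ : ∀ {n} → Expr (3 + n)
x₂ = var (suc (suc zero))
x₃ : ∀ {n} → Expr (4 + n)
x₃ = var (suc (suc (suc zero)))
x₄ : ∀ {n} → Expr (5 + n)
x₄ = var (suc (suc (suc (suc zero))))
x₅ : ∀ {n} → Expr (6 + n)
x₅ = var (suc (suc (suc (suc (suc zero)))))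

-- Fractions of natural numbers; a ÷ 0 is 0

infix 7.5 _÷_

opaque
  _÷_ : ℕ → ℕ → ℚ
  a ÷ zero  = 0ℚ
  a ÷ suc p = ℤ.+ a ℚ./ suc p

opaque
  unfolding _÷_

  ÷-mono-≤ : ∀ a b p q .{{_ : NonZero p}} .{{_ : NonZero q}} → a * q ≤ b * p → a ÷ p ℚ.≤ b ÷ q
  ÷-mono-≤ a b (suc p) (suc q) aq≤bp = ℚₚ.toℚᵘ-cancel-≤ (begin
    ℚ.toℚᵘ (ℤ.+ a ℚ./ suc p)  ≃⟨ ℚₚ.toℚᵘ-fromℚᵘ (mkℚᵘ (ℤ.+ a) p) ⟩
    mkℚᵘ (ℤ.+ a) p            ≤⟨ *≤* (subst₂ ℤ._≤_ (ℤₚ.pos-* a (suc q)) (ℤₚ.pos-* b (suc p)) (ℤ.+≤+ aq≤bp)) ⟩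
    mkℚᵘ (ℤ.+ b) q            ≃⟨ ℚₚ.toℚᵘ-fromℚᵘ (mkℚᵘ (ℤ.+ b) q) ⟨
    ℚ.toℚᵘ (ℤ.+ b ℚ./ suc q)  ∎)
    where open ℚᵘₚ.≤-Reasoning

opaque
  unfolding _÷_

  ÷-monoˡ-≤ : ∀ {a b} p → a ≤ b → a ÷ p ℚ.≤ b ÷ p
  ÷-monoˡ-≤ zero      a≤b = ℚₚ.≤-refl
  ÷-monoˡ-≤ {a} {b} p@(suc _) a≤b = ÷-mono-≤ a b p p (*-monoˡ-≤ p a≤b)

÷-cancel : ∀ a p q .{{_ : NonZero p}} .{{_ : NonZero q}} → (a * q) ÷ (p * q) ≡ a ÷ p
÷-cancel a p q {{p≢0}} = ℚₚ.≤-antisym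
  (÷-mono-≤ (a * q) a (p * q) p {{m*n≢0 p q}} (≤-reflexive eq))
  (÷-mono-≤ a (a * q) p (p * q) {{p≢0}} {{m*n≢0 p q}} (≤-reflexive (sym eq)))
  where
  eq : a * q * p ≡ a * (p * q)
  eq = trans (*-assoc a q p) (cong (a *_) (*-comm q p))

opaque
  unfolding _÷_

  ÷-+ : ∀ a b p → a ÷ p ℚ.+ b ÷ p ≡ (a + b) ÷ p
  ÷-+ a b zero    = refl
  ÷-+ a b (suc p) = ℚₚ.toℚᵘ-injective (begin
    ℚ.toℚᵘ (ℤ.+ a ℚ./ suc p ℚ.+ ℤ.+ b ℚ./ suc p)             ≈⟨ ℚₚ.toℚᵘ-homo-+ (ℤ.+ a ℚ./ suc p) (ℤ.+ b ℚ./ suc p) ⟩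
    ℚ.toℚᵘ (ℤ.+ a ℚ./ suc p) ℚᵘ.+ ℚ.toℚᵘ (ℤ.+ b ℚ./ suc p)   ≈⟨ ℚᵘₚ.+-cong (ℚₚ.toℚᵘ-fromℚᵘ (mkℚᵘ (ℤ.+ a) p)) (ℚₚ.toℚᵘ-fromℚᵘ (mkℚᵘ (ℤ.+ b) p)) ⟩
    mkℚᵘ (ℤ.+ a) p ℚᵘ.+ mkℚᵘ (ℤ.+ b) p                       ≈⟨ *≡* common-denominator ⟩
    mkℚᵘ (ℤ.+ (a + b)) p                                     ≈⟨ ℚₚ.toℚᵘ-fromℚᵘ (mkℚᵘ (ℤ.+ (a + b)) p) ⟨
    ℚ.toℚᵘ (ℤ.+ (a + b) ℚ./ suc p)                           ∎)
    where
    open import Relation.Binary.Reasoning.Setoid ℚᵘₚ.≃-setoid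
    q : ℤ.ℤ
    q = ℤ.+ suc p
    common-denominator : (ℤ.+ a ℤ.* q ℤ.+ ℤ.+ b ℤ.* q) ℤ.* q ≡ (ℤ.+ (a + b)) ℤ.* (q ℤ.* q)
    common-denominator = trans (cong (ℤ._* q) (sym (ℤₚ.*-distribʳ-+ q (ℤ.+ a) (ℤ.+ b))))
                   (ℤₚ.*-assoc (ℤ.+ (a + b)) q q)

opaque
  unfolding _÷_

  0÷ : ∀ p → 0 ÷ p ≡ 0ℚ
  0÷ zero    = refl
  0÷ (suc p) = ℚₚ.0/n≡0 (suc p)

-- Finite sums

foldr-map-allFin : ∀ {A : Set} {n} (_∙_ : A → A → A) (ε : A) (f : Fin n → A) →
                   foldr _∙_ ε (map f (allFin n)) ≡ foldr _∙_ ε (tabulate f)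
foldr-map-allFin _∙_ ε f = cong (foldr _∙_ ε) (map-tabulate id f)

foldr-tabulate-+ : ∀ {n} (f : Fin n → ℕ) → foldr _+_ 0 (tabulate f) ≡ sum f
foldr-tabulate-+ {zero}  f = refl
foldr-tabulate-+ {suc n} f = cong (f zero +_) (foldr-tabulate-+ (f ∘ suc))

foldr-tabulate-ℚ : ∀ {n} (f : Fin n → ℚ) → foldr ℚ._+_ 0ℚ (tabulate f) ≡ ℚΣ.sum f
foldr-tabulate-ℚ {zero}  f = refl
foldr-tabulate-ℚ {suc n} f = cong (f zero ℚ.+_) (foldr-tabulate-ℚ (f ∘ suc))

𝟙 : Bool → ℕ
𝟙 b = if b then 1 else 0

length-filter-tabulate : ∀ {A : Set} {n} (p : A → Bool) (f : Fin n → A) →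
                         length (filter (λ x → T? (p x)) (tabulate f)) ≡ sum (λ i → 𝟙 (p (f i)))
length-filter-tabulate {n = zero}  p f = refl
length-filter-tabulate {n = suc n} p f with p (f zero)
... | true  = cong suc (length-filter-tabulate p (f ∘ suc))
... | false = length-filter-tabulate p (f ∘ suc)

countV≡sum : ∀ {N} (G : Graph N) p → countV G p ≡ sum (λ x → 𝟙 (p x))
countV≡sum G p = length-filter-tabulate p id

W≡sum : ∀ {N} (G : Graph N) v → W G v ≡ sum (dist G v)
W≡sum G v = trans (foldr-map-allFin _+_ 0 (dist G v)) (foldr-tabulate-+ (dist G v))

sum-mono-≤ : ∀ {n} {f g : Fin n → ℕ} → (∀ i → f i ≤ g i) → sum f ≤ sum g
sum-mono-≤ {zero}  f≤g = z≤n
sum-mono-≤ {suc n} f≤g = +-mono-≤ (f≤g zero) (sum-mono-≤ (f≤g ∘ suc))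

sum-const : ∀ n a → sum {n} (λ _ → a) ≡ n * a
sum-const zero    a = refl
sum-const (suc n) a = cong (a +_) (sum-const n a)

sum-≥ : ∀ {n} (f : Fin n → ℕ) i → f i ≤ sum f
sum-≥ f zero    = m≤m+n _ _
sum-≥ f (suc i) = ≤-trans (sum-≥ (f ∘ suc) i) (m≤n+m _ _)

⟨_≡_⟩ : ∀ {n} → Fin n → Fin n → ℕ
⟨ x ≡ y ⟩ = 𝟙 (does (x Fin.≟ y))

sum-pick : ∀ {n} (i : Fin n) (f : Fin n → ℕ) → sum (λ x → ⟨ i ≡ x ⟩ * f x) ≡ f i
sum-pick {suc n} zero    f = trans (cong₂ _+_ (+-identityʳ (f zero)) (trans (sum-const n 0) (*-zeroʳ n))) (+-identityʳ _)
sum-pick {suc n} (suc i) f = trans (sum-cong-≗ lem) (sum-pick i (f ∘ suc))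
  where
  lem : ∀ x → ⟨ suc i ≡ suc x ⟩ * f (suc x) ≡ ⟨ i ≡ x ⟩ * f (suc x)
  lem x with i Fin.≟ x
  ... | yes _ = refl
  ... | no  _ = refl

ℚsum-mono-≤ : ∀ {n} {f g : Fin n → ℚ} → (∀ i → f i ℚ.≤ g i) → ℚΣ.sum f ℚ.≤ ℚΣ.sum g
ℚsum-mono-≤ {zero}  f≤g = ℚₚ.≤-refl
ℚsum-mono-≤ {suc n} f≤g = ℚₚ.+-mono-≤ (f≤g zero) (ℚsum-mono-≤ (f≤g ∘ suc))

sum-÷ : ∀ {n} (f : Fin n → ℕ) p → ℚΣ.sum (λ i → f i ÷ p) ≡ sum f ÷ p
sum-÷ {zero}  f p = sym (0÷ p)
sum-÷ {suc n} f p = trans (cong (f zero ÷ p ℚ.+_) (sum-÷ (f ∘ suc) p)) (÷-+ (f zero) (sum (f ∘ suc)) p)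

opaque
  unfolding _÷_

  closeness≡1÷W : ∀ {N} (G : Graph N) v → closeness G v ≡ 1 ÷ W G v
  closeness≡1÷W G v with W G v
  ... | zero  = refl
  ... | suc w = refl

-- Adding back the subtracted closenesses leaves N copies of 1/W(v). This removes subtraction from
-- the comparison of the two graphs.
C₁+∑closeness : ∀ {N} (G : Graph N) v → C₁ G v ℚ.+ ℚΣ.sum (λ x → 1 ÷ W G x) ≡ N ÷ W G v
C₁+∑closeness {N} G v = begin
  C₁ G v ℚ.+ ℚΣ.sum c                            ≡⟨ cong (ℚ._+ ℚΣ.sum c) (trans (foldr-map-allFin ℚ._+_ 0ℚ r) (foldr-tabulate-ℚ r)) ⟩
  ℚΣ.sum r ℚ.+ ℚΣ.sum c                          ≡⟨ sym (ℚΣ.∑-distrib-+ r c) ⟩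
  ℚΣ.sum (λ x → r x ℚ.+ c x)                     ≡⟨ ℚΣ.sum-cong-≗ lem ⟩
  ℚΣ.sum {N} (λ x → 1 ÷ W G v)                       ≡⟨ sum-÷ {N} (λ _ → 1) (W G v) ⟩
  sum {N} (λ _ → 1) ÷ W G v                          ≡⟨ cong (_÷ W G v) (trans (sum-const N 1) (*-identityʳ N)) ⟩
  N ÷ W G v                                      ∎
  where
  open ≡-Reasoning
  c r : Fin N → ℚ
  c x = 1 ÷ W G x
  r x = closeness G v ℚ.- closeness G x
  lem : ∀ x → r x ℚ.+ c x ≡ 1 ÷ W G v
  lem x rewrite closeness≡1÷W G x | closeness≡1÷W G v = begin
    p ℚ.- q ℚ.+ q            ≡⟨ ℚₚ.+-assoc p (ℚ.- q) q ⟩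
    p ℚ.+ (ℚ.- q ℚ.+ q)      ≡⟨ cong (p ℚ.+_) (ℚₚ.+-inverseˡ q) ⟩
    p ℚ.+ 0ℚ                 ≡⟨ ℚₚ.+-identityʳ p ⟩
    p                        ∎
    where p = 1 ÷ W G v
          q = 1 ÷ W G x

-- Distances

-- Defs.search is private; unification recovers it from the unfolding of dist,
-- once the number of vertices has been separated from the search bound.
mutual
  search : ∀ {N} → Graph N → ℕ → ℕ → Fin N → Fin N → ℕ
  search = _

  dist-unfold : ∀ {M} (G : Graph (suc M)) x y →
                dist G x y ≡ (if reach G 0 x y then 0 else search G 1 M x y)
  dist-unfold {M} G x y with suc M | G | x | y | 1
  ... | _ | _ | _ | _ | _ = refl

T-any : ∀ {n} {f : Fin n → Bool} → T (foldr _∨_ false (tabulate f)) → ∃ λ i → T (f i)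
T-any {suc n} {f} t with Equivalence.to (T-∨ {f zero}) t
... | inj₁ t₀ = zero , t₀
... | inj₂ t₁ with i , tᵢ ← T-any t₁ = suc i , tᵢ

any-T : ∀ {n} {f : Fin n → Bool} i → T (f i) → T (foldr _∨_ false (tabulate f))
any-T {f = f} zero    t = Equivalence.from (T-∨ {f zero}) (inj₁ t)
any-T {f = f} (suc i) t = Equivalence.from (T-∨ {f zero}) (inj₂ (any-T i t))

flip : ℕ → Bool → Bool
flip zero    b = b
flip (suc k) b = not (flip k b)

module _ {N : ℕ} (G : Graph N) where

  reach⇒walk : ∀ k {x y} → T (reach G k x y) → Walk G x y k
  reach⇒walk zero    {x} {y} t with x Fin.≟ y
  ... | yes refl = here
  reach⇒walk (suc k) {x} {y} t
    with z , tz ← T-any (subst T (foldr-map-allFin _∨_ false (λ z → adj G x z ∧ reach G k z y)) t)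
    with a , r ← Equivalence.to (T-∧ {adj G x z}) tz
    = step a (reach⇒walk k r)

  walk⇒reach : ∀ {k x y} → Walk G x y k → T (reach G k x y)
  walk⇒reach {x = x} here with x Fin.≟ x
  ... | yes _   = tt
  ... | no  x≢x = x≢x refl
  walk⇒reach {suc k} {x} {y} (step {y = z} a w) =
    subst T (sym (foldr-map-allFin _∨_ false (λ z → adj G x z ∧ reach G k z y)))
      (any-T z (Equivalence.from (T-∧ {adj G x z}) (a , walk⇒reach w)))

  vertex : ∀ {x y k} → Walk G x y k → Fin (suc k) → Fin N
  vertex {x = x} w          zero    = x
  vertex         (step a w) (suc i) = vertex w i

  prefix : ∀ {x y k} (w : Walk G x y k) i → Walk G x (vertex w i) (toℕ i)
  prefix w          zero    = here
  prefix (step a w) (suc i) = step a (prefix w i)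

  suffix : ∀ {x y k} (w : Walk G x y k) i → Walk G (vertex w i) y (k ∸ toℕ i)
  suffix w          zero    = w
  suffix (step a w) (suc i) = suffix w i

  infixr 5 _◅◅_
  _◅◅_ : ∀ {x y z k l} → Walk G x y k → Walk G y z l → Walk G x z (k + l)
  here     ◅◅ w′ = w′
  step a w ◅◅ w′ = step a (w ◅◅ w′)

  edge : ∀ {x y} → T (adj G x y) → Walk G x y 1
  edge a = step a here

  adj-symᵀ : ∀ {x y} → T (adj G x y) → T (adj G y x)
  adj-symᵀ {x} {y} = subst T (adj-sym G x y)

  reverse : ∀ {x y k} → Walk G x y k → Walk G y x k
  reverse here = here
  reverse {k = suc k} (step a w) = subst (Walk G _ _) (+-comm k 1) (reverse w ◅◅ edge (adj-symᵀ a))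

  -- `dist` searches only lengths below N, so walks have to be brought into that range. A walk with
  -- at least N steps visits some vertex twice, and the part between the two visits can be cut out.
  shorten : ∀ k {x y} → Walk G x y k → ∃ λ l → l ≤ k × l < N × Walk G x y l
  shorten = <-rec _ λ k rec {x} {y} w → go k rec w
    where
    go : ∀ k → (∀ {l} → l < k → ∀ {x y} → Walk G x y l → ∃ λ j → j ≤ l × j < N × Walk G x y j) →
         ∀ {x y} → Walk G x y k → ∃ λ j → j ≤ k × j < N × Walk G x y j
    go k rec {x} {y} w with k <? N
    ... | yes k<N = k , ≤-refl , k<N , w
    ... | no  k≮N with i , j , i<j , eq ← Finₚ.pigeonhole (s≤s (≮⇒≥ k≮N)) (vertex w)
      = let short = prefix w i ◅◅ subst (λ z → Walk G z y _) (sym eq) (suffix w j)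
            shorter : toℕ i + (k ∸ toℕ j) < k
            shorter = ≤-trans (+-monoˡ-≤ (k ∸ toℕ j) i<j) (≤-reflexive (m+[n∸m]≡n (Finₚ.toℕ≤pred[n] j)))
            l , l≤ , l<N , w′ = rec shorter short
        in l , ≤-trans l≤ (<⇒≤ shorter) , l<N , w′

  search-spec : ∀ b k {l x y} → k ≤ l → l < k + b → T (reach G l x y) →
                T (reach G (search G k b x y) x y) × search G k b x y ≤ l
  search-spec zero k k≤l l<k+0 t = contradiction (<-≤-trans l<k+0 (≤-reflexive (+-identityʳ k))) (≤⇒≯ k≤l)
  search-spec (suc b) k {l} {x} {y} k≤l l<k+b t with reach G k x y in eq
  ... | true  = subst T (sym eq) tt , k≤l
  ... | false with m≤n⇒m<n∨m≡n k≤l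
  ...   | inj₁ k<l  = search-spec b (suc k) k<l (<-≤-trans l<k+b (≤-reflexive (+-suc k b))) t
  ...   | inj₂ refl = contradiction t (subst (¬_ ∘ T) (sym eq) id)

  dist-minimal : ∀ {x y k} → Walk G x y k → dist G x y ≤ k
  dist-minimal {k = k} w with l , l≤k , l<N , w′ ← shorten k w
    = ≤-trans (proj₂ (search-spec N 0 z≤n l<N (walk⇒reach w′))) l≤k

  dist-self : ∀ x → dist G x x ≡ 0
  dist-self x = n≤0⇒n≡0 (dist-minimal here)

  module _ (conn : Connected G) where

    geodesic : ∀ x y → Walk G x y (dist G x y)
    geodesic x y with k , w ← conn x y
      with l , l≤k , l<N , w′ ← shorten k w
      = reach⇒walk _ (proj₁ (search-spec N 0 z≤n l<N (walk⇒reach w′)))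

    dist-triangle : ∀ x y z → dist G x z ≤ dist G x y + dist G y z
    dist-triangle x y z = dist-minimal (geodesic x y ◅◅ geodesic y z)

    0<dist : ∀ {x y} → x ≢ y → 0 < dist G x y
    0<dist {x} {y} x≢y with dist G x y | geodesic x y
    ... | zero  | here = contradiction refl x≢y
    ... | suc _ | _    = z<s

    predecessor : ∀ x y → x ≢ y → ∃ λ p → T (adj G y p) × dist G x y ≡ suc (dist G x p)
    predecessor x y x≢y with dist G x y in eq | geodesic x y
    ... | zero  | here = contradiction refl x≢y
    ... | suc k | w with step {y = p} a w′ ← reverse w = p , a , cong suc (≤-antisym lower (dist-minimal (reverse w′)))
      where
      lower : k ≤ dist G x p
      lower = s≤s⁻¹ (≤-trans (≤-reflexive (sym eq))
                (≤-trans (dist-minimal (geodesic x p ◅◅ edge (adj-symᵀ a))) (≤-reflexive (+-comm _ 1))))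

  module _ (c : Fin N → Bool) (proper : ∀ x y → T (adj G x y) → c x ≢ c y) where

    colour-step : ∀ {x y} → T (adj G x y) → c y ≡ not (c x)
    colour-step {x} {y} a with c x | c y | proper x y a
    ... | true  | true  | q = contradiction refl q
    ... | true  | false | q = refl
    ... | false | true  | q = refl
    ... | false | false | q = contradiction refl q

    walk-colour : ∀ {x y k} → Walk G x y k → c x ≡ flip k (c y)
    walk-colour here       = refl
    walk-colour (step a w) = trans (colour-step (adj-symᵀ a)) (cong not (walk-colour w))

-- The polynomial inequality behind the comparison

-- Here m = 1 + m′, n = m h + 1 + r, N = m + n + 1, and b₁ = T′ + N − 2(h + 2), b₀ = T′ + 2N − 2(h + 2) − 2
-- are written out without subtraction; ° marks the value at k = 0. With c = N − 4,
--   lhs₁ ≤ rhs₁  is  m/(b₁° b₁) + n/(b₀° b₀) + c/(b₁ (b₁ + 2)) ≤ (m + n)/(T° T′) + q h/(b₀ (b₀ + 2)),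
--   lhs₀ ≤ rhs₀  is  m/(b₁° b₁) + n/(b₀° b₀) + (c + q)/(b₀ (b₀ + 2)) ≤ (m + n)/(T° T′),
-- where q is the multiple of the convexity gap that is used (see spread).
module Key {A : Set} (add mul : A → A → A) (κ : ℕ → A) (m′ h r k c q : A) where
  infixl 6 _⊞_
  infixl 7 _⊠_

  _⊞_ _⊠_ : A → A → A
  _⊞_ = add
  _⊠_ = mul

  m n b₁° b₀° b₁ b₀ T° T′ : A
  m   = κ 1 ⊞ m′
  n   = m ⊠ h ⊞ (κ 1 ⊞ r)
  b₁° = κ 2 ⊞ κ 2 ⊠ m′ ⊞ κ 3 ⊠ r ⊞ (κ 1 ⊞ κ 3 ⊠ m′) ⊠ h
  b₀° = κ 3 ⊞ κ 3 ⊠ m′ ⊞ κ 4 ⊠ r ⊞ (κ 2 ⊞ κ 4 ⊠ m′) ⊠ h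
  b₁  = b₁° ⊞ κ 2 ⊠ k
  b₀  = b₀° ⊞ κ 2 ⊠ k
  T°  = m ⊞ κ 2 ⊠ n
  T′  = T° ⊞ κ 2 ⊠ k

  -- `root` is the common denominator b₁° · b₁(b₁ + 2) · b₀° · b₀(b₀ + 2). The other four are the
  -- cofactors in it of b₁° b₁, b₀° b₀, b₁(b₁ + 2) and b₀(b₀ + 2), in this order.
  odd₁ even₁ extra₁ extra₀ root : A
  odd₁   = (b₁ ⊞ κ 2) ⊠ (b₀° ⊠ (b₀ ⊠ (b₀ ⊞ κ 2)))
  even₁  = b₁° ⊠ (b₁ ⊠ (b₁ ⊞ κ 2)) ⊠ (b₀ ⊞ κ 2)
  extra₁ = b₁° ⊠ (b₀° ⊠ (b₀ ⊠ (b₀ ⊞ κ 2)))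
  extra₀ = b₁° ⊠ (b₁ ⊠ (b₁ ⊞ κ 2)) ⊠ b₀°
  root   = b₁° ⊠ (b₁ ⊠ (b₁ ⊞ κ 2)) ⊠ (b₀° ⊠ (b₀ ⊠ (b₀ ⊞ κ 2)))

  lhs₁ rhs₁ lhs₀ rhs₀ : A
  lhs₁ = T° ⊠ T′ ⊠ (m ⊠ odd₁ ⊞ n ⊠ even₁ ⊞ c ⊠ extra₁)
  rhs₁ = (m ⊞ n) ⊠ root ⊞ T° ⊠ T′ ⊠ (q ⊠ h ⊠ extra₀)
  lhs₀ = T° ⊠ T′ ⊠ (m ⊠ odd₁ ⊞ n ⊠ even₁ ⊞ (c ⊞ q) ⊠ extra₀)
  rhs₀ = (m ⊞ n) ⊠ root

-- The same formulas are read twice, as numbers for the comparison of fractions and as expressions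
-- for the coefficient test, so that the two readings agree by computation.
module Keyᴺ = Key _+_ _*_ id
module Keyᴱ {n} = Key {Expr n} _⊕_ _⊗_ con

module Keyˣ = Keyᴱ {6} x₀ x₁ x₂ x₃ x₄ x₅

record KeyAt (ρ : Vec ℕ 6) : Set where
  constructor mkKey
  field
    key₁ : ⟦ Keyˣ.lhs₁ ⟧ ρ ≤ ⟦ Keyˣ.rhs₁ ⟧ ρ
    key₀ : ⟦ Keyˣ.lhs₀ ⟧ ρ ≤ ⟦ Keyˣ.rhs₀ ⟧ ρ

KeyHolds : (m′ h r k c q : ℕ) → Set
KeyHolds m′ h r k c q = KeyAt (m′ ∷ h ∷ r ∷ k ∷ c ∷ q ∷ [])

by-coefficients : ∀ {n} (σ : Vec (Expr n) 6)
  {_ : T (leqᵖ (normalise (inst Keyˣ.lhs₁ σ)) (normalise (inst Keyˣ.rhs₁ σ)))}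
  {_ : T (leqᵖ (normalise (inst Keyˣ.lhs₀ σ)) (normalise (inst Keyˣ.rhs₀ σ)))} →
  ∀ ρ → KeyAt (Vec.map (λ s → ⟦ s ⟧ ρ) σ)
by-coefficients σ {t₁} {t₀} ρ = mkKey (poly≤-inst Keyˣ.lhs₁ Keyˣ.rhs₁ σ {t₁} ρ) (poly≤-inst Keyˣ.lhs₀ Keyˣ.rhs₀ σ {t₀} ρ)

-- In this and the next three cases the fifth argument is N - 4, written without subtraction. At h =
-- 0 the gain q h in `rhs₁` vanishes while q still burdens `lhs₀`, hence q = 0.
key-m≡2-h≡0 : ∀ r k → KeyHolds 1 0 r k r 0
key-m≡2-h≡0 r k = by-coefficients (con 1 ∷ con 0 ∷ x₀ ∷ x₁ ∷ x₀ ∷ con 0 ∷ []) (r ∷ k ∷ [])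

key-m≡2 : ∀ h r k → KeyHolds 1 (1 + h) r k (2 * (1 + h) + r) 2
key-m≡2 h r k = by-coefficients (con 1 ∷ con 1 ⊕ x₀ ∷ x₁ ∷ x₂ ∷ con 2 ⊗ (con 1 ⊕ x₀) ⊕ x₁ ∷ con 2 ∷ []) (h ∷ r ∷ k ∷ [])

key-m≡3 : ∀ h r k → KeyHolds 2 h r k (3 * h + (1 + r)) 1
key-m≡3 h r k = by-coefficients (con 2 ∷ x₀ ∷ x₁ ∷ x₂ ∷ con 3 ⊗ x₀ ⊕ (con 1 ⊕ x₁) ∷ con 1 ∷ []) (h ∷ r ∷ k ∷ [])

key-m≥4 : ∀ m h r k → KeyHolds (3 + m) h r k ((4 + m) * h + (1 + r) + (1 + m)) 0
key-m≥4 m h r k = by-coefficients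
  (con 3 ⊕ x₀ ∷ x₁ ∷ x₂ ∷ x₃ ∷ (con 4 ⊕ x₀) ⊗ x₁ ⊕ (con 1 ⊕ x₂) ⊕ (con 1 ⊕ x₀) ∷ con 0 ∷ []) (m ∷ h ∷ r ∷ k ∷ [])

-- Secants of 1/z

÷-+-≤ : ∀ x p y r z → .{{_ : NonZero p}} → .{{_ : NonZero r}} →
        x * r ≤ y * r + z * p → x ÷ p ℚ.≤ y ÷ p ℚ.+ z ÷ r
÷-+-≤ x p y r z {{p≢0}} {{r≢0}} le = begin
  x ÷ p                                    ≡⟨ ÷-cancel x p r ⟨
  (x * r) ÷ (p * r)                        ≤⟨ ÷-monoˡ-≤ (p * r) le ⟩
  (y * r + z * p) ÷ (p * r)                ≡⟨ ÷-+ (y * r) (z * p) (p * r) ⟨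
  (y * r) ÷ (p * r) ℚ.+ (z * p) ÷ (p * r)  ≡⟨ cong₂ ℚ._+_ (÷-cancel y p r) (trans (cong ((z * p) ÷_) (*-comm p r)) (÷-cancel z r p)) ⟩
  y ÷ p ℚ.+ z ÷ r                          ∎
  where open ℚₚ.≤-Reasoning

-- The secant is evaluated at b - 2t, at or below its lower node. Writing b = w + 2t + s turns the
-- claim into a comparison of coefficients.
secant-above : ∀ w b y t → w + 2 * (y + t) ≤ b + 2 * y →
               (b + 2 + 2 * (y + t)) * w ≤ 2 * y * w + 1 * (b * (b + 2))
secant-above w b y t le
  with s , refl ← m≤n⇒∃[o]m+o≡n (+-cancelʳ-≤ (2 * y) (w + 2 * t) b (≤-trans
    (≤-reflexive (poly≡ (x₀ ⊕ con 2 ⊗ x₁ ⊕ con 2 ⊗ x₂) (x₀ ⊕ con 2 ⊗ (x₂ ⊕ x₁)) (w ∷ t ∷ y ∷ []))) le)) =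
  poly≤ ((x₀ ⊕ con 2 ⊗ x₁ ⊕ x₂ ⊕ con 2 ⊕ con 2 ⊗ (x₃ ⊕ x₁)) ⊗ x₀)
        (con 2 ⊗ x₃ ⊗ x₀ ⊕ con 1 ⊗ ((x₀ ⊕ con 2 ⊗ x₁ ⊕ x₂) ⊗ (x₀ ⊕ con 2 ⊗ x₁ ⊕ x₂ ⊕ con 2)))
        (w ∷ t ∷ s ∷ y ∷ [])

secant-below : ∀ w b d t → w + 2 * d ≤ b + 2 * (1 + d + t) →
               (b + 2 + 2 * d) * w ≤ 2 * (1 + d + t) * w + 1 * (b * (b + 2))
secant-below w b d t le with ≤-total b (2 * t)
-- The secant is evaluated at z = b + 2 + 2t, where its numerator is b - 2t; in this case it is not
-- positive.
... | inj₁ b≤2t = begin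
  (b + 2 + 2 * d) * w                                ≤⟨ *-monoˡ-≤ w (+-monoˡ-≤ (2 * d) (+-monoˡ-≤ 2 b≤2t)) ⟩
  (2 * t + 2 + 2 * d) * w                            ≤⟨ poly≤ ((con 2 ⊗ x₀ ⊕ con 2 ⊕ con 2 ⊗ x₁) ⊗ x₂)
                                                           (con 2 ⊗ (con 1 ⊕ x₁ ⊕ x₀) ⊗ x₂ ⊕ con 1 ⊗ (x₃ ⊗ (x₃ ⊕ con 2))) (t ∷ d ∷ w ∷ b ∷ []) ⟩
  2 * (1 + d + t) * w + 1 * (b * (b + 2))            ∎
  where open ≤-Reasoning
-- With s = b - 2t the claim becomes s w ≤ b (b + 2), and w is at most z = 4t + s + 2.
... | inj₂ 2t≤b with s , refl ← m≤n⇒∃[o]m+o≡n 2t≤b = begin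
  (2 * t + s + 2 + 2 * d) * w                        ≡⟨ poly≡ ((con 2 ⊗ x₀ ⊕ x₁ ⊕ con 2 ⊕ con 2 ⊗ x₂) ⊗ x₃)
                                                           (con 2 ⊗ (con 1 ⊕ x₂ ⊕ x₀) ⊗ x₃ ⊕ x₁ ⊗ x₃) (t ∷ s ∷ d ∷ w ∷ []) ⟩
  2 * (1 + d + t) * w + s * w                        ≤⟨ +-monoʳ-≤ (2 * (1 + d + t) * w) (begin
    s * w                                              ≤⟨ *-monoʳ-≤ s w≤ ⟩
    s * (4 * t + s + 2)                                ≤⟨ poly≤ (x₁ ⊗ (con 4 ⊗ x₀ ⊕ x₁ ⊕ con 2))
                                                             (con 1 ⊗ ((con 2 ⊗ x₀ ⊕ x₁) ⊗ (con 2 ⊗ x₀ ⊕ x₁ ⊕ con 2))) (t ∷ s ∷ []) ⟩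
    1 * ((2 * t + s) * (2 * t + s + 2))                ∎) ⟩
  2 * (1 + d + t) * w + 1 * ((2 * t + s) * (2 * t + s + 2)) ∎
  where
  open ≤-Reasoning
  w≤ : w ≤ 4 * t + s + 2
  w≤ = +-cancelʳ-≤ (2 * d) w (4 * t + s + 2) (≤-trans le (≤-reflexive
    (poly≡ (con 2 ⊗ x₀ ⊕ x₁ ⊕ con 2 ⊗ (con 1 ⊕ x₂ ⊕ x₀)) (con 4 ⊗ x₀ ⊕ x₁ ⊕ con 2 ⊕ con 2 ⊗ x₂) (t ∷ s ∷ d ∷ []))))

-- The line through (b, 1/b) and (b + 2, 1/(b + 2)) has the value (b + 2 + 2d - 2y)/(b(b + 2)) at z
-- = b + 2y - 2d. By parity z ≤ b or z ≥ b + 2, where the convex function 1/z is on or above the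
-- line; and w ≤ z gives 1/w ≥ 1/z.
secant-bound : ∀ w b d y → w + 2 * d ≤ b + 2 * y → (b + 2 + 2 * d) * w ≤ 2 * y * w + 1 * (b * (b + 2))
secant-bound w b d y le with ≤-<-connex y d
... | inj₁ y≤d with t , refl ← m≤n⇒∃[o]m+o≡n y≤d = secant-above w b y t le
... | inj₂ d<y with t , refl ← m≤n⇒∃[o]m+o≡n d<y = secant-below w b d t le

1÷-secant : ∀ w b d y .{{_ : NonZero w}} .{{_ : NonZero b}} → w + 2 * d ≤ b + 2 * y →
            (b + 2 + 2 * d) ÷ (b * (b + 2)) ℚ.≤ (2 * y) ÷ (b * (b + 2)) ℚ.+ 1 ÷ w
1÷-secant w b@(suc _) d y le =
  ÷-+-≤ (b + 2 + 2 * d) (b * (b + 2)) (2 * y) w 1 (secant-bound w b d y le)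

-- For e ∈ {h , 1 + h} the extremal w is b + 2 or b, where the secant meets 1/z.
1÷-secant-tight : ∀ w b e h .{{_ : NonZero w}} .{{_ : NonZero b}} → b + 2 * (h + 2) ≤ w + 2 * (1 + e) →
                  (e ≡ h ⊎ e ≡ 1 + h) →
                  1 ÷ w ℚ.+ (2 * (h + 2)) ÷ (b * (b + 2)) ℚ.≤ (b + 2 + 2 * (1 + e)) ÷ (b * (b + 2))
1÷-secant-tight w b@(suc b′) e h {{w≢0}} le cases = begin
  1 ÷ w ℚ.+ (2 * (h + 2)) ÷ B                              ≡⟨ cong₂ ℚ._+_ (÷-cancel 1 w B) (÷-cancel (2 * (h + 2)) B w) ⟨
  (1 * B) ÷ (w * B) ℚ.+ (2 * (h + 2) * w) ÷ (B * w)        ≡⟨ cong (λ D → (1 * B) ÷ D ℚ.+ (2 * (h + 2) * w) ÷ (B * w)) (*-comm w B) ⟩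
  (1 * B) ÷ (B * w) ℚ.+ (2 * (h + 2) * w) ÷ (B * w)        ≡⟨ ÷-+ (1 * B) (2 * (h + 2) * w) (B * w) ⟩
  (1 * B + 2 * (h + 2) * w) ÷ (B * w)                      ≤⟨ ÷-monoˡ-≤ (B * w) (bound cases le) ⟩
  ((b + 2 + 2 * (1 + e)) * w) ÷ (B * w)                    ≡⟨ ÷-cancel (b + 2 + 2 * (1 + e)) B w ⟩
  (b + 2 + 2 * (1 + e)) ÷ B                                ∎
  where
  open ℚₚ.≤-Reasoning
  B = b * (b + 2)
  bound : (e ≡ h ⊎ e ≡ 1 + h) → b + 2 * (h + 2) ≤ w + 2 * (1 + e) →
          1 * B + 2 * (h + 2) * w ≤ (b + 2 + 2 * (1 + e)) * w
  bound (inj₁ refl) le with s , refl ← m≤n⇒∃[o]m+o≡n (+-cancelʳ-≤ (2 * (1 + h)) (b + 2) w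
      (≤-trans (≤-reflexive (poly≡ (x₀ ⊕ con 2 ⊕ con 2 ⊗ (con 1 ⊕ x₁)) (x₀ ⊕ con 2 ⊗ (x₁ ⊕ con 2)) (b ∷ h ∷ []))) le))
    = poly≤ (con 1 ⊗ (x₀ ⊗ (x₀ ⊕ con 2)) ⊕ con 2 ⊗ (x₁ ⊕ con 2) ⊗ (x₀ ⊕ con 2 ⊕ x₂))
            ((x₀ ⊕ con 2 ⊕ con 2 ⊗ (con 1 ⊕ x₁)) ⊗ (x₀ ⊕ con 2 ⊕ x₂)) (b ∷ h ∷ s ∷ [])
  bound (inj₂ refl) le with s , refl ← m≤n⇒∃[o]m+o≡n (+-cancelʳ-≤ (2 * (h + 2)) b w
      (≤-trans le (≤-reflexive (poly≡ (x₀ ⊕ con 2 ⊗ (con 1 ⊕ (con 1 ⊕ x₁))) (x₀ ⊕ con 2 ⊗ (x₁ ⊕ con 2)) (w ∷ h ∷ [])))))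
    = poly≤ (con 1 ⊗ (x₀ ⊗ (x₀ ⊕ con 2)) ⊕ con 2 ⊗ (x₁ ⊕ con 2) ⊗ (x₀ ⊕ x₂))
            ((x₀ ⊕ con 2 ⊕ con 2 ⊗ (con 1 ⊕ (con 1 ⊕ x₁))) ⊗ (x₀ ⊕ x₂)) (b ∷ h ∷ s ∷ [])

-- Both fractions over b (b + 2) are of the form x/b + y/(b + 2).
two-value-shift : ∀ b k x y .{{_ : NonZero b}} →
  ((x + y) * b + 2 * x) ÷ (b * (b + 2)) ℚ.≤
  ((x + y) * (b + 2 * k) + 2 * x) ÷ ((b + 2 * k) * (b + 2 * k + 2)) ℚ.+ (2 * k * (x + y)) ÷ (b * (b + 2 * k))
two-value-shift b@(suc _) k x y = begin
  ((x + y) * b + 2 * x) ÷ B         ≤⟨ ÷-mono-≤ ((x + y) * b + 2 * x) num B D {{_}} {{m*n≢0 B′ (b * (b + 2 * k))}} cross ⟩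
  num ÷ D                           ≡⟨ ÷-+ (u * (b * b′)) (z * B′) D ⟨
  (u * (b * b′)) ÷ D ℚ.+ (z * B′) ÷ D ≡⟨ cong₂ ℚ._+_ (÷-cancel u B′ (b * b′)) (trans (cong ((z * B′) ÷_) (*-comm B′ (b * b′))) (÷-cancel z (b * b′) B′)) ⟩
  u ÷ B′ ℚ.+ z ÷ (b * b′)           ∎
  where
  open ℚₚ.≤-Reasoning
  b′ = b + 2 * k
  B = b * (b + 2)
  B′ = b′ * (b′ + 2)
  D = B′ * (b * b′)
  u = (x + y) * b′ + 2 * x
  z = 2 * k * (x + y)
  num = u * (b * b′) + z * B′
  cross : ((x + y) * b + 2 * x) * D ≤ num * B
  cross = poly≤ (((x₂ ⊕ x₃) ⊗ x₀ ⊕ con 2 ⊗ x₂) ⊗ Dᴱ) ((uᴱ ⊗ (x₀ ⊗ b′ᴱ) ⊕ con 2 ⊗ x₁ ⊗ (x₂ ⊕ x₃) ⊗ B′ᴱ) ⊗ (x₀ ⊗ (x₀ ⊕ con 2))) (b ∷ k ∷ x ∷ y ∷ [])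
    where
    b′ᴱ B′ᴱ Dᴱ uᴱ : Expr 4
    b′ᴱ = x₀ ⊕ con 2 ⊗ x₁
    B′ᴱ = b′ᴱ ⊗ (b′ᴱ ⊕ con 2)
    Dᴱ = B′ᴱ ⊗ (x₀ ⊗ b′ᴱ)
    uᴱ = (x₂ ⊕ x₃) ⊗ b′ᴱ ⊕ con 2 ⊗ x₂

-- Clearing denominators

÷-expand : ∀ s x p r {D} .{{_ : NonZero p}} .{{_ : NonZero r}} → p * r ≡ D → (s * x) ÷ p ≡ (s * (x * r)) ÷ D
÷-expand s x p r refl = trans (sym (÷-cancel (s * x) p r)) (cong (_÷ (p * r)) (*-assoc s x r))

÷-combine₃ : ∀ s x y z D → (s * x) ÷ D ℚ.+ (s * y) ÷ D ℚ.+ (s * z) ÷ D ≡ (s * (x + y + z)) ÷ D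
÷-combine₃ s x y z D = begin
  (s * x) ÷ D ℚ.+ (s * y) ÷ D ℚ.+ (s * z) ÷ D  ≡⟨ cong (ℚ._+ (s * z) ÷ D) (÷-+ (s * x) (s * y) D) ⟩
  (s * x + s * y) ÷ D ℚ.+ (s * z) ÷ D          ≡⟨ ÷-+ (s * x + s * y) (s * z) D ⟩
  (s * x + s * y + s * z) ÷ D                  ≡⟨ cong (_÷ D) (poly≡ (x₀ ⊗ x₁ ⊕ x₀ ⊗ x₂ ⊕ x₀ ⊗ x₃) (x₀ ⊗ (x₁ ⊕ x₂ ⊕ x₃)) (s ∷ x ∷ y ∷ z ∷ [])) ⟩
  (s * (x + y + z)) ÷ D                        ∎
  where open ≡-Reasoning

module _ (b₁°-1 b₁-1 b₀°-1 b₀-1 t-1 s : ℕ) where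

  private
    b₁° = suc b₁°-1
    b₁  = suc b₁-1
    b₀° = suc b₀°-1
    b₀  = suc b₀-1
    t   = suc t-1
    odd₁ = (b₁ + 2) * (b₀° * (b₀ * (b₀ + 2)))
    even₁ = b₁° * (b₁ * (b₁ + 2)) * (b₀ + 2)
    extra₁ = b₁° * (b₀° * (b₀ * (b₀ + 2)))
    extra₀ = b₁° * (b₁ * (b₁ + 2)) * b₀°
    root = b₁° * (b₁ * (b₁ + 2)) * (b₀° * (b₀ * (b₀ + 2)))
    D = root * t

    ρ : Vec ℕ 5
    ρ = b₁° ∷ b₁ ∷ b₀° ∷ b₀ ∷ t ∷ []

    rootᴱ : Expr 5
    rootᴱ = x₀ ⊗ (x₁ ⊗ (x₁ ⊕ con 2)) ⊗ (x₂ ⊗ (x₃ ⊗ (x₃ ⊕ con 2)))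

    term-odd : ∀ x → (s * x) ÷ (b₁° * b₁) ≡ (s * (x * (odd₁ * t))) ÷ D
    term-odd x = ÷-expand s x (b₁° * b₁) (odd₁ * t)
      (poly≡ (x₀ ⊗ x₁ ⊗ ((x₁ ⊕ con 2) ⊗ (x₂ ⊗ (x₃ ⊗ (x₃ ⊕ con 2))) ⊗ x₄)) (rootᴱ ⊗ x₄) ρ)

    term-even : ∀ x → (s * x) ÷ (b₀° * b₀) ≡ (s * (x * (even₁ * t))) ÷ D
    term-even x = ÷-expand s x (b₀° * b₀) (even₁ * t)
      (poly≡ (x₂ ⊗ x₃ ⊗ (x₀ ⊗ (x₁ ⊗ (x₁ ⊕ con 2)) ⊗ (x₃ ⊕ con 2) ⊗ x₄)) (rootᴱ ⊗ x₄) ρ)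

    term-extra₁ : ∀ x → (s * x) ÷ (b₁ * (b₁ + 2)) ≡ (s * (x * (extra₁ * t))) ÷ D
    term-extra₁ x = ÷-expand s x (b₁ * (b₁ + 2)) (extra₁ * t)
      (poly≡ (x₁ ⊗ (x₁ ⊕ con 2) ⊗ (x₀ ⊗ (x₂ ⊗ (x₃ ⊗ (x₃ ⊕ con 2))) ⊗ x₄)) (rootᴱ ⊗ x₄) ρ)

    term-extra₀ : ∀ x → (s * x) ÷ (b₀ * (b₀ + 2)) ≡ (s * (x * (extra₀ * t))) ÷ D
    term-extra₀ x = ÷-expand s x (b₀ * (b₀ + 2)) (extra₀ * t)
      (poly≡ (x₃ ⊗ (x₃ ⊕ con 2) ⊗ (x₀ ⊗ (x₁ ⊗ (x₁ ⊕ con 2)) ⊗ x₂ ⊗ x₄)) (rootᴱ ⊗ x₄) ρ)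

    term-root : ∀ x → (s * x) ÷ t ≡ (s * (x * root)) ÷ D
    term-root x = ÷-expand s x t root (*-comm t root)

    regroup : ∀ t m o n e c x → m * (o * t) + n * (e * t) + c * (x * t) ≡ t * (m * o + n * e + c * x)
    regroup t m o n e c x = poly≡ (x₁ ⊗ (x₂ ⊗ x₀) ⊕ x₃ ⊗ (x₄ ⊗ x₀) ⊕ y₅ ⊗ (y₆ ⊗ x₀)) (x₀ ⊗ (x₁ ⊗ x₂ ⊕ x₃ ⊗ x₄ ⊕ y₅ ⊗ y₆))
                                  (t ∷ m ∷ o ∷ n ∷ e ∷ c ∷ x ∷ [])
      where
      y₅ y₆ : Expr 7
      y₅ = var (suc (suc (suc (suc (suc zero)))))
      y₆ = var (suc (suc (suc (suc (suc (suc zero))))))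

  clear-denominators₁ : ∀ m n c z l →
    t * (m * odd₁ + n * even₁ + c * extra₁) ≤ l * root + t * (z * extra₀) →
    (s * m) ÷ (b₁° * b₁) ℚ.+ (s * n) ÷ (b₀° * b₀) ℚ.+ (s * c) ÷ (b₁ * (b₁ + 2)) ℚ.≤
    (s * z) ÷ (b₀ * (b₀ + 2)) ℚ.+ (s * l) ÷ t
  clear-denominators₁ m n c z l le = begin
    (s * m) ÷ (b₁° * b₁) ℚ.+ (s * n) ÷ (b₀° * b₀) ℚ.+ (s * c) ÷ (b₁ * (b₁ + 2))
      ≡⟨ cong₂ ℚ._+_ (cong₂ ℚ._+_ (term-odd m) (term-even n)) (term-extra₁ c) ⟩
    (s * (m * (odd₁ * t))) ÷ D ℚ.+ (s * (n * (even₁ * t))) ÷ D ℚ.+ (s * (c * (extra₁ * t))) ÷ D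
      ≡⟨ ÷-combine₃ s (m * (odd₁ * t)) (n * (even₁ * t)) (c * (extra₁ * t)) D ⟩
    (s * (m * (odd₁ * t) + n * (even₁ * t) + c * (extra₁ * t))) ÷ D
      ≤⟨ ÷-monoˡ-≤ D (*-monoʳ-≤ s (≤-trans (≤-reflexive (regroup t m odd₁ n even₁ c extra₁)) (≤-trans le (≤-reflexive
           (poly≡ (x₀ ⊕ x₁ ⊗ (x₂ ⊗ x₃)) (x₂ ⊗ (x₃ ⊗ x₁) ⊕ x₀) (l * root ∷ t ∷ z ∷ extra₀ ∷ [])))))) ⟩
    (s * (z * (extra₀ * t) + l * root)) ÷ D
      ≡⟨ cong (_÷ D) (*-distribˡ-+ s (z * (extra₀ * t)) (l * root)) ⟩
    (s * (z * (extra₀ * t)) + s * (l * root)) ÷ D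
      ≡⟨ ÷-+ (s * (z * (extra₀ * t))) (s * (l * root)) D ⟨
    (s * (z * (extra₀ * t))) ÷ D ℚ.+ (s * (l * root)) ÷ D
      ≡⟨ cong₂ ℚ._+_ (term-extra₀ z) (term-root l) ⟨
    (s * z) ÷ (b₀ * (b₀ + 2)) ℚ.+ (s * l) ÷ t ∎
    where open ℚₚ.≤-Reasoning

  clear-denominators₀ : ∀ m n c l →
    t * (m * odd₁ + n * even₁ + c * extra₀) ≤ l * root →
    (s * m) ÷ (b₁° * b₁) ℚ.+ (s * n) ÷ (b₀° * b₀) ℚ.+ (s * c) ÷ (b₀ * (b₀ + 2)) ℚ.≤ (s * l) ÷ t
  clear-denominators₀ m n c l le = begin
    (s * m) ÷ (b₁° * b₁) ℚ.+ (s * n) ÷ (b₀° * b₀) ℚ.+ (s * c) ÷ (b₀ * (b₀ + 2))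
      ≡⟨ cong₂ ℚ._+_ (cong₂ ℚ._+_ (term-odd m) (term-even n)) (term-extra₀ c) ⟩
    (s * (m * (odd₁ * t))) ÷ D ℚ.+ (s * (n * (even₁ * t))) ÷ D ℚ.+ (s * (c * (extra₀ * t))) ÷ D
      ≡⟨ ÷-combine₃ s (m * (odd₁ * t)) (n * (even₁ * t)) (c * (extra₀ * t)) D ⟩
    (s * (m * (odd₁ * t) + n * (even₁ * t) + c * (extra₀ * t))) ÷ D
      ≤⟨ ÷-monoˡ-≤ D (*-monoʳ-≤ s (≤-trans (≤-reflexive (regroup t m odd₁ n even₁ c extra₀)) le)) ⟩
    (s * (l * root)) ÷ D
      ≡⟨ term-root l ⟨
    (s * l) ÷ t ∎
    where open ℚₚ.≤-Reasoning

-- Adding up the bounds for the two graphs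

ℚ-cancel-≤ : ∀ {x y} z → x ℚ.+ z ℚ.≤ y ℚ.+ z → x ℚ.≤ y
ℚ-cancel-≤ {x} {y} z le = subst₂ ℚ._≤_ (lem x) (lem y) (ℚₚ.+-monoˡ-≤ (ℚ.- z) le)
  where
  lem : ∀ x → x ℚ.+ z ℚ.+ ℚ.- z ≡ x
  lem x = trans (ℚₚ.+-assoc x z (ℚ.- z)) (trans (cong (x ℚ.+_) (ℚₚ.+-inverseʳ z)) (ℚₚ.+-identityʳ x))

-- The sum of the six hypotheses with the common terms cancelled: the secant bounds for G and for H,
-- the shift of the nodes for odd and for even vertices, the inequality `Excess`, and the decrease
-- of the root term.
ℚ-chain : ∀ {tT lT u₁ u₀ z₀ SG x₁ x₀ y₀ SH tH u₁° u₀° v₁ v₀ w lH} →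
  tT ℚ.+ u₁ ℚ.+ (u₀ ℚ.+ z₀) ℚ.≤ SG ℚ.+ x₁ ℚ.+ (x₀ ℚ.+ y₀) →
  SH ℚ.≤ tH ℚ.+ u₁° ℚ.+ u₀° →
  u₁° ℚ.≤ u₁ ℚ.+ v₁ →
  u₀° ℚ.≤ u₀ ℚ.+ v₀ →
  v₁ ℚ.+ v₀ ℚ.+ (x₁ ℚ.+ (x₀ ℚ.+ y₀)) ℚ.≤ z₀ ℚ.+ w →
  w ℚ.+ lT ℚ.≤ lH →
  tT ℚ.+ lT ℚ.+ SH ℚ.≤ tH ℚ.+ lH ℚ.+ SG
ℚ-chain {tT} {lT} {u₁} {u₀} {z₀} {SG} {x₁} {x₀} {y₀} {SH} {tH} {u₁°} {u₀°} {v₁} {v₀} {w} {lH} G H M₁ M₀ K L =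
  ℚ-cancel-≤ (u₁ ℚ.+ u₀ ℚ.+ z₀ ℚ.+ (v₁ ℚ.+ v₀ ℚ.+ (x₁ ℚ.+ (x₀ ℚ.+ y₀))) ℚ.+ w) (begin
    tT ℚ.+ lT ℚ.+ SH ℚ.+ (u₁ ℚ.+ u₀ ℚ.+ z₀ ℚ.+ (v₁ ℚ.+ v₀ ℚ.+ X) ℚ.+ w)
      ≡⟨ solve 9 (λ tT lT SH u₁ u₀ z₀ v X w →
           tT :+ lT :+ SH :+ (u₁ :+ u₀ :+ z₀ :+ (v :+ X) :+ w) :=
           tT :+ u₁ :+ (u₀ :+ z₀) :+ (SH :+ (v :+ X :+ (w :+ lT)))) refl tT lT SH u₁ u₀ z₀ (v₁ ℚ.+ v₀) X w ⟩
    tT ℚ.+ u₁ ℚ.+ (u₀ ℚ.+ z₀) ℚ.+ (SH ℚ.+ (v₁ ℚ.+ v₀ ℚ.+ X ℚ.+ (w ℚ.+ lT)))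
      ≤⟨ ℚₚ.+-mono-≤ G (ℚₚ.+-mono-≤ (ℚₚ.≤-trans H (ℚₚ.+-mono-≤ (ℚₚ.+-monoʳ-≤ tH M₁) M₀)) (ℚₚ.+-mono-≤ K L)) ⟩
    SG ℚ.+ x₁ ℚ.+ (x₀ ℚ.+ y₀) ℚ.+ ((tH ℚ.+ (u₁ ℚ.+ v₁) ℚ.+ (u₀ ℚ.+ v₀)) ℚ.+ (z₀ ℚ.+ w ℚ.+ lH))
      ≡⟨ solve 11 (λ SG x₁ xy tH u₁ v₁ u₀ v₀ z₀ w lH →
           SG :+ x₁ :+ xy :+ ((tH :+ (u₁ :+ v₁) :+ (u₀ :+ v₀)) :+ (z₀ :+ w :+ lH)) :=
           tH :+ lH :+ SG :+ (u₁ :+ u₀ :+ z₀ :+ (v₁ :+ v₀ :+ (x₁ :+ xy)) :+ w)) refl SG x₁ (x₀ ℚ.+ y₀) tH u₁ v₁ u₀ v₀ z₀ w lH ⟩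
    tH ℚ.+ lH ℚ.+ SG ℚ.+ (u₁ ℚ.+ u₀ ℚ.+ z₀ ℚ.+ (v₁ ℚ.+ v₀ ℚ.+ X) ℚ.+ w) ∎)
  where
  open ℚₚ.≤-Reasoning
  open +-*-Solver
  X = x₁ ℚ.+ (x₀ ℚ.+ y₀)

-- Since n = m h + 1 + r, exactly 1 + r vertices of A₁ have e = h + 1 in H, and the remaining p have
-- e = h; hence m = 1 + r + p.
module Compare (p h r J₁ J₀ c q : ℕ) where

  m′ : ℕ
  m′ = r + p

  open Keyᴺ m′ h r (J₁ + J₀) c q using (m; n; b₁°; b₀°; b₁; b₀; T°; T′) public

  k : ℕ
  k = J₁ + J₀

  B₁ B₀ B₁° B₀° : ℕ
  B₁  = b₁ * (b₁ + 2)
  B₀  = b₀ * (b₀ + 2)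
  B₁° = b₁° * (b₁° + 2)
  B₀° = b₀° * (b₀° + 2)

  -- On the left stands what the lower bound for Σ 1/W loses when k > 0: the shift of the nodes by
  -- 2k and the depth costs c j, to which the price q J₀ of the convexity gap is added. On the right
  -- stands the gain from the gap, and then (m + n)/T° - (m + n)/T′.
  Excess : Set
  Excess = (2 * (k * m)) ÷ (b₁° * b₁) ℚ.+ (2 * (k * n)) ÷ (b₀° * b₀) ℚ.+
           ((2 * (c * J₁)) ÷ B₁ ℚ.+ ((2 * (c * J₀)) ÷ B₀ ℚ.+ (2 * (q * J₀)) ÷ B₀)) ℚ.≤
           (2 * (q * (h * J₁))) ÷ B₀ ℚ.+ (2 * (k * (m + n))) ÷ (T° * T′)

  -- With the denominators held fixed both sides are linear in J₁ and J₀, because k = J₁ + J₀. So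
  -- the claim is 2 J₁ times the first key inequality plus 2 J₀ times the second.
  key⇒excess : KeyHolds m′ h r k c q → Excess
  key⇒excess (mkKey key₁ key₀) = begin
    (2 * (k * m)) ÷ (b₁° * b₁) ℚ.+ (2 * (k * n)) ÷ (b₀° * b₀) ℚ.+
      ((2 * (c * J₁)) ÷ B₁ ℚ.+ ((2 * (c * J₀)) ÷ B₀ ℚ.+ (2 * (q * J₀)) ÷ B₀))
      ≡⟨ cong₂ ℚ._+_ (cong₂ ℚ._+_ (split m (b₁° * b₁)) (split n (b₀° * b₀)))
           (cong₂ ℚ._+_ (cong (_÷ B₁) (poly≡ (con 2 ⊗ (x₀ ⊗ x₁)) (con 2 ⊗ x₁ ⊗ x₀) (c ∷ J₁ ∷ [])))
             (trans (÷-+ (2 * (c * J₀)) (2 * (q * J₀)) B₀)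
               (cong (_÷ B₀) (poly≡ (con 2 ⊗ (x₀ ⊗ x₁) ⊕ con 2 ⊗ (x₂ ⊗ x₁)) (con 2 ⊗ x₁ ⊗ (x₀ ⊕ x₂)) (c ∷ J₀ ∷ q ∷ []))))) ⟩
    (2 * J₁ * m) ÷ (b₁° * b₁) ℚ.+ (2 * J₀ * m) ÷ (b₁° * b₁) ℚ.+
      ((2 * J₁ * n) ÷ (b₀° * b₀) ℚ.+ (2 * J₀ * n) ÷ (b₀° * b₀)) ℚ.+
      ((2 * J₁ * c) ÷ B₁ ℚ.+ (2 * J₀ * (c + q)) ÷ B₀)
      ≡⟨ solve 6 (λ a b c d e f → a :+ b :+ (c :+ d) :+ (e :+ f) := a :+ c :+ e :+ (b :+ d :+ f)) refl
           ((2 * J₁ * m) ÷ (b₁° * b₁)) ((2 * J₀ * m) ÷ (b₁° * b₁)) ((2 * J₁ * n) ÷ (b₀° * b₀)) ((2 * J₀ * n) ÷ (b₀° * b₀))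
           ((2 * J₁ * c) ÷ B₁) ((2 * J₀ * (c + q)) ÷ B₀) ⟩
    (2 * J₁ * m) ÷ (b₁° * b₁) ℚ.+ (2 * J₁ * n) ÷ (b₀° * b₀) ℚ.+ (2 * J₁ * c) ÷ B₁ ℚ.+
      ((2 * J₀ * m) ÷ (b₁° * b₁) ℚ.+ (2 * J₀ * n) ÷ (b₀° * b₀) ℚ.+ (2 * J₀ * (c + q)) ÷ B₀)
      ≤⟨ ℚₚ.+-mono-≤
           -- Each quantity under `pred` computes to a successor, so `suc (pred b₁°)` is `b₁°`
           -- itself, and likewise for the others.
           (clear-denominators₁ (pred b₁°) (pred b₁) (pred b₀°) (pred b₀) (pred (T° * T′)) (2 * J₁) m n c (q * h) (m + n) key₁)
           (clear-denominators₀ (pred b₁°) (pred b₁) (pred b₀°) (pred b₀) (pred (T° * T′)) (2 * J₀) m n (c + q) (m + n) key₀) ⟩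
    (2 * J₁ * (q * h)) ÷ B₀ ℚ.+ (2 * J₁ * (m + n)) ÷ (T° * T′) ℚ.+ (2 * J₀ * (m + n)) ÷ (T° * T′)
      ≡⟨ trans (ℚₚ.+-assoc ((2 * J₁ * (q * h)) ÷ B₀) ((2 * J₁ * (m + n)) ÷ (T° * T′)) ((2 * J₀ * (m + n)) ÷ (T° * T′)))
           (cong₂ ℚ._+_ (cong (_÷ B₀) (poly≡ (con 2 ⊗ x₀ ⊗ (x₁ ⊗ x₂)) (con 2 ⊗ (x₁ ⊗ (x₂ ⊗ x₀))) (J₁ ∷ q ∷ h ∷ [])))
             (sym (split (m + n) (T° * T′)))) ⟩
    (2 * (q * (h * J₁))) ÷ B₀ ℚ.+ (2 * (k * (m + n))) ÷ (T° * T′) ∎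
    where
    open ℚₚ.≤-Reasoning
    open +-*-Solver
    split : ∀ x D → (2 * (k * x)) ÷ D ≡ (2 * J₁ * x) ÷ D ℚ.+ (2 * J₀ * x) ÷ D
    split x D = trans (cong (_÷ D) (poly≡ (con 2 ⊗ ((x₀ ⊕ x₁) ⊗ x₂)) (con 2 ⊗ x₀ ⊗ x₂ ⊕ con 2 ⊗ x₁ ⊗ x₂) (J₁ ∷ J₀ ∷ x ∷ [])))
                      (sym (÷-+ (2 * J₁ * x) (2 * J₀ * x) D))

  -- One of the 1 + (m + n) copies of 1/T′ cancels against the term of v in the bound for `SG`; the
  -- decrease of the other m + n copies has to pay for everything else.
  comparison : Excess → ∀ {E E° TH SG SH} .{{_ : NonZero TH}} → TH ≤ T° →
    2 * ((1 + h) * n) + q * (h * J₁) ≤ E + m * (h * (1 + h)) + q * J₀ →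
    E° + m * (h * (1 + h)) ≤ 2 * ((1 + h) * n) →
    1 ÷ T′ ℚ.+ (m * (b₁ + 2) + 2 * (m + n)) ÷ B₁ ℚ.+ (n * (b₀ + 2) + 2 * E) ÷ B₀ ℚ.≤
      SG ℚ.+ (2 * ((h + 2) * m + c * J₁)) ÷ B₁ ℚ.+ (2 * ((h + 2) * n + c * J₀)) ÷ B₀ →
    SH ℚ.+ (2 * ((h + 2) * m)) ÷ B₁° ℚ.+ (2 * ((h + 2) * n)) ÷ B₀° ℚ.≤
      1 ÷ TH ℚ.+ (m * (b₁° + 2) + 2 * (m + n)) ÷ B₁° ℚ.+ (n * (b₀° + 2) + 2 * E°) ÷ B₀° →
    (1 + (m + n)) ÷ T′ ℚ.+ SH ℚ.≤ (1 + (m + n)) ÷ TH ℚ.+ SG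
  comparison excess {E} {E°} {TH} {SG} {SH} TH≤T° evenG evenH boundG boundH =
    subst₂ (λ x y → x ℚ.+ SH ℚ.≤ y ℚ.+ SG) (÷-+ 1 (m + n) T′) (÷-+ 1 (m + n) TH)
      (ℚ-chain {1 ÷ T′} {(m + n) ÷ T′} {u₁ b₁ ÷ B₁} {u₀ b₀ ÷ B₀} {(2 * (q * (h * J₁))) ÷ B₀}
        {SG} {(2 * (c * J₁)) ÷ B₁} {(2 * (c * J₀)) ÷ B₀} {(2 * (q * J₀)) ÷ B₀}
        {SH} {1 ÷ TH} {u₁ b₁° ÷ B₁°} {u₀ b₀° ÷ B₀°} {(2 * (k * m)) ÷ (b₁° * b₁)} {(2 * (k * n)) ÷ (b₀° * b₀)}
        {(2 * (k * (m + n))) ÷ (T° * T′)} {(m + n) ÷ TH} simpleG simpleH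
        (subst (λ z → u₁ b₁° ÷ B₁° ℚ.≤ u₁ b₁ ÷ B₁ ℚ.+ z ÷ (b₁° * b₁)) (*-assoc 2 k m)
          (two-value-shift b₁° k (1 + r) p))
        (subst (λ z → u₀ b₀° ÷ B₀° ℚ.≤ u₀ b₀ ÷ B₀ ℚ.+ z ÷ (b₀° * b₀))
          (trans (cong (2 * k *_) n-split) (*-assoc 2 k n))
          (two-value-shift b₀° k ((1 + r) * (1 + h)) (p * h)))
        excess rootShift)
    where
    open ℚₚ.≤-Reasoning

    n-split : (1 + r) * (1 + h) + p * h ≡ n
    n-split = poly≡ ((con 1 ⊕ x₁) ⊗ (con 1 ⊕ x₂) ⊕ x₀ ⊗ x₂) ((con 1 ⊕ (x₁ ⊕ x₀)) ⊗ x₂ ⊕ (con 1 ⊕ x₁)) (p ∷ r ∷ h ∷ [])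

    -- Divided by b (b + 2) these are (1 + r)/b + p/(b + 2) and (1 + r)(1 + h)/b + p h/(b + 2). At
    -- `b₁°` and `b₀°` they bound the contributions to Σ 1/W for H of the odd and of the even
    -- vertices.
    u₁ u₀ : ℕ → ℕ
    u₁ b = (1 + r + p) * b + 2 * (1 + r)
    u₀ b = ((1 + r) * (1 + h) + p * h) * b + 2 * ((1 + r) * (1 + h))

    odd-sum : ∀ b → m * (b + 2) + 2 * (m + n) ≡ u₁ b + 2 * ((h + 2) * m)
    odd-sum b = poly≡ (mᴱ ⊗ (x₃ ⊕ con 2) ⊕ con 2 ⊗ (mᴱ ⊕ (mᴱ ⊗ x₂ ⊕ (con 1 ⊕ x₁))))
                      ((con 1 ⊕ x₁ ⊕ x₀) ⊗ x₃ ⊕ con 2 ⊗ (con 1 ⊕ x₁) ⊕ con 2 ⊗ ((x₂ ⊕ con 2) ⊗ mᴱ)) (p ∷ r ∷ h ∷ b ∷ [])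
      where mᴱ = con 1 ⊕ (x₁ ⊕ x₀)

    even-sum : ∀ b → n * (b + 2) + 4 * ((1 + h) * n) ≡ u₀ b + 2 * ((h + 2) * n) + 2 * (m * (h * (1 + h)))
    even-sum b = poly≡ (nᴱ ⊗ (x₃ ⊕ con 2) ⊕ con 4 ⊗ ((con 1 ⊕ x₂) ⊗ nᴱ))
                       (((con 1 ⊕ x₁) ⊗ (con 1 ⊕ x₂) ⊕ x₀ ⊗ x₂) ⊗ x₃ ⊕ con 2 ⊗ ((con 1 ⊕ x₁) ⊗ (con 1 ⊕ x₂))
                         ⊕ con 2 ⊗ ((x₂ ⊕ con 2) ⊗ nᴱ) ⊕ con 2 ⊗ (mᴱ ⊗ (x₂ ⊗ (con 1 ⊕ x₂)))) (p ∷ r ∷ h ∷ b ∷ [])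
      where mᴱ = con 1 ⊕ (x₁ ⊕ x₀)
            nᴱ = mᴱ ⊗ x₂ ⊕ (con 1 ⊕ x₁)

    evenG′ : u₀ b₀ + 2 * (q * (h * J₁)) + 2 * ((h + 2) * n) ≤ n * (b₀ + 2) + 2 * E + 2 * (q * J₀)
    evenG′ = +-cancelʳ-≤ (2 * e) (u + 2 * x + 2 * g) (nb + 2 * E + 2 * (q * J₀))
      (subst₂ _≤_
        (trans (poly≡ (x₀ ⊕ con 2 ⊗ (con 2 ⊗ x₁ ⊕ x₂)) (x₀ ⊕ con 4 ⊗ x₁ ⊕ con 2 ⊗ x₂) (nb ∷ f ∷ x ∷ []))
          (trans (cong (_+ 2 * x) (even-sum b₀))
            (poly≡ (x₀ ⊕ con 2 ⊗ x₂ ⊕ con 2 ⊗ x₃ ⊕ con 2 ⊗ x₁) (x₀ ⊕ con 2 ⊗ x₁ ⊕ con 2 ⊗ x₂ ⊕ con 2 ⊗ x₃) (u ∷ x ∷ g ∷ e ∷ []))))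
        (poly≡ (x₀ ⊕ con 2 ⊗ (x₁ ⊕ x₂ ⊕ x₃)) (x₀ ⊕ con 2 ⊗ x₁ ⊕ con 2 ⊗ x₃ ⊕ con 2 ⊗ x₂) (nb ∷ E ∷ e ∷ q * J₀ ∷ []))
        (+-monoʳ-≤ nb (*-monoʳ-≤ 2 evenG)))
      where
      u = u₀ b₀
      x = q * (h * J₁)
      g = (h + 2) * n
      e = m * (h * (1 + h))
      f = (1 + h) * n
      nb = n * (b₀ + 2)

    evenH′ : n * (b₀° + 2) + 2 * E° ≤ u₀ b₀° + 2 * ((h + 2) * n)
    evenH′ = +-cancelʳ-≤ (2 * e) (nb + 2 * E°) (u₀ b₀° + 2 * ((h + 2) * n))
      (subst₂ _≤_
        (poly≡ (x₀ ⊕ con 2 ⊗ (x₁ ⊕ x₂)) (x₀ ⊕ con 2 ⊗ x₁ ⊕ con 2 ⊗ x₂) (nb ∷ E° ∷ e ∷ []))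
        (trans (poly≡ (x₀ ⊕ con 2 ⊗ (con 2 ⊗ x₁)) (x₀ ⊕ con 4 ⊗ x₁) (nb ∷ (1 + h) * n ∷ [])) (even-sum b₀°))
        (+-monoʳ-≤ nb (*-monoʳ-≤ 2 evenH)))
      where
      e = m * (h * (1 + h))
      nb = n * (b₀° + 2)

    simpleG : 1 ÷ T′ ℚ.+ u₁ b₁ ÷ B₁ ℚ.+ (u₀ b₀ ÷ B₀ ℚ.+ (2 * (q * (h * J₁))) ÷ B₀) ℚ.≤
              SG ℚ.+ (2 * (c * J₁)) ÷ B₁ ℚ.+ ((2 * (c * J₀)) ÷ B₀ ℚ.+ (2 * (q * J₀)) ÷ B₀)
    simpleG = ℚ-cancel-≤ (g₁ ℚ.+ g₀) (begin
      t ℚ.+ U₁ ℚ.+ (U₀ ℚ.+ Z₀) ℚ.+ (g₁ ℚ.+ g₀)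
        ≡⟨ solve 6 (λ t U₁ U₀ Z₀ g₁ g₀ → t :+ U₁ :+ (U₀ :+ Z₀) :+ (g₁ :+ g₀) := t :+ (U₁ :+ g₁) :+ (U₀ :+ Z₀ :+ g₀)) refl t U₁ U₀ Z₀ g₁ g₀ ⟩
      t ℚ.+ (U₁ ℚ.+ g₁) ℚ.+ (U₀ ℚ.+ Z₀ ℚ.+ g₀)
        ≡⟨ cong₂ (λ x y → t ℚ.+ x ℚ.+ y)
             (trans (÷-+ (u₁ b₁) (2 * ((h + 2) * m)) B₁) (cong (_÷ B₁) (sym (odd-sum b₁))))
             (trans (cong (ℚ._+ g₀) (÷-+ (u₀ b₀) (2 * (q * (h * J₁))) B₀)) (÷-+ (u₀ b₀ + 2 * (q * (h * J₁))) (2 * ((h + 2) * n)) B₀)) ⟩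
      t ℚ.+ (m * (b₁ + 2) + 2 * (m + n)) ÷ B₁ ℚ.+ (u₀ b₀ + 2 * (q * (h * J₁)) + 2 * ((h + 2) * n)) ÷ B₀
        ≤⟨ ℚₚ.+-monoʳ-≤ (t ℚ.+ (m * (b₁ + 2) + 2 * (m + n)) ÷ B₁) (÷-monoˡ-≤ B₀ evenG′) ⟩
      t ℚ.+ (m * (b₁ + 2) + 2 * (m + n)) ÷ B₁ ℚ.+ (n * (b₀ + 2) + 2 * E + 2 * (q * J₀)) ÷ B₀
        ≡⟨ cong (t ℚ.+ (m * (b₁ + 2) + 2 * (m + n)) ÷ B₁ ℚ.+_) (÷-+ (n * (b₀ + 2) + 2 * E) (2 * (q * J₀)) B₀) ⟨
      t ℚ.+ (m * (b₁ + 2) + 2 * (m + n)) ÷ B₁ ℚ.+ ((n * (b₀ + 2) + 2 * E) ÷ B₀ ℚ.+ Y₀)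
        ≡⟨ ℚₚ.+-assoc (t ℚ.+ (m * (b₁ + 2) + 2 * (m + n)) ÷ B₁) ((n * (b₀ + 2) + 2 * E) ÷ B₀) Y₀ ⟨
      t ℚ.+ (m * (b₁ + 2) + 2 * (m + n)) ÷ B₁ ℚ.+ (n * (b₀ + 2) + 2 * E) ÷ B₀ ℚ.+ Y₀
        ≤⟨ ℚₚ.+-monoˡ-≤ Y₀ boundG ⟩
      SG ℚ.+ (2 * ((h + 2) * m + c * J₁)) ÷ B₁ ℚ.+ (2 * ((h + 2) * n + c * J₀)) ÷ B₀ ℚ.+ Y₀
        ≡⟨ cong₂ (λ x y → SG ℚ.+ x ℚ.+ y ℚ.+ Y₀) (split ((h + 2) * m) (c * J₁) B₁) (split ((h + 2) * n) (c * J₀) B₀) ⟩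
      SG ℚ.+ (g₁ ℚ.+ X₁) ℚ.+ (g₀ ℚ.+ X₀) ℚ.+ Y₀
        ≡⟨ solve 6 (λ S g₁ X₁ g₀ X₀ Y₀ → S :+ (g₁ :+ X₁) :+ (g₀ :+ X₀) :+ Y₀ := S :+ X₁ :+ (X₀ :+ Y₀) :+ (g₁ :+ g₀)) refl SG g₁ X₁ g₀ X₀ Y₀ ⟩
      SG ℚ.+ X₁ ℚ.+ (X₀ ℚ.+ Y₀) ℚ.+ (g₁ ℚ.+ g₀) ∎)
      where
      open +-*-Solver
      t  = 1 ÷ T′
      U₁ = u₁ b₁ ÷ B₁
      U₀ = u₀ b₀ ÷ B₀
      Z₀ = (2 * (q * (h * J₁))) ÷ B₀
      Y₀ = (2 * (q * J₀)) ÷ B₀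
      X₁ = (2 * (c * J₁)) ÷ B₁
      X₀ = (2 * (c * J₀)) ÷ B₀
      g₁ = (2 * ((h + 2) * m)) ÷ B₁
      g₀ = (2 * ((h + 2) * n)) ÷ B₀
      split : ∀ x y D → (2 * (x + y)) ÷ D ≡ (2 * x) ÷ D ℚ.+ (2 * y) ÷ D
      split x y D = trans (cong (_÷ D) (*-distribˡ-+ 2 x y)) (sym (÷-+ (2 * x) (2 * y) D))

    simpleH : SH ℚ.≤ 1 ÷ TH ℚ.+ u₁ b₁° ÷ B₁° ℚ.+ u₀ b₀° ÷ B₀°
    simpleH = ℚ-cancel-≤ (g₁ ℚ.+ g₀) (begin
      SH ℚ.+ (g₁ ℚ.+ g₀)
        ≡⟨ ℚₚ.+-assoc SH g₁ g₀ ⟨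
      SH ℚ.+ g₁ ℚ.+ g₀
        ≤⟨ boundH ⟩
      t ℚ.+ (m * (b₁° + 2) + 2 * (m + n)) ÷ B₁° ℚ.+ (n * (b₀° + 2) + 2 * E°) ÷ B₀°
        ≤⟨ ℚₚ.+-monoʳ-≤ (t ℚ.+ (m * (b₁° + 2) + 2 * (m + n)) ÷ B₁°) (÷-monoˡ-≤ B₀° evenH′) ⟩
      t ℚ.+ (m * (b₁° + 2) + 2 * (m + n)) ÷ B₁° ℚ.+ (u₀ b₀° + 2 * ((h + 2) * n)) ÷ B₀°
        ≡⟨ cong₂ (λ x y → t ℚ.+ x ℚ.+ y)
             (trans (cong (_÷ B₁°) (odd-sum b₁°)) (sym (÷-+ (u₁ b₁°) (2 * ((h + 2) * m)) B₁°)))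
             (sym (÷-+ (u₀ b₀°) (2 * ((h + 2) * n)) B₀°)) ⟩
      t ℚ.+ (U₁ ℚ.+ g₁) ℚ.+ (U₀ ℚ.+ g₀)
        ≡⟨ solve 5 (λ t U₁ g₁ U₀ g₀ → t :+ (U₁ :+ g₁) :+ (U₀ :+ g₀) := t :+ U₁ :+ U₀ :+ (g₁ :+ g₀)) refl t U₁ g₁ U₀ g₀ ⟩
      t ℚ.+ U₁ ℚ.+ U₀ ℚ.+ (g₁ ℚ.+ g₀) ∎)
      where
      open +-*-Solver
      t  = 1 ÷ TH
      U₁ = u₁ b₁° ÷ B₁°
      U₀ = u₀ b₀° ÷ B₀°
      g₁ = (2 * ((h + 2) * m)) ÷ B₁°
      g₀ = (2 * ((h + 2) * n)) ÷ B₀°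

    -- T′ = T° + 2k gives 1/T′ + 2k/(T° T′) = 1/T°, and 1/T° is at most 1/`TH`.
    rootShift : (2 * (k * (m + n))) ÷ (T° * T′) ℚ.+ (m + n) ÷ T′ ℚ.≤ (m + n) ÷ TH
    rootShift = begin
      (2 * (k * (m + n))) ÷ (T° * T′) ℚ.+ (m + n) ÷ T′
        ≡⟨ cong ((2 * (k * (m + n))) ÷ (T° * T′) ℚ.+_) (trans (sym (÷-cancel (m + n) T′ T°)) (cong (((m + n) * T°) ÷_) (*-comm T′ T°))) ⟩
      (2 * (k * (m + n))) ÷ (T° * T′) ℚ.+ ((m + n) * T°) ÷ (T° * T′)
        ≡⟨ ÷-+ (2 * (k * (m + n))) ((m + n) * T°) (T° * T′) ⟩
      (2 * (k * (m + n)) + (m + n) * T°) ÷ (T° * T′)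
        ≡⟨ cong (_÷ (T° * T′)) (poly≡ (con 2 ⊗ (x₀ ⊗ x₁) ⊕ x₁ ⊗ x₂) (x₁ ⊗ (x₂ ⊕ con 2 ⊗ x₀)) (k ∷ m + n ∷ T° ∷ [])) ⟩
      ((m + n) * T′) ÷ (T° * T′)
        ≡⟨ ÷-cancel (m + n) T° T′ ⟩
      (m + n) ÷ T°
        ≤⟨ ÷-mono-≤ (m + n) (m + n) T° TH (*-monoʳ-≤ (m + n) TH≤T°) ⟩
      (m + n) ÷ TH ∎

-- Sums over a rooted bipartition

-- (e − h)(e − h − 1) + (e − h) t ≥ 0, with the terms moved so that no subtraction occurs.
spread : ∀ e h t → t ≤ 2 → 2 * ((1 + h) * e) + h * t ≤ e * (1 + e) + h * (1 + h) + e * t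
spread e h t t≤2 with ≤-total h e
... | inj₁ h≤e with m≤n⇒∃[o]m+o≡n h≤e
...   | zero  , refl = poly≤ (con 2 ⊗ ((con 1 ⊕ x₀) ⊗ (x₀ ⊕ con 0)) ⊕ x₀ ⊗ x₁)
                         ((x₀ ⊕ con 0) ⊗ (con 1 ⊕ (x₀ ⊕ con 0)) ⊕ x₀ ⊗ (con 1 ⊕ x₀) ⊕ (x₀ ⊕ con 0) ⊗ x₁) (h ∷ t ∷ [])
...   | suc s , refl = poly≤ (con 2 ⊗ ((con 1 ⊕ x₀) ⊗ (x₀ ⊕ (con 1 ⊕ x₂))) ⊕ x₀ ⊗ x₁)
                         ((x₀ ⊕ (con 1 ⊕ x₂)) ⊗ (con 1 ⊕ (x₀ ⊕ (con 1 ⊕ x₂))) ⊕ x₀ ⊗ (con 1 ⊕ x₀) ⊕ (x₀ ⊕ (con 1 ⊕ x₂)) ⊗ x₁)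
                         (h ∷ t ∷ s ∷ [])
spread e h t t≤2 | inj₂ e≤h with i , refl ← m≤n⇒∃[o]m+o≡n e≤h = begin
  2 * ((1 + (e + i)) * e) + (e + i) * t          ≡⟨ poly≡ (con 2 ⊗ ((con 1 ⊕ (x₀ ⊕ x₁)) ⊗ x₀) ⊕ (x₀ ⊕ x₁) ⊗ x₂)
                                                       (con 2 ⊗ ((con 1 ⊕ (x₀ ⊕ x₁)) ⊗ x₀) ⊕ x₀ ⊗ x₂ ⊕ x₁ ⊗ x₂) (e ∷ i ∷ t ∷ []) ⟩
  2 * ((1 + (e + i)) * e) + e * t + i * t        ≤⟨ +-monoʳ-≤ (2 * ((1 + (e + i)) * e) + e * t) (i*t≤ i) ⟩
  2 * ((1 + (e + i)) * e) + e * t + (i * i + i)  ≡⟨ poly≡ (con 2 ⊗ ((con 1 ⊕ (x₀ ⊕ x₁)) ⊗ x₀) ⊕ x₀ ⊗ x₂ ⊕ (x₁ ⊗ x₁ ⊕ x₁))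
                                                       (x₀ ⊗ (con 1 ⊕ x₀) ⊕ (x₀ ⊕ x₁) ⊗ (con 1 ⊕ (x₀ ⊕ x₁)) ⊕ x₀ ⊗ x₂) (e ∷ i ∷ t ∷ []) ⟩
  e * (1 + e) + (e + i) * (1 + (e + i)) + e * t  ∎
  where
  open ≤-Reasoning
  i*t≤ : ∀ i → i * t ≤ i * i + i
  i*t≤ zero    = z≤n
  i*t≤ (suc i) = ≤-trans (*-monoʳ-≤ (suc i) t≤2)
    (poly≤ ((con 1 ⊕ x₀) ⊗ con 2) ((con 1 ⊕ x₀) ⊗ (con 1 ⊕ x₀) ⊕ (con 1 ⊕ x₀)) (i ∷ []))

sum-scaleʳ : ∀ {n} (f : Fin n → ℕ) K → sum (λ x → f x * K) ≡ sum f * K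
sum-scaleʳ f K = sym (*-distribʳ-sum K f)

sum-linear : ∀ {n} (f g : Fin n → ℕ) K L → sum (λ x → f x * K + g x * L) ≡ sum f * K + sum g * L
sum-linear f g K L = trans (∑-distrib-+ (λ x → f x * K) (λ x → g x * L)) (cong₂ _+_ (sum-scaleʳ f K) (sum-scaleʳ g L))

∑-distrib-+₃ : ∀ {n} (f g h : Fin n → ℚ) →
               ℚΣ.sum (λ x → f x ℚ.+ g x ℚ.+ h x) ≡ ℚΣ.sum f ℚ.+ ℚΣ.sum g ℚ.+ ℚΣ.sum h
∑-distrib-+₃ f g h = trans (ℚΣ.∑-distrib-+ (λ x → f x ℚ.+ g x) h) (cong (ℚ._+ ℚΣ.sum h) (ℚΣ.∑-distrib-+ f g))

module Roles {N : ℕ} (c : Fin N → Bool) (v : Fin N) (cv : c v ≡ false) where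

  -- odd vertices are those of A₁, even ones those of A₀ other than the root.
  isRoot : Fin N → Bool
  isRoot x = does (v Fin.≟ x)

  δ α ζ : Fin N → ℕ
  δ x = 𝟙 (isRoot x)
  α x = 𝟙 (c x)
  ζ x = 𝟙 (not (c x) ∧ not (isRoot x))

  -- The indices are the values of δ, α and ζ at x, so that one case split on `role x`, abstracted
  -- together with the three indicators, evaluates all of them.
  data Role (x : Fin N) : ℕ → ℕ → ℕ → Set where
    root : v ≡ x → Role x 1 0 0
    odd  : c x ≡ true → Role x 0 1 0
    even : c x ≡ false → v ≢ x → Role x 0 0 1

  role : ∀ x → Role x (δ x) (α x) (ζ x)
  role x with v Fin.≟ x | c x in eq
  ... | yes refl | true  = contradiction (trans (sym eq) cv) λ ()
  ... | yes refl | false = root refl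
  ... | no  v≢x  | true  = odd eq
  ... | no  v≢x  | false = even eq v≢x

  ∑δ≡1 : sum δ ≡ 1
  ∑δ≡1 = trans (sum-cong-≗ (λ x → sym (*-identityʳ (δ x)))) (sum-pick v (λ _ → 1))

  role-partition : ∀ x → δ x + α x + ζ x ≡ 1
  role-partition x with δ x | α x | ζ x | role x
  ... | _ | _ | _ | root _   = refl
  ... | _ | _ | _ | odd _    = refl
  ... | _ | _ | _ | even _ _ = refl

  module Sizes {n m : ℕ} (∑¬c : sum (λ x → 𝟙 (not (c x))) ≡ suc n) (∑c : sum (λ x → 𝟙 (c x)) ≡ m) where

    ∑ζ≡n : sum ζ ≡ n
    ∑ζ≡n = suc-injective (begin
      1 + sum ζ                  ≡⟨ cong (_+ sum ζ) (sym ∑δ≡1) ⟩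
      sum δ + sum ζ              ≡⟨ sym (∑-distrib-+ δ ζ) ⟩
      sum (λ x → δ x + ζ x)      ≡⟨ sum-cong-≗ lem ⟩
      sum (λ x → 𝟙 (not (c x)))  ≡⟨ ∑¬c ⟩
      suc n                      ∎)
      where
      open ≡-Reasoning
      lem : ∀ x → δ x + ζ x ≡ 𝟙 (not (c x))
      lem x with v Fin.≟ x | c x in eq
      ... | yes refl | true  = contradiction (trans (sym eq) cv) λ ()
      ... | yes refl | false = refl
      ... | no  _    | true  = refl
      ... | no  _    | false = refl

    N≡ : N ≡ 1 + (m + n)
    N≡ = begin
      N                                  ≡⟨ *-identityʳ N ⟨
      N * 1                              ≡⟨ sum-const N 1 ⟨
      sum {N} (λ _ → 1)                  ≡⟨ sum-cong-≗ (λ x → sym (role-partition x)) ⟩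
      sum (λ x → δ x + α x + ζ x)        ≡⟨ trans (∑-distrib-+ (λ x → δ x + α x) ζ) (cong (_+ sum ζ) (∑-distrib-+ δ α)) ⟩
      sum δ + sum α + sum ζ              ≡⟨ cong₂ _+_ (cong₂ _+_ ∑δ≡1 ∑c) ∑ζ≡n ⟩
      1 + (m + n)                        ∎
      where open ≡-Reasoning

    module Clusters (p : Fin N → Fin N) (p-odd : ∀ x → c x ≡ false → v ≢ x → c (p x) ≡ true) where

      e : Fin N → ℕ
      e w = sum (λ x → ζ x * ⟨ p x ≡ w ⟩)

      -- Double counting of the pairs (x, w) with p x = w. The factor α can be inserted because p
      -- maps even vertices to odd ones.
      fibre : ∀ (f : Fin N → ℕ) → sum (λ x → ζ x * f (p x)) ≡ sum (λ w → α w * (e w * f w))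
      fibre f = begin
        sum (λ x → ζ x * f (p x))                                ≡⟨ sum-cong-≗ to-odd ⟩
        sum (λ x → ζ x * (α (p x) * f (p x)))                    ≡⟨ sum-cong-≗ (λ x → cong (ζ x *_) (sym (sum-pick (p x) (λ w → α w * f w)))) ⟩
        sum (λ x → ζ x * sum (λ w → ⟨ p x ≡ w ⟩ * (α w * f w)))  ≡⟨ sum-cong-≗ (λ x → *-distribˡ-sum (ζ x) (λ w → ⟨ p x ≡ w ⟩ * (α w * f w))) ⟩
        sum (λ x → sum (λ w → ζ x * (⟨ p x ≡ w ⟩ * (α w * f w)))) ≡⟨ ∑-comm (λ x w → ζ x * (⟨ p x ≡ w ⟩ * (α w * f w))) ⟩
        sum (λ w → sum (λ x → ζ x * (⟨ p x ≡ w ⟩ * (α w * f w)))) ≡⟨ sum-cong-≗ collect ⟩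
        sum (λ w → α w * (e w * f w))                            ∎
        where
        open ≡-Reasoning
        to-odd : ∀ x → ζ x * f (p x) ≡ ζ x * (α (p x) * f (p x))
        to-odd x with δ x | α x | ζ x | role x
        ... | _ | _ | _ | root _      = refl
        ... | _ | _ | _ | odd _       = refl
        ... | _ | _ | _ | even cx v≢x rewrite p-odd x cx v≢x = cong (_+ 0) (sym (*-identityˡ (f (p x))))
        collect : ∀ w → sum (λ x → ζ x * (⟨ p x ≡ w ⟩ * (α w * f w))) ≡ α w * (e w * f w)
        collect w = trans (sum-cong-≗ (λ x → sym (*-assoc (ζ x) ⟨ p x ≡ w ⟩ (α w * f w))))
          (trans (sum-scaleʳ (λ x → ζ x * ⟨ p x ≡ w ⟩) (α w * f w))
            (poly≡ (x₀ ⊗ (x₁ ⊗ x₂)) (x₁ ⊗ (x₀ ⊗ x₂)) (e w ∷ α w ∷ f w ∷ [])))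

      -- By `fibre` this is the sum of 1 + e (p x) over the even vertices x. Each odd w is counted e
      -- w times, which makes the expression quadratic in e.
      E : ℕ
      E = sum (λ w → α w * (e w * (1 + e w)))

      ∑αe≡n : sum (λ w → α w * (e w * 1)) ≡ n
      ∑αe≡n = trans (sym (fibre (λ _ → 1))) (trans (sum-cong-≗ (λ x → *-identityʳ (ζ x))) ∑ζ≡n)

      odd-weight : ∀ A → sum (λ x → α x * (A + 2 * (1 + e x))) ≡ m * A + 2 * (m + n)
      odd-weight A = begin
        sum (λ x → α x * (A + 2 * (1 + e x)))                ≡⟨ sum-cong-≗ (λ x → poly≡ (x₀ ⊗ (x₁ ⊕ con 2 ⊗ (con 1 ⊕ x₂)))
                                                                  (x₀ ⊗ (x₁ ⊕ con 2) ⊕ x₀ ⊗ (x₂ ⊗ con 1) ⊗ con 2) (α x ∷ A ∷ e x ∷ [])) ⟩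
        sum (λ x → α x * (A + 2) + α x * (e x * 1) * 2)      ≡⟨ sum-linear α (λ x → α x * (e x * 1)) (A + 2) 2 ⟩
        sum α * (A + 2) + sum (λ x → α x * (e x * 1)) * 2    ≡⟨ cong₂ (λ a b → a * (A + 2) + b * 2) ∑c ∑αe≡n ⟩
        m * (A + 2) + n * 2                                  ≡⟨ poly≡ (x₀ ⊗ (x₁ ⊕ con 2) ⊕ x₂ ⊗ con 2) (x₀ ⊗ x₁ ⊕ con 2 ⊗ (x₀ ⊕ x₂)) (m ∷ A ∷ n ∷ []) ⟩
        m * A + 2 * (m + n)                                  ∎
        where open ≡-Reasoning

      even-weight : ∀ A → sum (λ x → ζ x * (A + 2 * (1 + e (p x)))) ≡ n * A + 2 * E
      even-weight A = begin
        sum (λ x → ζ x * (A + 2 * (1 + e (p x))))                ≡⟨ sum-cong-≗ (λ x → poly≡ (x₀ ⊗ (x₁ ⊕ con 2 ⊗ (con 1 ⊕ x₂)))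
                                                                      (x₀ ⊗ x₁ ⊕ x₀ ⊗ (con 1 ⊕ x₂) ⊗ con 2) (ζ x ∷ A ∷ e (p x) ∷ [])) ⟩
        sum (λ x → ζ x * A + ζ x * (1 + e (p x)) * 2)            ≡⟨ sum-linear ζ (λ x → ζ x * (1 + e (p x))) A 2 ⟩
        sum ζ * A + sum (λ x → ζ x * (1 + e (p x))) * 2          ≡⟨ cong₂ (λ a b → a * A + b * 2) ∑ζ≡n (fibre (λ w → 1 + e w)) ⟩
        n * A + E * 2                                            ≡⟨ cong (n * A +_) (*-comm E 2) ⟩
        n * A + 2 * E                                            ∎
        where open ≡-Reasoning

      ∑α-scale : ∀ K → sum (λ x → α x * K) ≡ m * K
      ∑α-scale K = trans (sum-scaleʳ α K) (cong (_* K) ∑c)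

      ∑ζ-scale : ∀ K → sum (λ x → ζ x * K) ≡ n * K
      ∑ζ-scale K = trans (sum-scaleʳ ζ K) (cong (_* K) ∑ζ≡n)

      module Depths (j : Fin N → ℕ) where

        -- The totals of j over the odd and over the even vertices; the second uses `fibre`, as an
        -- even x inherits j (p x).
        J₁ J₀ : ℕ
        J₁ = sum (λ w → α w * j w)
        J₀ = sum (λ w → α w * (e w * j w))

        odd-cost : ∀ g c → sum (λ x → α x * (2 * (g + c * j x))) ≡ 2 * (g * m + c * J₁)
        odd-cost g c = begin
          sum (λ x → α x * (2 * (g + c * j x)))          ≡⟨ sum-cong-≗ (λ x → poly≡ (x₀ ⊗ (con 2 ⊗ (x₁ ⊕ x₂ ⊗ x₃)))
                                                              (x₀ ⊗ (con 2 ⊗ x₁) ⊕ x₀ ⊗ x₃ ⊗ (con 2 ⊗ x₂)) (α x ∷ g ∷ c ∷ j x ∷ [])) ⟩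
          sum (λ x → α x * (2 * g) + α x * j x * (2 * c)) ≡⟨ sum-linear α (λ x → α x * j x) (2 * g) (2 * c) ⟩
          sum α * (2 * g) + J₁ * (2 * c)                 ≡⟨ cong (λ a → a * (2 * g) + J₁ * (2 * c)) ∑c ⟩
          m * (2 * g) + J₁ * (2 * c)                     ≡⟨ poly≡ (x₀ ⊗ (con 2 ⊗ x₁) ⊕ x₂ ⊗ (con 2 ⊗ x₃)) (con 2 ⊗ (x₁ ⊗ x₀ ⊕ x₃ ⊗ x₂)) (m ∷ g ∷ J₁ ∷ c ∷ []) ⟩
          2 * (g * m + c * J₁)                           ∎
          where open ≡-Reasoning

        even-cost : ∀ g c → sum (λ x → ζ x * (2 * (g + c * j (p x)))) ≡ 2 * (g * n + c * J₀)
        even-cost g c = begin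
          sum (λ x → ζ x * (2 * (g + c * j (p x))))           ≡⟨ sum-cong-≗ (λ x → poly≡ (x₀ ⊗ (con 2 ⊗ (x₁ ⊕ x₂ ⊗ x₃)))
                                                                   (x₀ ⊗ (con 2 ⊗ x₁) ⊕ x₀ ⊗ x₃ ⊗ (con 2 ⊗ x₂)) (ζ x ∷ g ∷ c ∷ j (p x) ∷ [])) ⟩
          sum (λ x → ζ x * (2 * g) + ζ x * j (p x) * (2 * c)) ≡⟨ sum-linear ζ (λ x → ζ x * j (p x)) (2 * g) (2 * c) ⟩
          sum ζ * (2 * g) + sum (λ x → ζ x * j (p x)) * (2 * c) ≡⟨ cong₂ (λ a b → a * (2 * g) + b * (2 * c)) ∑ζ≡n (fibre j) ⟩
          n * (2 * g) + J₀ * (2 * c)                          ≡⟨ poly≡ (x₀ ⊗ (con 2 ⊗ x₁) ⊕ x₂ ⊗ (con 2 ⊗ x₃)) (con 2 ⊗ (x₁ ⊗ x₀ ⊕ x₃ ⊗ x₂)) (n ∷ g ∷ J₀ ∷ c ∷ []) ⟩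
          2 * (g * n + c * J₀)                                ∎
          where open ≡-Reasoning

        -- The sum of `spread` over the odd vertices at t = j q, using that the e w add up to n. The
        -- q terms improve the lower bound on E by a multiple of J₁ at the expense of J₀.
        spread-sum : ∀ h q → (∀ w → c w ≡ true → j w * q ≤ 2) →
                     2 * ((1 + h) * n) + q * (h * J₁) ≤ E + m * (h * (1 + h)) + q * J₀
        spread-sum h q small = begin
          2 * ((1 + h) * n) + q * (h * J₁)
            ≡⟨ poly≡ (con 2 ⊗ ((con 1 ⊕ x₀) ⊗ x₁) ⊕ x₂ ⊗ (x₀ ⊗ x₃)) (x₁ ⊗ (con 2 ⊗ (con 1 ⊕ x₀)) ⊕ x₃ ⊗ (x₂ ⊗ x₀)) (h ∷ n ∷ q ∷ J₁ ∷ []) ⟩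
          n * (2 * (1 + h)) + J₁ * (q * h)
            ≡⟨ cong (λ a → a * (2 * (1 + h)) + J₁ * (q * h)) (sym ∑αe≡n) ⟩
          sum (λ w → α w * (e w * 1)) * (2 * (1 + h)) + J₁ * (q * h)
            ≡⟨ sum-linear (λ w → α w * (e w * 1)) (λ w → α w * j w) (2 * (1 + h)) (q * h) ⟨
          sum (λ w → α w * (e w * 1) * (2 * (1 + h)) + α w * j w * (q * h))
            ≤⟨ sum-mono-≤ pointwise ⟩
          sum (λ w → (α w * (e w * (1 + e w)) * 1 + α w * (h * (1 + h))) + α w * (e w * j w) * q)
            ≡⟨ trans (∑-distrib-+ (λ w → α w * (e w * (1 + e w)) * 1 + α w * (h * (1 + h))) (λ w → α w * (e w * j w) * q))
                 (cong₂ _+_ (sum-linear (λ w → α w * (e w * (1 + e w))) α 1 (h * (1 + h))) (sum-scaleʳ (λ w → α w * (e w * j w)) q)) ⟩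
          E * 1 + sum α * (h * (1 + h)) + J₀ * q
            ≡⟨ cong₂ _+_ (cong₂ _+_ (*-identityʳ E) (cong (_* (h * (1 + h))) ∑c)) (*-comm J₀ q) ⟩
          E + m * (h * (1 + h)) + q * J₀ ∎
          where
          open ≤-Reasoning
          pointwise : ∀ w → α w * (e w * 1) * (2 * (1 + h)) + α w * j w * (q * h) ≤
                            α w * (e w * (1 + e w)) * 1 + α w * (h * (1 + h)) + α w * (e w * j w) * q
          pointwise w with c w in eq
          ... | false = z≤n
          ... | true  = subst₂ _≤_
            (poly≡ (con 2 ⊗ ((con 1 ⊕ x₀) ⊗ x₁) ⊕ x₀ ⊗ (x₂ ⊗ x₃)) (con 1 ⊗ (x₁ ⊗ con 1) ⊗ (con 2 ⊗ (con 1 ⊕ x₀)) ⊕ con 1 ⊗ x₂ ⊗ (x₃ ⊗ x₀)) (h ∷ e w ∷ j w ∷ q ∷ []))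
            (poly≡ (x₁ ⊗ (con 1 ⊕ x₁) ⊕ x₀ ⊗ (con 1 ⊕ x₀) ⊕ x₁ ⊗ (x₂ ⊗ x₃))
                   (con 1 ⊗ (x₁ ⊗ (con 1 ⊕ x₁)) ⊗ con 1 ⊕ con 1 ⊗ (x₀ ⊗ (con 1 ⊕ x₀)) ⊕ con 1 ⊗ (x₁ ⊗ x₂) ⊗ x₃) (h ∷ e w ∷ j w ∷ q ∷ []))
            (spread (e w) h (j w * q) (small w eq))

      -- For e ∈ {h, 1 + h} the product (e - h)(e - h - 1) vanishes, so `spread-sum` at q = 0 can be
      -- reversed.
      tight-sum : ∀ h → (∀ w → c w ≡ true → e w ≡ h ⊎ e w ≡ 1 + h) → E + m * (h * (1 + h)) ≤ 2 * ((1 + h) * n)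
      tight-sum h tight = begin
        E + m * (h * (1 + h))
          ≡⟨ cong₂ _+_ (*-identityʳ E) (cong (_* (h * (1 + h))) ∑c) ⟨
        E * 1 + sum α * (h * (1 + h))
          ≡⟨ sum-linear (λ w → α w * (e w * (1 + e w))) α 1 (h * (1 + h)) ⟨
        sum (λ w → α w * (e w * (1 + e w)) * 1 + α w * (h * (1 + h)))
          ≤⟨ sum-mono-≤ pointwise ⟩
        sum (λ w → α w * (e w * 1) * (2 * (1 + h)))
          ≡⟨ sum-scaleʳ (λ w → α w * (e w * 1)) (2 * (1 + h)) ⟩
        sum (λ w → α w * (e w * 1)) * (2 * (1 + h))
          ≡⟨ cong (_* (2 * (1 + h))) ∑αe≡n ⟩
        n * (2 * (1 + h))
          ≡⟨ poly≡ (x₀ ⊗ (con 2 ⊗ (con 1 ⊕ x₁))) (con 2 ⊗ ((con 1 ⊕ x₁) ⊗ x₀)) (n ∷ h ∷ []) ⟩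
        2 * ((1 + h) * n) ∎
        where
        open ≤-Reasoning
        pointwise : ∀ w → α w * (e w * (1 + e w)) * 1 + α w * (h * (1 + h)) ≤ α w * (e w * 1) * (2 * (1 + h))
        pointwise w with c w in eq
        ... | false = z≤n
        ... | true with e w | tight w eq
        ...   | _ | inj₁ refl = poly≤ (con 1 ⊗ (x₀ ⊗ (con 1 ⊕ x₀)) ⊗ con 1 ⊕ con 1 ⊗ (x₀ ⊗ (con 1 ⊕ x₀)))
                                      (con 1 ⊗ (x₀ ⊗ con 1) ⊗ (con 2 ⊗ (con 1 ⊕ x₀))) (h ∷ [])
        ...   | _ | inj₂ refl = poly≤ (con 1 ⊗ ((con 1 ⊕ x₀) ⊗ (con 1 ⊕ (con 1 ⊕ x₀))) ⊗ con 1 ⊕ con 1 ⊗ (x₀ ⊗ (con 1 ⊕ x₀)))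
                                      (con 1 ⊗ ((con 1 ⊕ x₀) ⊗ con 1) ⊗ (con 2 ⊗ (con 1 ⊕ x₀))) (h ∷ [])

-- From bounds on W to bounds on the sum of 1/W

module WeightBounds {N : ℕ} (c : Fin N → Bool) (v : Fin N) (cv : c v ≡ false) where

  open Roles c v cv

  distribute : ∀ (W : Fin N → ℚ) {A₁ A₀ : Fin N → ℕ} B₁ B₀ {a₁ a₀} → sum A₁ ≡ a₁ → sum A₀ ≡ a₀ →
    ℚΣ.sum (λ x → W x ℚ.+ A₁ x ÷ B₁ ℚ.+ A₀ x ÷ B₀) ≡ ℚΣ.sum W ℚ.+ a₁ ÷ B₁ ℚ.+ a₀ ÷ B₀
  distribute W {A₁} {A₀} B₁ B₀ eq₁ eq₀ =
    trans (∑-distrib-+₃ W (λ x → A₁ x ÷ B₁) (λ x → A₀ x ÷ B₀))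
      (cong₂ (λ a b → ℚΣ.sum W ℚ.+ a ℚ.+ b)
        (trans (sum-÷ A₁ B₁) (cong (_÷ B₁) eq₁)) (trans (sum-÷ A₀ B₀) (cong (_÷ B₀) eq₀)))

  only-odd : ∀ p X B₁ B₀ → p ℚ.+ (1 * X) ÷ B₁ ℚ.+ 0 ÷ B₀ ≡ p ℚ.+ X ÷ B₁
  only-odd p X B₁ B₀ = trans (cong₂ (λ a b → p ℚ.+ a ÷ B₁ ℚ.+ b) (*-identityˡ X) (0÷ B₀)) (ℚₚ.+-identityʳ (p ℚ.+ X ÷ B₁))

  only-even : ∀ p X B₁ B₀ → p ℚ.+ 0 ÷ B₁ ℚ.+ (1 * X) ÷ B₀ ≡ p ℚ.+ X ÷ B₀
  only-even p X B₁ B₀ = trans (cong₂ (λ a b → p ℚ.+ a ℚ.+ b ÷ B₀) (0÷ B₁) (*-identityˡ X)) (cong (ℚ._+ X ÷ B₀) (ℚₚ.+-identityʳ p))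

  0÷+ : ∀ T p → 0 ÷ T ℚ.+ p ≡ p
  0÷+ T p = trans (cong (ℚ._+ p) (0÷ T)) (ℚₚ.+-identityˡ p)

  module _ {n m : ℕ} (∑¬c : sum (λ x → 𝟙 (not (c x))) ≡ suc n) (∑c : sum (λ x → 𝟙 (c x)) ≡ m)
           (p : Fin N → Fin N) (p-odd : ∀ x → c x ≡ false → v ≢ x → c (p x) ≡ true) where

    open Sizes ∑¬c ∑c
    open Clusters p p-odd

    module _ (W : Fin N → ℕ) (W≢0 : ∀ x → NonZero (W x)) (b₁ b₀ : ℕ) .{{b₁≢0 : NonZero b₁}} .{{b₀≢0 : NonZero b₀}} where

      private
        B₁ = b₁ * (b₁ + 2)
        B₀ = b₀ * (b₀ + 2)

      -- Odd vertices use the secant with nodes b₁ and b₁ + 2, even ones that with nodes b₀ and b₀ +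
      -- 2, while v keeps its exact term 1/W(v).
      ∑1÷-lower : ∀ (j : Fin N → ℕ) g c′ → let open Depths j in
        (∀ x → c x ≡ true → W x + 2 * (1 + e x) ≤ b₁ + 2 * (g + c′ * j x)) →
        (∀ x → c x ≡ false → v ≢ x → W x + 2 * (1 + e (p x)) ≤ b₀ + 2 * (g + c′ * j (p x))) →
        1 ÷ W v ℚ.+ (m * (b₁ + 2) + 2 * (m + n)) ÷ B₁ ℚ.+ (n * (b₀ + 2) + 2 * E) ÷ B₀ ℚ.≤
        ℚΣ.sum (λ x → 1 ÷ W x) ℚ.+ (2 * (g * m + c′ * J₁)) ÷ B₁ ℚ.+ (2 * (g * n + c′ * J₀)) ÷ B₀
      ∑1÷-lower j g c′ odd-bound even-bound = subst₂ ℚ._≤_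
        (trans (distribute (λ x → δ x ÷ W v) B₁ B₀ (odd-weight (b₁ + 2)) (even-weight (b₀ + 2)))
          (cong (λ t → t ℚ.+ (m * (b₁ + 2) + 2 * (m + n)) ÷ B₁ ℚ.+ (n * (b₀ + 2) + 2 * E) ÷ B₀)
            (trans (sum-÷ δ (W v)) (cong (_÷ W v) ∑δ≡1))))
        (distribute (λ x → 1 ÷ W x) B₁ B₀ (odd-cost g c′) (even-cost g c′))
        (ℚsum-mono-≤ pointwise)
        where
        open Depths j
        pointwise : ∀ x →
          δ x ÷ W v ℚ.+ (α x * (b₁ + 2 + 2 * (1 + e x))) ÷ B₁ ℚ.+ (ζ x * (b₀ + 2 + 2 * (1 + e (p x)))) ÷ B₀ ℚ.≤
          1 ÷ W x ℚ.+ (α x * (2 * (g + c′ * j x))) ÷ B₁ ℚ.+ (ζ x * (2 * (g + c′ * j (p x)))) ÷ B₀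
        pointwise x with δ x | α x | ζ x | role x
        ... | _ | _ | _ | root refl = ℚₚ.≤-refl
        ... | _ | _ | _ | odd cx = subst₂ ℚ._≤_
          (sym (trans (only-odd (0 ÷ W v) X B₁ B₀) (0÷+ (W v) (X ÷ B₁))))
          (trans (ℚₚ.+-comm (Y ÷ B₁) (1 ÷ W x)) (sym (only-odd (1 ÷ W x) Y B₁ B₀)))
          (1÷-secant (W x) b₁ (1 + e x) (g + c′ * j x) {{W≢0 x}} (odd-bound x cx))
          where X = b₁ + 2 + 2 * (1 + e x)
                Y = 2 * (g + c′ * j x)
        ... | _ | _ | _ | even cx v≢x = subst₂ ℚ._≤_
          (sym (trans (only-even (0 ÷ W v) X B₁ B₀) (0÷+ (W v) (X ÷ B₀))))
          (trans (ℚₚ.+-comm (Y ÷ B₀) (1 ÷ W x)) (sym (only-even (1 ÷ W x) Y B₁ B₀)))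
          (1÷-secant (W x) b₀ (1 + e (p x)) (g + c′ * j (p x)) {{W≢0 x}} (even-bound x cx v≢x))
          where X = b₀ + 2 + 2 * (1 + e (p x))
                Y = 2 * (g + c′ * j (p x))

      ∑1÷-upper : ∀ h → (∀ w → c w ≡ true → e w ≡ h ⊎ e w ≡ 1 + h) →
        (∀ x → c x ≡ true → b₁ + 2 * (h + 2) ≤ W x + 2 * (1 + e x)) →
        (∀ x → c x ≡ false → v ≢ x → b₀ + 2 * (h + 2) ≤ W x + 2 * (1 + e (p x))) →
        ℚΣ.sum (λ x → 1 ÷ W x) ℚ.+ (2 * ((h + 2) * m)) ÷ B₁ ℚ.+ (2 * ((h + 2) * n)) ÷ B₀ ℚ.≤
        1 ÷ W v ℚ.+ (m * (b₁ + 2) + 2 * (m + n)) ÷ B₁ ℚ.+ (n * (b₀ + 2) + 2 * E) ÷ B₀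
      ∑1÷-upper h tight odd-bound even-bound = subst₂ ℚ._≤_
        (distribute (λ x → 1 ÷ W x) B₁ B₀
          (trans (∑α-scale (2 * (h + 2))) (poly≡ (x₀ ⊗ (con 2 ⊗ x₁)) (con 2 ⊗ (x₁ ⊗ x₀)) (m ∷ h + 2 ∷ [])))
          (trans (∑ζ-scale (2 * (h + 2))) (poly≡ (x₀ ⊗ (con 2 ⊗ x₁)) (con 2 ⊗ (x₁ ⊗ x₀)) (n ∷ h + 2 ∷ []))))
        (trans (distribute (λ x → δ x ÷ W v) B₁ B₀ (odd-weight (b₁ + 2)) (even-weight (b₀ + 2)))
          (cong (λ t → t ℚ.+ (m * (b₁ + 2) + 2 * (m + n)) ÷ B₁ ℚ.+ (n * (b₀ + 2) + 2 * E) ÷ B₀)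
            (trans (sum-÷ δ (W v)) (cong (_÷ W v) ∑δ≡1))))
        (ℚsum-mono-≤ pointwise)
        where
        Y = 2 * (h + 2)
        pointwise : ∀ x →
          1 ÷ W x ℚ.+ (α x * Y) ÷ B₁ ℚ.+ (ζ x * Y) ÷ B₀ ℚ.≤
          δ x ÷ W v ℚ.+ (α x * (b₁ + 2 + 2 * (1 + e x))) ÷ B₁ ℚ.+ (ζ x * (b₀ + 2 + 2 * (1 + e (p x)))) ÷ B₀
        pointwise x with δ x | α x | ζ x | role x
        ... | _ | _ | _ | root refl = ℚₚ.≤-refl
        ... | _ | _ | _ | odd cx = subst₂ ℚ._≤_
          (sym (only-odd (1 ÷ W x) Y B₁ B₀))
          (sym (trans (only-odd (0 ÷ W v) X B₁ B₀) (0÷+ (W v) (X ÷ B₁))))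
          (1÷-secant-tight (W x) b₁ (e x) h {{W≢0 x}} (odd-bound x cx) (tight x cx))
          where X = b₁ + 2 + 2 * (1 + e x)
        ... | _ | _ | _ | even cx v≢x = subst₂ ℚ._≤_
          (sym (only-even (1 ÷ W x) Y B₁ B₀))
          (sym (trans (only-even (0 ÷ W v) X B₁ B₀) (0÷+ (W v) (X ÷ B₀))))
          (1÷-secant-tight (W x) b₀ (e (p x)) h {{W≢0 x}} (even-bound x cx v≢x) (tight (p x) (p-odd x cx v≢x)))
          where X = b₀ + 2 + 2 * (1 + e (p x))

-- Levels of a connected bipartite graph

⟨x≡x⟩≡1 : ∀ {n} (x : Fin n) → ⟨ x ≡ x ⟩ ≡ 1
⟨x≡x⟩≡1 x with x Fin.≟ x
... | yes _   = refl
... | no  x≢x = contradiction refl x≢x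

∑⟨x≡⟩≡1 : ∀ {n} (x : Fin n) → sum (λ y → ⟨ x ≡ y ⟩) ≡ 1
∑⟨x≡⟩≡1 x = trans (sum-cong-≗ (λ y → sym (*-identityʳ ⟨ x ≡ y ⟩))) (sum-pick x (λ _ → 1))

𝟙-T : ∀ {b} → T b → 𝟙 b ≡ 1
𝟙-T {true} _ = refl

𝟙-¬T : ∀ {b} → ¬ T b → 𝟙 b ≡ 0
𝟙-¬T {true}  ¬t = contradiction _ ¬t
𝟙-¬T {false} _  = refl

𝟙-mono : ∀ {a b} → (T a → T b) → 𝟙 a ≤ 𝟙 b
𝟙-mono {true}  a⇒b = ≤-reflexive (sym (𝟙-T (a⇒b _)))
𝟙-mono {false} a⇒b = z≤n

flip-odd : ∀ k → false ≡ flip k true → k ≡ 1 + 2 * ⌊ pred k /2⌋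
flip-odd (suc zero)          eq = refl
flip-odd (suc (suc (suc k))) eq =
  trans (cong (2 +_) (flip-odd (suc k) (trans eq (not-involutive _))))
        (poly≡ (con 2 ⊕ (con 1 ⊕ con 2 ⊗ x₀)) (con 1 ⊕ con 2 ⊗ (con 1 ⊕ x₀)) (⌊ k /2⌋ ∷ []))

module _ {N : ℕ} (G : Graph N) (conn : Connected G) where

  W≢0 : 2 ≤ N → ∀ x → NonZero (W G x)
  W≢0 2≤N x = >-nonZero (+-cancelʳ-≤ 1 1 (W G x) (begin
    2                                        ≤⟨ 2≤N ⟩
    N                                        ≡⟨ *-identityʳ N ⟨
    N * 1                                    ≡⟨ sum-const N 1 ⟨
    sum {N} (λ _ → 1)                        ≤⟨ sum-mono-≤ pointwise ⟩
    sum (λ y → dist G x y + ⟨ x ≡ y ⟩)       ≡⟨ ∑-distrib-+ (dist G x) (λ y → ⟨ x ≡ y ⟩) ⟩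
    sum (dist G x) + sum (λ y → ⟨ x ≡ y ⟩)   ≡⟨ cong₂ _+_ (sym (W≡sum G x)) (∑⟨x≡⟩≡1 x) ⟩
    W G x + 1                                ∎))
    where
    open ≤-Reasoning
    pointwise : ∀ y → 1 ≤ dist G x y + ⟨ x ≡ y ⟩
    pointwise y with x Fin.≟ y
    ... | yes _   = m≤n+m 1 (dist G x y)
    ... | no  x≢y = ≤-trans (0<dist G conn x≢y) (m≤m+n _ 0)

module Levels {N : ℕ} (G : Graph N) (conn : Connected G) (c : Fin N → Bool)
              (proper : ∀ x y → T (adj G x y) → c x ≢ c y) (v : Fin N) (cv : c v ≡ false) where

  lev : Fin N → ℕ
  lev = dist G v

  par : Fin N → Fin N
  par x with v Fin.≟ x
  -- A default value: ζ vanishes at the root, so this does not affect the cluster sizes.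
  ... | yes _   = x
  ... | no  v≢x = proj₁ (predecessor G conn v x v≢x)

  par-spec : ∀ {x} → v ≢ x → T (adj G x (par x)) × lev x ≡ suc (lev (par x))
  par-spec {x} v≢x with v Fin.≟ x
  ... | yes v≡x = contradiction v≡x v≢x
  ... | no  v≢x = proj₂ (predecessor G conn v x v≢x)

  par-adj : ∀ {x} → v ≢ x → T (adj G x (par x))
  par-adj = proj₁ ∘ par-spec

  par-lev : ∀ {x} → v ≢ x → lev x ≡ suc (lev (par x))
  par-lev = proj₂ ∘ par-spec

  par-colour : ∀ {x} → v ≢ x → c (par x) ≡ not (c x)
  par-colour v≢x = colour-step G c proper (par-adj v≢x)

  par-odd : ∀ x → c x ≡ false → v ≢ x → c (par x) ≡ true
  par-odd x cx v≢x = trans (par-colour v≢x) (cong not cx)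

  odd≢root : ∀ {x} → c x ≡ true → v ≢ x
  odd≢root cx refl = contradiction (trans (sym cx) cv) λ ()

  depth : Fin N → ℕ
  depth x = ⌊ pred (lev x) /2⌋

  lev-odd : ∀ {x} → c x ≡ true → lev x ≡ 1 + 2 * depth x
  lev-odd {x} cx = flip-odd (lev x)
    (trans (sym cv) (trans (walk-colour G c proper (geodesic G conn v x)) (cong (flip (lev x)) cx)))

  lev≡0 : ∀ {x} → lev x ≡ 0 → v ≡ x
  lev≡0 {x} eq with v Fin.≟ x
  ... | yes v≡x = v≡x
  ... | no  v≢x = contradiction (0<dist G conn v≢x) (subst (λ k → ¬ 0 < k) (sym eq) λ ())

  -- Some geodesic from v to z passes through y.
  below : Fin N → Fin N → Bool
  below y z = lev z ≡ᵇ lev y + dist G y z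

  size : Fin N → ℕ
  size y = sum (λ z → 𝟙 (below y z))

  below-1 : ∀ {y z} → lev z ≡ lev y + dist G y z → 𝟙 (below y z) ≡ 1
  below-1 {y} {z} eq = 𝟙-T (≡⇒≡ᵇ (lev z) (lev y + dist G y z) eq)

  below-self : ∀ y → 𝟙 (below y y) ≡ 1
  below-self y = below-1 (sym (trans (cong (lev y +_) (dist-self G y)) (+-identityʳ _)))

  below-child : ∀ {z} → v ≢ z → 𝟙 (below (par z) z) ≡ 1
  below-child {z} v≢z = below-1 (≤-antisym (dist-triangle G conn v (par z) z)
    (≤-trans (+-monoʳ-≤ (lev (par z)) (dist-minimal G (edge G (adj-symᵀ G (par-adj v≢z)))))
      (≤-reflexive (trans (+-comm _ 1) (sym (par-lev v≢z))))))

  -- Passing from the parent of y to y raises any distance by at most 1. It lowers by 1 the distance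
  -- to each z counted by `size y`: a closer parent would give a path from v to z shorter than the
  -- geodesic through y.
  W-step : ∀ {y} → v ≢ y → W G y + 2 * size y ≤ W G (par y) + N
  W-step {y} v≢y = begin
    W G y + 2 * size y                              ≡⟨ cong₂ _+_ (W≡sum G y) (*-comm 2 (size y)) ⟩
    sum (dist G y) + size y * 2                     ≡⟨ cong (sum (dist G y) +_) (sum-scaleʳ (λ z → 𝟙 (below y z)) 2) ⟨
    sum (dist G y) + sum (λ z → 𝟙 (below y z) * 2)  ≡⟨ ∑-distrib-+ (dist G y) (λ z → 𝟙 (below y z) * 2) ⟨
    sum (λ z → dist G y z + 𝟙 (below y z) * 2)      ≤⟨ sum-mono-≤ pointwise ⟩
    sum (λ z → dist G (par y) z + 1)                ≡⟨ ∑-distrib-+ (dist G (par y)) (λ _ → 1) ⟩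
    sum (dist G (par y)) + sum {N} (λ _ → 1)        ≡⟨ cong₂ _+_ (sym (W≡sum G (par y))) (trans (sum-const N 1) (*-identityʳ N)) ⟩
    W G (par y) + N                                 ∎
    where
    open ≤-Reasoning
    pointwise : ∀ z → dist G y z + 𝟙 (below y z) * 2 ≤ dist G (par y) z + 1
    pointwise z with below y z in eqb
    ... | true  = ≤-trans (≤-reflexive (sym (+-assoc (dist G y z) 1 1))) (+-monoˡ-≤ 1 (+-cancelˡ-≤ (lev (par y)) _ _ (begin
      lev (par y) + (dist G y z + 1)     ≡⟨ poly≡ (x₀ ⊕ (x₁ ⊕ con 1)) (con 1 ⊕ x₀ ⊕ x₁) (lev (par y) ∷ dist G y z ∷ []) ⟩
      suc (lev (par y)) + dist G y z     ≡⟨ cong (_+ dist G y z) (par-lev v≢y) ⟨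
      lev y + dist G y z                 ≡⟨ ≡ᵇ⇒≡ (lev z) (lev y + dist G y z) (subst T (sym eqb) _) ⟨
      lev z                              ≤⟨ dist-triangle G conn v (par y) z ⟩
      lev (par y) + dist G (par y) z     ∎)))
    ... | false = begin
      dist G y z + 0                     ≡⟨ +-identityʳ _ ⟩
      dist G y z                         ≤⟨ dist-minimal G (_◅◅_ G (edge G (par-adj v≢y)) (geodesic G conn (par y) z)) ⟩
      1 + dist G (par y) z               ≡⟨ +-comm 1 _ ⟩
      dist G (par y) z + 1               ∎

  1≤size : ∀ y → 1 ≤ size y
  1≤size y = ≤-trans (≤-reflexive (sym (below-self y))) (sum-≥ (λ z → 𝟙 (below y z)) y)

  par≢self : ∀ {z} → v ≢ z → par z ≢ z
  par≢self v≢z eq = 1+n≢n (trans (sym (par-lev v≢z)) (cong lev (sym eq)))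

  2≤size : ∀ {z} → v ≢ z → 2 ≤ size (par z)
  2≤size {z} v≢z = begin
    2                                                       ≡⟨ cong₂ _+_ (∑⟨x≡⟩≡1 (par z)) (∑⟨x≡⟩≡1 z) ⟨
    sum (λ x → ⟨ par z ≡ x ⟩) + sum (λ x → ⟨ z ≡ x ⟩)       ≡⟨ ∑-distrib-+ (λ x → ⟨ par z ≡ x ⟩) (λ x → ⟨ z ≡ x ⟩) ⟨
    sum (λ x → ⟨ par z ≡ x ⟩ + ⟨ z ≡ x ⟩)                   ≤⟨ sum-mono-≤ pointwise ⟩
    size (par z)                                            ∎
    where
    open ≤-Reasoning
    pointwise : ∀ x → ⟨ par z ≡ x ⟩ + ⟨ z ≡ x ⟩ ≤ 𝟙 (below (par z) x)
    pointwise x with par z Fin.≟ x | z Fin.≟ x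
    ... | yes eq   | yes refl = contradiction eq (par≢self v≢z)
    ... | yes refl | no  _    = ≤-reflexive (sym (below-self (par z)))
    ... | no  _    | yes refl = ≤-reflexive (sym (below-child v≢z))
    ... | no  _    | no  _    = z≤n

  -- Each of the k steps down from v raises W by at most N - 4, because the vertex reached and its
  -- child towards z are both counted by its `size`. Speaking of the parent of some z guarantees
  -- that this child exists.
  W-ancestor : ∀ k {z} → v ≢ z → lev (par z) ≡ k → W G (par z) + 4 * k ≤ W G v + k * N
  W-ancestor zero    {z} v≢z eq = ≤-reflexive (cong (λ y → W G y + 0) (sym (lev≡0 eq)))
  W-ancestor (suc k) {z} v≢z eq = begin
    W G y + 4 * suc k                  ≡⟨ poly≡ (x₀ ⊕ con 4 ⊗ (con 1 ⊕ x₁)) (x₀ ⊕ con 2 ⊗ con 2 ⊕ con 4 ⊗ x₁) (W G y ∷ k ∷ []) ⟩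
    W G y + 2 * 2 + 4 * k              ≤⟨ +-monoˡ-≤ (4 * k) (+-monoʳ-≤ (W G y) (*-monoʳ-≤ 2 (2≤size v≢z))) ⟩
    W G y + 2 * size y + 4 * k         ≤⟨ +-monoˡ-≤ (4 * k) (W-step v≢y) ⟩
    W G (par y) + N + 4 * k            ≡⟨ poly≡ (x₀ ⊕ x₁ ⊕ con 4 ⊗ x₂) (x₀ ⊕ con 4 ⊗ x₂ ⊕ x₁) (W G (par y) ∷ N ∷ k ∷ []) ⟩
    W G (par y) + 4 * k + N            ≤⟨ +-monoˡ-≤ N (W-ancestor k v≢y (suc-injective (trans (sym (par-lev v≢y)) eq))) ⟩
    W G v + k * N + N                  ≡⟨ poly≡ (x₀ ⊕ x₁ ⊗ x₂ ⊕ x₂) (x₀ ⊕ (con 1 ⊕ x₁) ⊗ x₂) (W G v ∷ k ∷ N ∷ []) ⟩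
    W G v + suc k * N                  ∎
    where
    open ≤-Reasoning
    y = par z
    v≢y : v ≢ y
    v≢y v≡y = contradiction (trans (sym eq) (trans (cong lev (sym v≡y)) (dist-self G v))) λ ()

  open Roles c v cv

  ∑odd-upTo : ℕ → ℕ
  ∑odd-upTo k = sum (λ x → α x * 𝟙 (lev x ≤ᵇ k))

  -- Every second ancestor of w is odd, which gives one odd vertex for each depth up to that of w.
  -- Counting only up to a level keeps w out of the vertices already counted for its grandparent.
  depth<∑odd-upTo : ∀ k {w} → c w ≡ true → depth w ≡ k → suc k ≤ ∑odd-upTo (lev w)
  depth<∑odd-upTo zero {w} cw eq = begin
    1                           ≡⟨ cong₂ _*_ (cong 𝟙 cw) (𝟙-T (≤⇒≤ᵇ (≤-refl {lev w}))) ⟨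
    α w * 𝟙 (lev w ≤ᵇ lev w)    ≤⟨ sum-≥ (λ x → α x * 𝟙 (lev x ≤ᵇ lev w)) w ⟩
    ∑odd-upTo (lev w)           ∎
    where open ≤-Reasoning
  depth<∑odd-upTo (suc k) {w} cw eq = begin
    suc (suc k)                                                          ≤⟨ s≤s (depth<∑odd-upTo k cg depth-g) ⟩
    1 + ∑odd-upTo (lev g)                                                ≡⟨ cong (_+ ∑odd-upTo (lev g)) (∑⟨x≡⟩≡1 w) ⟨
    sum (λ x → ⟨ w ≡ x ⟩) + ∑odd-upTo (lev g)                            ≡⟨ ∑-distrib-+ (λ x → ⟨ w ≡ x ⟩) (λ x → α x * 𝟙 (lev x ≤ᵇ lev g)) ⟨
    sum (λ x → ⟨ w ≡ x ⟩ + α x * 𝟙 (lev x ≤ᵇ lev g))                     ≤⟨ sum-mono-≤ pointwise ⟩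
    ∑odd-upTo (lev w)                                                    ∎
    where
    open ≤-Reasoning
    v≢w = odd≢root cw
    y = par w
    lev-w : lev w ≡ 1 + 2 * suc k
    lev-w = trans (lev-odd cw) (cong (λ d → 1 + 2 * d) eq)
    lev-y : lev y ≡ 2 * suc k
    lev-y = suc-injective (trans (sym (par-lev v≢w)) lev-w)
    v≢y : v ≢ y
    v≢y v≡y = contradiction (trans (sym lev-y) (trans (cong lev (sym v≡y)) (dist-self G v))) λ ()
    g = par y
    cg : c g ≡ true
    cg = par-odd y (trans (par-colour v≢w) (cong not cw)) v≢y
    lev-y≡ : lev y ≡ 1 + lev g
    lev-y≡ = par-lev v≢y
    depth-g : depth g ≡ k
    depth-g = *-cancelˡ-≡ (depth g) k 2 (suc-injective (suc-injective (trans (cong suc (sym (lev-odd cg)))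
      (trans (sym lev-y≡) (trans lev-y (poly≡ (con 2 ⊗ (con 1 ⊕ x₀)) (con 2 ⊕ con 2 ⊗ x₀) (k ∷ [])))))))
    lev-g<lev-w : lev g < lev w
    lev-g<lev-w = ≤-trans (≤-reflexive (sym lev-y≡)) (≤-trans (n≤1+n _) (≤-reflexive (sym (par-lev v≢w))))
    pointwise : ∀ x → ⟨ w ≡ x ⟩ + α x * 𝟙 (lev x ≤ᵇ lev g) ≤ α x * 𝟙 (lev x ≤ᵇ lev w)
    pointwise x with w Fin.≟ x
    ... | yes refl rewrite cw | 𝟙-¬T (λ t → <⇒≱ lev-g<lev-w (≤ᵇ⇒≤ (lev w) (lev g) t)) | 𝟙-T (≤⇒≤ᵇ (≤-refl {lev w})) = ≤-refl
    ... | no  _    = *-monoʳ-≤ (α x) (𝟙-mono (λ t → ≤⇒≤ᵇ (≤-trans (≤ᵇ⇒≤ (lev x) (lev g) t) (<⇒≤ lev-g<lev-w))))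

  -- This is j ≤ m - 1, the bound that limits the multiplier q.
  depth<∑odd : ∀ {w} → c w ≡ true → depth w < sum α
  depth<∑odd {w} cw = ≤-trans (depth<∑odd-upTo (depth w) cw refl)
    (sum-mono-≤ (λ x → ≤-trans (*-monoʳ-≤ (α x) (𝟙-mono {b = true} _)) (≤-reflexive (*-identityʳ (α x)))))

  module Bounds {n m : ℕ} (∑¬c : sum (λ x → 𝟙 (not (c x))) ≡ suc n) (∑c : sum (λ x → 𝟙 (c x)) ≡ m) where

    open Sizes ∑¬c ∑c
    open Clusters par par-odd
    open Depths depth

    W-root : W G v ≡ m + 2 * n + 2 * (J₁ + J₀)
    W-root = begin
      W G v                                                            ≡⟨ W≡sum G v ⟩
      sum lev                                                          ≡⟨ sum-cong-≗ pointwise ⟩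
      sum (λ x → (α x * 1 + α x * depth x * 2) + (ζ x * 2 + ζ x * depth (par x) * 2))
        ≡⟨ trans (∑-distrib-+ (λ x → α x * 1 + α x * depth x * 2) (λ x → ζ x * 2 + ζ x * depth (par x) * 2))
             (cong₂ _+_ (sum-linear α (λ x → α x * depth x) 1 2) (sum-linear ζ (λ x → ζ x * depth (par x)) 2 2)) ⟩
      sum α * 1 + J₁ * 2 + (sum ζ * 2 + sum (λ x → ζ x * depth (par x)) * 2)
        ≡⟨ cong₂ (λ a b → a * 1 + J₁ * 2 + b) ∑c (cong₂ (λ a b → a * 2 + b * 2) ∑ζ≡n (fibre depth)) ⟩
      m * 1 + J₁ * 2 + (n * 2 + J₀ * 2)
        ≡⟨ poly≡ (x₀ ⊗ con 1 ⊕ x₁ ⊗ con 2 ⊕ (x₂ ⊗ con 2 ⊕ x₃ ⊗ con 2)) (x₀ ⊕ con 2 ⊗ x₂ ⊕ con 2 ⊗ (x₁ ⊕ x₃)) (m ∷ J₁ ∷ n ∷ J₀ ∷ []) ⟩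
      m + 2 * n + 2 * (J₁ + J₀)                                        ∎
      where
      open ≡-Reasoning
      pointwise : ∀ x → lev x ≡ (α x * 1 + α x * depth x * 2) + (ζ x * 2 + ζ x * depth (par x) * 2)
      pointwise x with δ x | α x | ζ x | role x
      ... | _ | _ | _ | root refl   = dist-self G v
      ... | _ | _ | _ | odd cx      = trans (lev-odd cx)
        (poly≡ (con 1 ⊕ con 2 ⊗ x₀) (con 1 ⊗ con 1 ⊕ con 1 ⊗ x₀ ⊗ con 2 ⊕ con 0) (depth x ∷ []))
      ... | _ | _ | _ | even cx v≢x = trans (par-lev v≢x) (trans (cong suc (lev-odd (par-odd x cx v≢x)))
        (poly≡ (con 1 ⊕ (con 1 ⊕ con 2 ⊗ x₀)) (con 0 ⊕ (con 1 ⊗ con 2 ⊕ con 1 ⊗ x₀ ⊗ con 2)) (depth (par x) ∷ [])))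

    1+e≤size : ∀ {w} → c w ≡ true → 1 + e w ≤ size w
    1+e≤size {w} cw = begin
      1 + e w                                                   ≡⟨ cong (_+ e w) (∑⟨x≡⟩≡1 w) ⟨
      sum (λ x → ⟨ w ≡ x ⟩) + e w                               ≡⟨ ∑-distrib-+ (λ x → ⟨ w ≡ x ⟩) (λ x → ζ x * ⟨ par x ≡ w ⟩) ⟨
      sum (λ x → ⟨ w ≡ x ⟩ + ζ x * ⟨ par x ≡ w ⟩)               ≤⟨ sum-mono-≤ pointwise ⟩
      size w                                                    ∎
      where
      open ≤-Reasoning
      pointwise : ∀ x → ⟨ w ≡ x ⟩ + ζ x * ⟨ par x ≡ w ⟩ ≤ 𝟙 (below w x)
      pointwise x with w Fin.≟ x
      ... | yes refl rewrite cw | below-self w = ≤-refl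
      ... | no  _ with δ x | α x | ζ x | role x
      ...   | _ | _ | _ | root _ = z≤n
      ...   | _ | _ | _ | odd _  = z≤n
      ...   | _ | _ | _ | even _ v≢x with par x Fin.≟ w
      ...     | yes refl = ≤-reflexive (sym (below-child v≢x))
      ...     | no  _    = z≤n

    -- `W-ancestor` covers the 2j steps from v to the parent of w, and `W-step` the last one, with w
    -- and its attached vertices counted by `size w`. The number c′ replaces N - 4, which can be
    -- negative when m = 1.
    W-odd : ∀ {w} c′ → N ≤ c′ + 4 → c w ≡ true →
            W G w + 2 * (1 + e w) ≤ W G v + N + 2 * (c′ * depth w)
    W-odd {w} c′ N≤ cw = +-cancelʳ-≤ (4 * (2 * d)) _ _ (begin
      W G w + 2 * (1 + e w) + 4 * (2 * d)     ≤⟨ +-monoˡ-≤ (4 * (2 * d)) (+-monoʳ-≤ (W G w) (*-monoʳ-≤ 2 (1+e≤size cw))) ⟩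
      W G w + 2 * size w + 4 * (2 * d)        ≤⟨ +-monoˡ-≤ (4 * (2 * d)) (W-step v≢w) ⟩
      W G (par w) + N + 4 * (2 * d)           ≡⟨ poly≡ (x₀ ⊕ x₁ ⊕ x₂) (x₀ ⊕ x₂ ⊕ x₁) (W G (par w) ∷ N ∷ 4 * (2 * d) ∷ []) ⟩
      W G (par w) + 4 * (2 * d) + N           ≤⟨ +-monoˡ-≤ N (W-ancestor (2 * d) v≢w (suc-injective (trans (sym (par-lev v≢w)) (lev-odd cw)))) ⟩
      W G v + 2 * d * N + N                   ≤⟨ +-monoˡ-≤ N (+-monoʳ-≤ (W G v) (*-monoʳ-≤ (2 * d) N≤)) ⟩
      W G v + 2 * d * (c′ + 4) + N            ≡⟨ poly≡ (x₀ ⊕ con 2 ⊗ x₁ ⊗ (x₂ ⊕ con 4) ⊕ x₃) (x₀ ⊕ x₃ ⊕ con 2 ⊗ (x₂ ⊗ x₁) ⊕ con 4 ⊗ (con 2 ⊗ x₁))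
                                                   (W G v ∷ d ∷ c′ ∷ N ∷ []) ⟩
      W G v + N + 2 * (c′ * d) + 4 * (2 * d)  ∎)
      where
      open ≤-Reasoning
      d = depth w
      v≢w = odd≢root cw

    W-even : ∀ {x} c′ → N ≤ c′ + 4 → c x ≡ false → v ≢ x →
             W G x + 2 * (1 + e (par x)) + 2 ≤ W G v + 2 * N + 2 * (c′ * depth (par x))
    W-even {x} c′ N≤ cx v≢x = begin
      W G x + E′ + 2                                    ≡⟨ poly≡ (x₀ ⊕ x₁ ⊕ con 2) (x₀ ⊕ con 2 ⊗ con 1 ⊕ x₁) (W G x ∷ E′ ∷ []) ⟩
      W G x + 2 * 1 + E′                                ≤⟨ +-monoˡ-≤ E′ (+-monoʳ-≤ (W G x) (*-monoʳ-≤ 2 (1≤size x))) ⟩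
      W G x + 2 * size x + E′                           ≤⟨ +-monoˡ-≤ E′ (W-step v≢x) ⟩
      W G w + N + E′                                    ≡⟨ poly≡ (x₀ ⊕ x₁ ⊕ x₂) (x₀ ⊕ x₂ ⊕ x₁) (W G w ∷ N ∷ E′ ∷ []) ⟩
      W G w + E′ + N                                    ≤⟨ +-monoˡ-≤ N (W-odd c′ N≤ (par-odd x cx v≢x)) ⟩
      W G v + N + 2 * (c′ * depth w) + N                ≡⟨ poly≡ (x₀ ⊕ x₁ ⊕ con 2 ⊗ x₂ ⊕ x₁) (x₀ ⊕ con 2 ⊗ x₁ ⊕ con 2 ⊗ x₂) (W G v ∷ N ∷ c′ * depth w ∷ []) ⟩
      W G v + 2 * N + 2 * (c′ * depth w)                ∎
      where
      open ≤-Reasoning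
      w = par x
      E′ = 2 * (1 + e w)

-- The tree H

module _ {N : ℕ} (G : Graph N) (conn : Connected G) (c : Fin N → Bool)
         (proper : ∀ x y → T (adj G x y) → c x ≢ c y) where

  private
    step₂ : ∀ {x y z} → T (adj G x y) → T (adj G y z) → c z ≡ c x
    step₂ a b = trans (colour-step G c proper b) (trans (cong not (colour-step G c proper a)) (not-involutive _))

  dist-unlike : ∀ {x z} → c x ≢ c z → 3 ≤ dist G x z + 2 * 𝟙 (adj G x z)
  dist-unlike {x} {z} c≢ with dist G x z | geodesic G conn x z
  ... | 0                 | here                 = contradiction refl c≢
  ... | 1                 | step a here          rewrite 𝟙-T a = ≤-refl
  ... | 2                 | step a (step b here) = contradiction (sym (step₂ a b)) c≢
  ... | suc (suc (suc k)) | _                    = s≤s (s≤s (s≤s z≤n))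

  dist-like : ∀ {x z} → c x ≡ c z → 2 ≤ dist G x z + 2 * ⟨ x ≡ z ⟩
  dist-like {x} {z} c≡ with dist G x z | geodesic G conn x z
  ... | 0           | here        rewrite ⟨x≡x⟩≡1 x = ≤-refl
  ... | 1           | step a here = contradiction c≡ (proper x z a)
  ... | suc (suc k) | _           = s≤s (s≤s z≤n)

  -- The distance is even, and a vertex at distance 2 from x must be adjacent to p, the only
  -- neighbour of x. For z = x both indicators equal 1 and supply the 4.
  dist-like-leaf : ∀ {x p z} → T (adj G x p) → (∀ {w} → T (adj G x w) → w ≡ p) → c x ≡ c z →
                   4 ≤ dist G x z + 2 * 𝟙 (adj G p z) + 2 * ⟨ x ≡ z ⟩
  dist-like-leaf {x} {p} {z} axp unique c≡ with dist G x z | geodesic G conn x z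
  ... | 0 | here rewrite ⟨x≡x⟩≡1 x | 𝟙-T (adj-symᵀ G axp) = ≤-refl
  ... | 1 | step a here = contradiction c≡ (proper x z a)
  ... | 2 | step a (step b here) rewrite 𝟙-T (subst (λ w → T (adj G w z)) (unique a) b) = m≤m+n 4 _
  ... | 3 | step a (step b (step b′ here)) = contradiction (trans (step₂ a b) c≡) (proper _ z b′)
  ... | suc (suc (suc (suc k))) | _ = s≤s (s≤s (s≤s (s≤s z≤n)))

module Extremal {N : ℕ} (H : Graph N) (tree : IsTree H) (c : Fin N → Bool)
                (proper : ∀ x y → T (adj H x y) → c x ≢ c y) (u : Fin N) (cu : c u ≡ false)
                (nbhd : ∀ w → T (adj H u w) ⇔ (c w ≡ true)) where

  conn : Connected H
  conn = proj₁ tree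

  open Levels H conn c proper u cu public
  open Roles c u cu

  adj-root : ∀ {w} → c w ≡ true → T (adj H u w)
  adj-root {w} = Equivalence.from (nbhd w)

  -- Two distinct neighbours of x would close the cycle u w₁ x w₂.
  neighbour-unique : ∀ {x w₁ w₂} → c x ≡ false → u ≢ x → T (adj H x w₁) → T (adj H x w₂) → w₁ ≡ w₂
  neighbour-unique {x} {w₁} {w₂} cx u≢x a₁ a₂ with w₁ Fin.≟ w₂
  ... | yes w₁≡w₂ = w₁≡w₂
  ... | no  w₁≢w₂ = contradiction cycle (proj₂ tree)
    where
    odd-neighbour : ∀ {w} → T (adj H x w) → c w ≡ true
    odd-neighbour a = trans (colour-step H c proper a) (cong not cx)
    x≢ : ∀ {w} → T (adj H x w) → x ≢ w
    x≢ a refl = proper _ _ a refl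
    cycle : HasCycle H
    cycle = u , w₁ ∷ x ∷ w₂ ∷ [] , s≤s (s≤s z≤n)
      , (odd≢root (odd-neighbour a₁) ∷ u≢x ∷ odd≢root (odd-neighbour a₂) ∷ [])
        ∷ (x≢ a₁ ∘ sym ∷ w₁≢w₂ ∷ []) ∷ (x≢ a₂ ∷ []) ∷ [] ∷ []
      , adj-root (odd-neighbour a₁) ∷ adj-symᵀ H a₁ ∷ a₂ ∷ adj-symᵀ H (adj-root (odd-neighbour a₂)) ∷ [-]

  par-unique : ∀ {x w} → c x ≡ false → u ≢ x → T (adj H x w) → w ≡ par x
  par-unique cx u≢x a = neighbour-unique cx u≢x a (par-adj u≢x)

  module TreeBounds {n m : ℕ} (∑¬c : sum (λ x → 𝟙 (not (c x))) ≡ suc n) (∑c : sum (λ x → 𝟙 (c x)) ≡ m) where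

    open Sizes ∑¬c ∑c
    open Clusters par par-odd

    W-root≤ : W H u ≤ m + 2 * n
    W-root≤ = begin
      W H u                            ≡⟨ W≡sum H u ⟩
      sum (dist H u)                   ≤⟨ sum-mono-≤ pointwise ⟩
      sum (λ x → α x * 1 + ζ x * 2)    ≡⟨ sum-linear α ζ 1 2 ⟩
      sum α * 1 + sum ζ * 2            ≡⟨ cong₂ (λ a b → a * 1 + b * 2) ∑c ∑ζ≡n ⟩
      m * 1 + n * 2                    ≡⟨ cong₂ _+_ (*-identityʳ m) (*-comm n 2) ⟩
      m + 2 * n                        ∎
      where
      open ≤-Reasoning
      pointwise : ∀ x → dist H u x ≤ α x * 1 + ζ x * 2
      pointwise x with δ x | α x | ζ x | role x
      ... | _ | _ | _ | root refl   = ≤-reflexive (dist-self H u)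
      ... | _ | _ | _ | odd cx      = dist-minimal H (edge H (adj-root cx))
      ... | _ | _ | _ | even cx u≢x = dist-minimal H (step (adj-root (par-odd x cx u≢x)) (edge H (adj-symᵀ H (par-adj u≢x))))

    -- This turns the degree condition on H into one on cluster sizes. Besides u, the neighbours of
    -- w are exactly the vertices attached to it, since an even vertex other than u has only one
    -- neighbour.
    degree≡1+e : ∀ {w} → c w ≡ true → degree H w ≡ 1 + e w
    degree≡1+e {w} cw = begin
      degree H w                                    ≡⟨ countV≡sum H (adj H w) ⟩
      sum (λ x → 𝟙 (adj H w x))                     ≡⟨ sum-cong-≗ pointwise ⟩
      sum (λ x → δ x + ζ x * ⟨ par x ≡ w ⟩)         ≡⟨ ∑-distrib-+ δ (λ x → ζ x * ⟨ par x ≡ w ⟩) ⟩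
      sum δ + e w                                   ≡⟨ cong (_+ e w) ∑δ≡1 ⟩
      1 + e w                                       ∎
      where
      open ≡-Reasoning
      pointwise : ∀ x → 𝟙 (adj H w x) ≡ δ x + ζ x * ⟨ par x ≡ w ⟩
      pointwise x with δ x | α x | ζ x | role x
      ... | _ | _ | _ | root refl = 𝟙-T (adj-symᵀ H (adj-root cw))
      ... | _ | _ | _ | odd cx    = 𝟙-¬T (λ a → proper w x a (trans cw (sym cx)))
      ... | _ | _ | _ | even cx u≢x with par x Fin.≟ w
      ...   | yes refl = 𝟙-T (adj-symᵀ H (par-adj u≢x))
      ...   | no  p≢w  = 𝟙-¬T (λ a → p≢w (sym (par-unique cx u≢x (adj-symᵀ H a))))

    private
      ∑adj : ∀ {w} → c w ≡ true → sum (λ x → 𝟙 (adj H w x)) ≡ 1 + e w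
      ∑adj {w} cw = trans (sym (countV≡sum H (adj H w))) (degree≡1+e cw)

    -- Distances from w are at least 2 within its own side, except to w itself, and at least 3 to
    -- the other side, except for the 1 + e w neighbours at distance 1.
    W-odd≥ : ∀ {w} → c w ≡ true → 2 * m + 3 * n + 1 ≤ W H w + 2 * (1 + e w)
    W-odd≥ {w} cw = +-cancelʳ-≤ 2 _ _ (begin
      2 * m + 3 * n + 1 + 2
        ≡⟨ poly≡ (con 2 ⊗ x₀ ⊕ con 3 ⊗ x₁ ⊕ con 1 ⊕ con 2) (x₀ ⊗ con 2 ⊕ (con 1 ⊕ x₁) ⊗ con 3) (m ∷ n ∷ []) ⟩
      m * 2 + (1 + n) * 3
        ≡⟨ cong₂ (λ a b → a * 2 + b * 3) (sym ∑c) (sym ∑¬c) ⟩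
      sum α * 2 + sum (λ z → 𝟙 (not (c z))) * 3
        ≡⟨ sum-linear α (λ z → 𝟙 (not (c z))) 2 3 ⟨
      sum (λ z → α z * 2 + 𝟙 (not (c z)) * 3)
        ≤⟨ sum-mono-≤ pointwise ⟩
      sum (λ z → dist H w z + (⟨ w ≡ z ⟩ * 2 + 𝟙 (adj H w z) * 2))
        ≡⟨ trans (∑-distrib-+ (dist H w) (λ z → ⟨ w ≡ z ⟩ * 2 + 𝟙 (adj H w z) * 2))
             (cong₂ _+_ (sym (W≡sum H w)) (sum-linear (λ z → ⟨ w ≡ z ⟩) (λ z → 𝟙 (adj H w z)) 2 2)) ⟩
      W H w + (sum (λ z → ⟨ w ≡ z ⟩) * 2 + sum (λ z → 𝟙 (adj H w z)) * 2)
        ≡⟨ cong₂ (λ a b → W H w + (a * 2 + b * 2)) (∑⟨x≡⟩≡1 w) (∑adj cw) ⟩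
      W H w + (1 * 2 + (1 + e w) * 2)
        ≡⟨ poly≡ (x₀ ⊕ (con 1 ⊗ con 2 ⊕ (con 1 ⊕ x₁) ⊗ con 2)) (x₀ ⊕ con 2 ⊗ (con 1 ⊕ x₁) ⊕ con 2) (W H w ∷ e w ∷ []) ⟩
      W H w + 2 * (1 + e w) + 2 ∎)
      where
      open ≤-Reasoning
      pointwise : ∀ z → α z * 2 + 𝟙 (not (c z)) * 3 ≤ dist H w z + (⟨ w ≡ z ⟩ * 2 + 𝟙 (adj H w z) * 2)
      pointwise z with c z in cz
      ... | true  = ≤-trans (dist-like H conn c proper (trans cw (sym cz)))
        (poly≤ (x₀ ⊕ con 2 ⊗ x₁) (x₀ ⊕ (x₁ ⊗ con 2 ⊕ x₂ ⊗ con 2)) (dist H w z ∷ ⟨ w ≡ z ⟩ ∷ 𝟙 (adj H w z) ∷ []))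
      ... | false = ≤-trans (dist-unlike H conn c proper (λ eq → contradiction (trans (sym cw) (trans eq cz)) λ ()))
        (poly≤ (x₀ ⊕ con 2 ⊗ x₂) (x₀ ⊕ (x₁ ⊗ con 2 ⊕ x₂ ⊗ con 2)) (dist H w z ∷ ⟨ w ≡ z ⟩ ∷ 𝟙 (adj H w z) ∷ []))

    W-even≥ : ∀ {x} → c x ≡ false → u ≢ x → 3 * m + 4 * n ≤ W H x + 2 * (1 + e (par x))
    W-even≥ {x} cx u≢x = +-cancelʳ-≤ 4 _ _ (begin
      3 * m + 4 * n + 4
        ≡⟨ poly≡ (con 3 ⊗ x₀ ⊕ con 4 ⊗ x₁ ⊕ con 4) (x₀ ⊗ con 3 ⊕ (con 1 ⊕ x₁) ⊗ con 4) (m ∷ n ∷ []) ⟩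
      m * 3 + (1 + n) * 4
        ≡⟨ cong₂ (λ a b → a * 3 + b * 4) (sym ∑c) (sym ∑¬c) ⟩
      sum α * 3 + sum (λ z → 𝟙 (not (c z))) * 4
        ≡⟨ sum-linear α (λ z → 𝟙 (not (c z))) 3 4 ⟨
      sum (λ z → α z * 3 + 𝟙 (not (c z)) * 4)
        ≤⟨ sum-mono-≤ pointwise ⟩
      sum (λ z → (dist H x z + ⟨ w ≡ z ⟩ * 2) + (𝟙 (adj H w z) * 2 + ⟨ x ≡ z ⟩ * 2))
        ≡⟨ trans (∑-distrib-+ (λ z → dist H x z + ⟨ w ≡ z ⟩ * 2) (λ z → 𝟙 (adj H w z) * 2 + ⟨ x ≡ z ⟩ * 2))
             (cong₂ _+_ (trans (∑-distrib-+ (dist H x) (λ z → ⟨ w ≡ z ⟩ * 2)) (cong₂ _+_ (sym (W≡sum H x)) (sum-scaleʳ (λ z → ⟨ w ≡ z ⟩) 2)))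
               (sum-linear (λ z → 𝟙 (adj H w z)) (λ z → ⟨ x ≡ z ⟩) 2 2)) ⟩
      (W H x + sum (λ z → ⟨ w ≡ z ⟩) * 2) + (sum (λ z → 𝟙 (adj H w z)) * 2 + sum (λ z → ⟨ x ≡ z ⟩) * 2)
        ≡⟨ cong₂ (λ a b → (W H x + a * 2) + b) (∑⟨x≡⟩≡1 w) (cong₂ (λ a b → a * 2 + b * 2) (∑adj (par-odd x cx u≢x)) (∑⟨x≡⟩≡1 x)) ⟩
      (W H x + 1 * 2) + ((1 + e w) * 2 + 1 * 2)
        ≡⟨ poly≡ (x₀ ⊕ con 1 ⊗ con 2 ⊕ ((con 1 ⊕ x₁) ⊗ con 2 ⊕ con 1 ⊗ con 2)) (x₀ ⊕ con 2 ⊗ (con 1 ⊕ x₁) ⊕ con 4) (W H x ∷ e w ∷ []) ⟩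
      W H x + 2 * (1 + e w) + 4 ∎)
      where
      open ≤-Reasoning
      w = par x
      adj≤ : ∀ z → 𝟙 (adj H x z) ≤ ⟨ w ≡ z ⟩
      adj≤ z with w Fin.≟ z
      ... | yes _   = 𝟙-mono {b = true} _
      ... | no  w≢z = ≤-reflexive (𝟙-¬T (λ a → w≢z (sym (par-unique cx u≢x a))))
      pointwise : ∀ z → α z * 3 + 𝟙 (not (c z)) * 4 ≤ (dist H x z + ⟨ w ≡ z ⟩ * 2) + (𝟙 (adj H w z) * 2 + ⟨ x ≡ z ⟩ * 2)
      pointwise z with c z in cz
      ... | true  = ≤-trans (dist-unlike H conn c proper (λ eq → contradiction (trans (sym cz) (trans (sym eq) cx)) λ ()))
        (≤-trans (+-monoʳ-≤ (dist H x z) (*-monoʳ-≤ 2 (adj≤ z)))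
          (poly≤ (x₀ ⊕ con 2 ⊗ x₁) (x₀ ⊕ x₁ ⊗ con 2 ⊕ (x₂ ⊗ con 2 ⊕ x₃ ⊗ con 2)) (dist H x z ∷ ⟨ w ≡ z ⟩ ∷ 𝟙 (adj H w z) ∷ ⟨ x ≡ z ⟩ ∷ [])))
      ... | false = ≤-trans (dist-like-leaf H conn c proper (par-adj u≢x) (par-unique cx u≢x) (trans cx (sym cz)))
          (poly≤ (x₀ ⊕ con 2 ⊗ x₂ ⊕ con 2 ⊗ x₃) (x₀ ⊕ x₁ ⊗ con 2 ⊕ (x₂ ⊗ con 2 ⊕ x₃ ⊗ con 2)) (dist H x z ∷ ⟨ w ≡ z ⟩ ∷ 𝟙 (adj H w z) ∷ ⟨ x ≡ z ⟩ ∷ []))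

-- Floor and ceiling of n/m

[k*m+r]/m≡k : ∀ k m r .{{_ : NonZero m}} → r < m → (k * m + r) / m ≡ k
[k*m+r]/m≡k k m r r<m = begin
  (k * m + r) / m      ≡⟨ +-distrib-/-∣ˡ r (divides k refl) ⟩
  k * m / m + r / m    ≡⟨ cong₂ _+_ (m*n/n≡m k m) (m<n⇒m/n≡0 r<m) ⟩
  k + 0                ≡⟨ +-identityʳ k ⟩
  k                    ∎
  where open ≡-Reasoning

ceilDiv-value : ∀ m′ h r → r ≤ m′ → ceilDiv (suc m′ * h + (1 + r)) (suc m′) ≡ 1 + h
ceilDiv-value m′ h r r≤m′ = trans
  (cong (_/ suc m′) (poly≡ ((con 1 ⊕ x₀) ⊗ x₁ ⊕ (con 1 ⊕ x₂) ⊕ x₀) ((con 1 ⊕ x₁) ⊗ (con 1 ⊕ x₀) ⊕ x₂) (m′ ∷ h ∷ r ∷ [])))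
  ([k*m+r]/m≡k (1 + h) (suc m′) r (s≤s r≤m′))

-- For r = m′ the division is exact, so the floor equals the ceiling 1 + h.
floorDiv-value : ∀ m′ h r → r ≤ m′ → floorDiv (suc m′ * h + (1 + r)) (suc m′) ≡ h ⊎ floorDiv (suc m′ * h + (1 + r)) (suc m′) ≡ 1 + h
floorDiv-value m′ h r r≤m′ with m≤n⇒m<n∨m≡n r≤m′
... | inj₁ r<m′ = inj₁ (trans (cong (λ a → (a + (1 + r)) / suc m′) (*-comm (suc m′) h)) ([k*m+r]/m≡k h (suc m′) (1 + r) (s≤s r<m′)))
... | inj₂ refl = inj₂ (trans
  (cong (_/ suc m′) (poly≡ ((con 1 ⊕ x₀) ⊗ x₁ ⊕ (con 1 ⊕ x₀)) ((con 1 ⊕ x₁) ⊗ (con 1 ⊕ x₀) ⊕ con 0) (m′ ∷ h ∷ [])))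
  ([k*m+r]/m≡k (1 + h) (suc m′) 0 z<s))

-- The comparison

order : ℕ → ℕ → ℕ → ℕ
order m′ h r = 1 + ((1 + m′) + ((1 + m′) * h + (1 + r)))

-- Here m = 2 + m′, and q is the largest number with (m - 1) q ≤ 2, namely 2, 1, 0 for m = 2, m = 3,
-- m ≥ 4; only m = 2 with h = 0 takes q = 0 instead.
key-exists : ∀ m′ h r k → ∃₂ λ c q → KeyHolds (suc m′) h r k c q × order (suc m′) h r ≤ c + 4 × suc m′ * q ≤ 2
key-exists 0 zero r k = r , 0 , key-m≡2-h≡0 r k , ≤-reflexive (poly≡ (con 4 ⊕ x₀) (x₀ ⊕ con 4) (r ∷ [])) , z≤n
key-exists 0 (suc h) r k = 2 * (1 + h) + r , 2 , key-m≡2 h r k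
  , ≤-reflexive (poly≡ (con 1 ⊕ (con 2 ⊕ (con 2 ⊗ (con 1 ⊕ x₀) ⊕ (con 1 ⊕ x₁)))) (con 2 ⊗ (con 1 ⊕ x₀) ⊕ x₁ ⊕ con 4) (h ∷ r ∷ []))
  , ≤-refl
key-exists 1 h r k = 3 * h + (1 + r) , 1 , key-m≡3 h r k
  , ≤-reflexive (poly≡ (con 1 ⊕ (con 3 ⊕ (con 3 ⊗ x₀ ⊕ (con 1 ⊕ x₁)))) (con 3 ⊗ x₀ ⊕ (con 1 ⊕ x₁) ⊕ con 4) (h ∷ r ∷ []))
  , ≤-refl
key-exists (suc (suc m)) h r k = (4 + m) * h + (1 + r) + (1 + m) , 0 , key-m≥4 m h r k
  , ≤-reflexive (poly≡ (con 1 ⊕ (con 4 ⊕ x₀ ⊕ ((con 4 ⊕ x₀) ⊗ x₁ ⊕ (con 1 ⊕ x₂)))) ((con 4 ⊕ x₀) ⊗ x₁ ⊕ (con 1 ⊕ x₂) ⊕ (con 1 ⊕ x₀) ⊕ con 4) (m ∷ h ∷ r ∷ []))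
  , ≤-trans (≤-reflexive (*-zeroʳ (3 + m))) z≤n

excess-0 : ∀ p h r c → Compare.Excess p h r 0 0 c 0
excess-0 p h r c = ℚₚ.≤-reflexive (trans
  (cong₂ ℚ._+_ (cong₂ ℚ._+_ (0÷ (b₁° * b₁)) (0÷ (b₀° * b₀))) (cong₂ ℚ._+_ (2c0÷ B₁) (cong₂ ℚ._+_ (2c0÷ B₀) (0÷ B₀))))
  (sym (cong₂ ℚ._+_ (0÷ B₀) (0÷ (T° * T′)))))
  where
  open Compare p h r 0 0 c 0
  2c0÷ : ∀ D → (2 * (c * 0)) ÷ D ≡ 0ℚ
  2c0÷ D = trans (cong (λ a → (2 * a) ÷ D) (*-zeroʳ c)) (0÷ D)

C₁-mono : ∀ {N} (G H : Graph N) v u →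
  N ÷ W G v ℚ.+ ℚΣ.sum (λ x → 1 ÷ W H x) ℚ.≤ N ÷ W H u ℚ.+ ℚΣ.sum (λ x → 1 ÷ W G x) → C₁ G v ℚ.≤ C₁ H u
C₁-mono G H v u le = ℚ-cancel-≤ (SG ℚ.+ SH) (subst₂ ℚ._≤_
  (trans (cong (ℚ._+ SH) (sym (C₁+∑closeness G v))) (ℚₚ.+-assoc (C₁ G v) SG SH))
  (trans (cong (ℚ._+ SG) (sym (C₁+∑closeness H u))) (trans (ℚₚ.+-assoc (C₁ H u) SH SG) (cong (C₁ H u ℚ.+_) (ℚₚ.+-comm SH SG))))
  le)
  where
  SG = ℚΣ.sum (λ x → 1 ÷ W G x)
  SH = ℚΣ.sum (λ x → 1 ÷ W H x)

-- Weights in stars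

module StarSums {N : ℕ} (c : Fin N → Bool) (v : Fin N) (cv : c v ≡ false) (∑¬c : sum (λ x → 𝟙 (not (c x))) ≡ 1) where

  open Roles c v cv
  open Sizes {0} {sum α} ∑¬c refl

  only-even : ∀ {x} → c x ≡ false → v ≡ x
  only-even {x} cx with v Fin.≟ x in eq
  ... | yes v≡x = v≡x
  ... | no  v≢x = contradiction (≤-trans 1≤ζ (≤-trans (sum-≥ ζ x) (≤-reflexive ∑ζ≡n))) λ ()
    where
    1≤ζ : 1 ≤ ζ x
    1≤ζ rewrite eq | cx = ≤-refl

  star-weights : ∀ (W : Fin N → ℕ) K → ℚΣ.sum (λ x → δ x ÷ W v ℚ.+ α x ÷ K) ≡ 1 ÷ W v ℚ.+ sum α ÷ K
  star-weights W K = trans (ℚΣ.∑-distrib-+ (λ x → δ x ÷ W v) (λ x → α x ÷ K))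
    (cong₂ ℚ._+_ (trans (sum-÷ δ (W v)) (cong (_÷ W v) ∑δ≡1)) (sum-÷ α K))

  star-term : ∀ (P : ℚ → Fin N → Set) (W : Fin N → ℕ) K → P (1 ÷ W v) v →
              (∀ x → c x ≡ true → P (1 ÷ K) x) → ∀ x → P (δ x ÷ W v ℚ.+ α x ÷ K) x
  star-term P W K at-root at-odd x with δ x | α x | ζ x | role x
  ... | _ | _ | _ | root refl   = subst (λ p → P p v) (sym (trans (cong (1 ÷ W v ℚ.+_) (0÷ K)) (ℚₚ.+-identityʳ _))) at-root
  ... | _ | _ | _ | odd cx      = subst (λ p → P p x) (sym (trans (cong (ℚ._+ 1 ÷ K) (0÷ (W v))) (ℚₚ.+-identityˡ _))) (at-odd x cx)
  ... | _ | _ | _ | even cx v≢x = contradiction (only-even cx) v≢x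

module Main {N : ℕ} (G : Graph N) (c : Fin N → Bool) (connG : Connected G)
            (properG : ∀ x y → T (adj G x y) → c x ≢ c y)
            (H : Graph N) (d : Fin N → Bool) (tree : IsTree H)
            (properH : ∀ x y → T (adj H x y) → d x ≢ d y)
            (u : Fin N) (du : d u ≡ false) (nbhd : ∀ w → T (adj H u w) ⇔ (d w ≡ true))
            (v : Fin N) (cv : c v ≡ false) where

  module LG = Levels G connG c properG v cv
  module LH = Extremal H tree d properH u du nbhd
  module RG = Roles c v cv
  module RH = Roles d u du

  general : ∀ p h r → let m = 1 + (r + p) ; n = m * h + (1 + r) in
    sum (λ x → 𝟙 (not (c x))) ≡ suc n → sum (λ x → 𝟙 (c x)) ≡ m →
    sum (λ x → 𝟙 (not (d x))) ≡ suc n → sum (λ x → 𝟙 (d x)) ≡ m →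
    (∀ w → d w ≡ true → degree H w ≡ 1 + h ⊎ degree H w ≡ 2 + h) →
    C₁ G v ℚ.≤ C₁ H u
  general p h r ∑¬c ∑c ∑¬d ∑d deg = conclude (parameters (r + p) refl)
    where
    open RG.Sizes ∑¬c ∑c using (N≡)
    module CG = RG.Sizes.Clusters ∑¬c ∑c LG.par LG.par-odd
    module DG = CG.Depths LG.depth
    module BG = LG.Bounds ∑¬c ∑c
    module CH = RH.Sizes.Clusters ∑¬d ∑d LH.par LH.par-odd
    module BH = LH.TreeBounds ∑¬d ∑d
    open DG using (J₁; J₀)

    2≤N : 2 ≤ N
    2≤N = ≤-trans (s≤s (s≤s z≤n)) (≤-reflexive (sym N≡))

    Parameters : Set
    Parameters = ∃₂ λ c′ q → Compare.Excess p h r J₁ J₀ c′ q × N ≤ c′ + 4 × (∀ w → c w ≡ true → LG.depth w * q ≤ 2)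

    depth≤ : ∀ {w} → c w ≡ true → LG.depth w ≤ r + p
    depth≤ cw = s≤s⁻¹ (≤-trans (LG.depth<∑odd cw) (≤-reflexive ∑c))

    parameters : ∀ m′ → m′ ≡ r + p → Parameters
    -- For m = 1 all depths are 0, so k = 0 and `Excess` reads 0 ≤ 0 for q = 0; as c′ any number
    -- with N ≤ c′ + 4 would do.
    parameters zero eq = N , 0
      , subst₂ (λ j₁ j₀ → Compare.Excess p h r j₁ j₀ N 0) (sym J₁≡0) (sym J₀≡0) (excess-0 p h r N)
      , m≤m+n N 4 , λ w _ → ≤-trans (≤-reflexive (*-zeroʳ (LG.depth w))) z≤n
      where
      depth≡0 : ∀ {w} → c w ≡ true → LG.depth w ≡ 0
      depth≡0 cw = n≤0⇒n≡0 (≤-trans (depth≤ cw) (≤-reflexive (sym eq)))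
      ∑≡0 : ∀ (f : Fin N → ℕ) → (∀ w → f w ≡ 0) → sum f ≡ 0
      ∑≡0 f f≡0 = trans (sum-cong-≗ f≡0) (trans (sum-const N 0) (*-zeroʳ N))
      J₁≡0 : J₁ ≡ 0
      J₁≡0 = ∑≡0 _ λ w → odd-zero w
        where
        odd-zero : ∀ w → RG.α w * LG.depth w ≡ 0
        odd-zero w with c w in cw
        ... | true  = trans (*-identityˡ _) (depth≡0 cw)
        ... | false = refl
      J₀≡0 : J₀ ≡ 0
      J₀≡0 = ∑≡0 _ λ w → odd-zero w
        where
        odd-zero : ∀ w → RG.α w * (CG.e w * LG.depth w) ≡ 0
        odd-zero w with c w in cw
        ... | true  = trans (*-identityˡ _) (trans (cong (CG.e w *_) (depth≡0 cw)) (*-zeroʳ (CG.e w)))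
        ... | false = refl
    parameters (suc m′) eq with c′ , q , key , N≤ , small ← key-exists m′ h r (J₁ + J₀)
      = c′ , q
      , Compare.key⇒excess p h r J₁ J₀ c′ q (subst (λ m → KeyHolds m h r (J₁ + J₀) c′ q) eq key)
      , ≤-trans (≤-reflexive N≡) (subst (λ m → order m h r ≤ c′ + 4) eq N≤)
      , λ w cw → ≤-trans (*-monoˡ-≤ q (≤-trans (depth≤ cw) (≤-reflexive (sym eq)))) small

    conclude : Parameters → C₁ G v ℚ.≤ C₁ H u
    conclude (c′ , q , excess , N≤ , small) = C₁-mono G H v u
      (subst₂ (λ a t → a ÷ t ℚ.+ ℚΣ.sum (λ x → 1 ÷ W H x) ℚ.≤ a ÷ W H u ℚ.+ ℚΣ.sum (λ x → 1 ÷ W G x))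
        (sym N≡) (sym BG.W-root)
        (comparison excess {E = CG.E} {E° = CH.E} {TH = W H u} {{W≢0 H LH.conn 2≤N u}} BH.W-root≤
          (DG.spread-sum h q small)
          (CH.tight-sum h tight)
          (subst (λ t → 1 ÷ t ℚ.+ (m * (b₁ + 2) + 2 * (m + n)) ÷ B₁ ℚ.+ (n * (b₀ + 2) + 2 * CG.E) ÷ B₀ ℚ.≤
                        ℚΣ.sum (λ x → 1 ÷ W G x) ℚ.+ (2 * ((h + 2) * m + c′ * J₁)) ÷ B₁ ℚ.+ (2 * ((h + 2) * n + c′ * J₀)) ÷ B₀)
            BG.W-root
            (WeightBounds.∑1÷-lower c v cv ∑¬c ∑c LG.par LG.par-odd (W G) (W≢0 G connG 2≤N) b₁ b₀
              LG.depth (h + 2) c′ odd-bound even-bound))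
          (WeightBounds.∑1÷-upper d u du ∑¬d ∑d LH.par LH.par-odd (W H) (W≢0 H LH.conn 2≤N) b₁° b₀° h tight
            (λ x dx → ≤-trans (≤-reflexive b₁°≡) (BH.W-odd≥ dx))
            (λ x dx u≢x → ≤-trans (≤-reflexive b₀°≡) (BH.W-even≥ dx u≢x)))))
      where
      open Compare p h r J₁ J₀ c′ q

      tight : ∀ w → d w ≡ true → CH.e w ≡ h ⊎ CH.e w ≡ 1 + h
      tight w dw with deg w dw
      ... | inj₁ eq = inj₁ (suc-injective (trans (sym (BH.degree≡1+e dw)) eq))
      ... | inj₂ eq = inj₂ (suc-injective (trans (sym (BH.degree≡1+e dw)) eq))

      mᴱ nᴱ b₁ᴱ b₀ᴱ : Expr 5
      mᴱ = con 1 ⊕ (x₂ ⊕ x₀)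
      nᴱ = mᴱ ⊗ x₁ ⊕ (con 1 ⊕ x₂)
      b₁ᴱ = Keyᴱ.b₁° (x₂ ⊕ x₀) x₁ x₂ x₃ (con 0) (con 0)
      b₀ᴱ = Keyᴱ.b₀° (x₂ ⊕ x₀) x₁ x₂ x₃ (con 0) (con 0)

      ρ : ℕ → Vec ℕ 5
      ρ x = p ∷ h ∷ r ∷ J₁ + J₀ ∷ x ∷ []

      b₁°≡ : b₁° + 2 * (h + 2) ≡ 2 * m + 3 * n + 1
      b₁°≡ = poly≡ (b₁ᴱ ⊕ con 2 ⊗ (x₁ ⊕ con 2)) (con 2 ⊗ mᴱ ⊕ con 3 ⊗ nᴱ ⊕ con 1) (ρ 0)

      b₀°≡ : b₀° + 2 * (h + 2) ≡ 3 * m + 4 * n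
      b₀°≡ = poly≡ (b₀ᴱ ⊕ con 2 ⊗ (x₁ ⊕ con 2)) (con 3 ⊗ mᴱ ⊕ con 4 ⊗ nᴱ) (ρ 0)

      odd-bound : ∀ x → c x ≡ true → W G x + 2 * (1 + CG.e x) ≤ b₁ + 2 * (h + 2 + c′ * LG.depth x)
      odd-bound x cx = ≤-trans (BG.W-odd c′ N≤ cx) (≤-reflexive (trans
        (cong₂ (λ t s → t + s + 2 * (c′ * LG.depth x)) BG.W-root N≡)
        (poly≡ (mᴱ ⊕ con 2 ⊗ nᴱ ⊕ con 2 ⊗ x₃ ⊕ (con 1 ⊕ (mᴱ ⊕ nᴱ)) ⊕ con 2 ⊗ x₄)
               (b₁ᴱ ⊕ con 2 ⊗ x₃ ⊕ con 2 ⊗ (x₁ ⊕ con 2 ⊕ x₄)) (ρ (c′ * LG.depth x)))))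

      even-bound : ∀ x → c x ≡ false → v ≢ x → W G x + 2 * (1 + CG.e (LG.par x)) ≤ b₀ + 2 * (h + 2 + c′ * LG.depth (LG.par x))
      even-bound x cx v≢x = +-cancelʳ-≤ 2 _ _ (≤-trans (BG.W-even c′ N≤ cx v≢x) (≤-reflexive (trans
        (cong₂ (λ t s → t + 2 * s + 2 * (c′ * LG.depth (LG.par x))) BG.W-root N≡)
        (poly≡ (mᴱ ⊕ con 2 ⊗ nᴱ ⊕ con 2 ⊗ x₃ ⊕ con 2 ⊗ (con 1 ⊕ (mᴱ ⊕ nᴱ)) ⊕ con 2 ⊗ x₄)
               (b₀ᴱ ⊕ con 2 ⊗ x₃ ⊕ con 2 ⊗ (x₁ ⊕ con 2 ⊕ x₄) ⊕ con 2) (ρ (c′ * LG.depth (LG.par x)))))))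

  star : ∀ m′ → sum (λ x → 𝟙 (not (c x))) ≡ 1 → sum (λ x → 𝟙 (c x)) ≡ suc m′ →
         sum (λ x → 𝟙 (not (d x))) ≡ 1 → sum (λ x → 𝟙 (d x)) ≡ suc m′ → C₁ G v ℚ.≤ C₁ H u
  star m′ ∑¬c ∑c ∑¬d ∑d = C₁-mono G H v u (subst
    (λ a → a ÷ W G v ℚ.+ SH ℚ.≤ a ÷ W H u ℚ.+ SG) (sym N≡1+m)
    (subst₂ (λ a b → a ℚ.+ SH ℚ.≤ b ℚ.+ SG) (÷-+ 1 m (W G v)) (÷-+ 1 m (W H u)) (begin
      tG ℚ.+ m ÷ W G v ℚ.+ SH            ≤⟨ ℚₚ.+-mono-≤ (ℚₚ.+-monoʳ-≤ tG root-bound) upper ⟩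
      tG ℚ.+ lH ℚ.+ (tH ℚ.+ m ÷ K)       ≡⟨ solve 4 (λ a b c d → a :+ b :+ (c :+ d) := c :+ b :+ (a :+ d)) refl tG lH tH (m ÷ K) ⟩
      tH ℚ.+ lH ℚ.+ (tG ℚ.+ m ÷ K)       ≤⟨ ℚₚ.+-monoʳ-≤ (tH ℚ.+ lH) lower ⟩
      tH ℚ.+ lH ℚ.+ SG                   ∎)))
    where
    open ℚₚ.≤-Reasoning
    open +-*-Solver
    m = suc m′
    -- The weight of a leaf in a star with m leaves: distance 1 to the centre and 2 to each of the
    -- other m′ leaves.
    K = 1 + 2 * m′
    SG = ℚΣ.sum (λ x → 1 ÷ W G x)
    SH = ℚΣ.sum (λ x → 1 ÷ W H x)
    tG = 1 ÷ W G v
    tH = 1 ÷ W H u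
    lH = m ÷ W H u

    module SG′ = StarSums c v cv ∑¬c
    module SH′ = StarSums d u du ∑¬d
    module BH = LH.TreeBounds ∑¬d ∑d
    module CH = RH.Sizes.Clusters ∑¬d ∑d LH.par LH.par-odd

    N≡1+m : N ≡ 1 + m
    N≡1+m = trans (RG.Sizes.N≡ ∑¬c ∑c) (cong suc (+-identityʳ m))

    2≤N : 2 ≤ N
    2≤N = ≤-trans (s≤s (s≤s z≤n)) (≤-reflexive (sym N≡1+m))

    lev-odd≡1 : ∀ {x} → c x ≡ true → LG.lev x ≡ 1
    lev-odd≡1 {x} cx = trans (LG.par-lev v≢x) (cong suc
      (trans (cong LG.lev (sym (SG′.only-even (trans (LG.par-colour v≢x) (cong not cx))))) (dist-self G v)))
      where v≢x = LG.odd≢root cx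

    W-root : W G v ≡ m
    W-root = trans (W≡sum G v) (trans (sum-cong-≗ lev≡α) ∑c)
      where
      lev≡α : ∀ x → LG.lev x ≡ RG.α x
      lev≡α x with c x in cx
      ... | true  = lev-odd≡1 cx
      ... | false = trans (cong LG.lev (sym (SG′.only-even cx))) (dist-self G v)

    W-odd≤K : ∀ {x} → c x ≡ true → W G x ≤ K
    W-odd≤K {x} cx = +-cancelʳ-≤ 2 _ _ (≤-trans (+-monoʳ-≤ (W G x) (*-monoʳ-≤ 2 (LG.1≤size x))) (≤-trans (LG.W-step v≢x)
      (≤-reflexive (trans (cong₂ _+_ (trans (cong (W G) (sym par≡v)) W-root) N≡1+m)
        (poly≡ (con 1 ⊕ x₀ ⊕ (con 1 ⊕ (con 1 ⊕ x₀))) (con 1 ⊕ con 2 ⊗ x₀ ⊕ con 2) (m′ ∷ []))))))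
      where
      v≢x = LG.odd≢root cx
      par≡v : v ≡ LG.par x
      par≡v = SG′.only-even (trans (LG.par-colour v≢x) (cong not cx))

    W-odd≥K : ∀ {w} → d w ≡ true → K ≤ W H w
    W-odd≥K {w} dw = +-cancelʳ-≤ 2 _ _ (≤-trans
      (≤-reflexive (poly≡ (con 1 ⊕ con 2 ⊗ x₀ ⊕ con 2) (con 2 ⊗ (con 1 ⊕ x₀) ⊕ con 3 ⊗ con 0 ⊕ con 1) (m′ ∷ [])))
      (≤-trans (BH.W-odd≥ dw) (≤-reflexive (cong (λ a → W H w + 2 * (1 + a)) e≡0))))
      where
      e≡0 : CH.e w ≡ 0
      e≡0 = n≤0⇒n≡0 (≤-trans (≤-reflexive (sym (trans (cong (λ b → 𝟙 b * (CH.e w * 1)) dw) (trans (*-identityˡ _) (*-identityʳ _)))))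
        (≤-trans (sum-≥ (λ w → RH.α w * (CH.e w * 1)) w) (≤-reflexive CH.∑αe≡n)))

    root-bound : m ÷ W G v ℚ.≤ m ÷ W H u
    root-bound = ÷-mono-≤ m m (W G v) (W H u) {{W≢0 G connG 2≤N v}} {{W≢0 H LH.conn 2≤N u}}
      (*-monoʳ-≤ m (≤-trans BH.W-root≤ (≤-reflexive (trans (+-identityʳ m) (sym W-root)))))

    lower : tG ℚ.+ m ÷ K ℚ.≤ SG
    lower = subst (λ a → a ℚ.≤ SG) (trans (SG′.star-weights (W G) K) (cong (λ a → tG ℚ.+ a ÷ K) ∑c))
      (ℚsum-mono-≤ (SG′.star-term (λ p x → p ℚ.≤ 1 ÷ W G x) (W G) K ℚₚ.≤-refl
        λ x cx → ÷-mono-≤ 1 1 K (W G x) {{_}} {{W≢0 G connG 2≤N x}} (*-monoʳ-≤ 1 (W-odd≤K cx))))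

    upper : SH ℚ.≤ tH ℚ.+ m ÷ K
    upper = subst (λ a → SH ℚ.≤ a) (trans (SH′.star-weights (W H) K) (cong (λ a → tH ℚ.+ a ÷ K) ∑d))
      (ℚsum-mono-≤ (SH′.star-term (λ p x → 1 ÷ W H x ℚ.≤ p) (W H) K ℚₚ.≤-refl
        λ x dx → ÷-mono-≤ 1 1 (W H x) K {{W≢0 H LH.conn 2≤N x}} (*-monoʳ-≤ 1 (W-odd≥K dx))))

-- The orders of G and H are equal only by a computation from the class sizes; taking the equation
-- as an argument lets both graphs live on the same vertex set. The case n = 0 is separate because n
-- = m h + 1 + r requires n ≥ 1.
equal-order : ∀ n m′ {N} (G : Graph N) (c : Fin N → Bool) → Connected G →
  (∀ x y → T (adj G x y) → c x ≢ c y) →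
  sum (λ x → 𝟙 (not (c x))) ≡ suc n → sum (λ x → 𝟙 (c x)) ≡ suc m′ →
  (v : Fin N) → c v ≡ false →
  ∀ {M} → N ≡ M → (H : Graph M) (d : Fin M → Bool) → IsTree H →
  (∀ x y → T (adj H x y) → d x ≢ d y) →
  sum (λ x → 𝟙 (not (d x))) ≡ suc n → sum (λ x → 𝟙 (d x)) ≡ suc m′ →
  (u : Fin M) → d u ≡ false → (∀ w → T (adj H u w) ⇔ (d w ≡ true)) →
  (∀ w → d w ≡ true → degree H w ≡ 1 + ceilDiv n (suc m′) ⊎ degree H w ≡ 1 + floorDiv n (suc m′)) →
  C₁ G v ℚ.≤ C₁ H u
equal-order zero m′ G c connG properG ∑¬c ∑c v cv refl H d tree properH ∑¬d ∑d u du nbhd deg =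
  Main.star G c connG properG H d tree properH u du nbhd v cv m′ ∑¬c ∑c ∑¬d ∑d
equal-order (suc n′) m′ G c connG properG ∑¬c ∑c v cv refl H d tree properH ∑¬d ∑d u du nbhd deg =
  Main.general G c connG properG H d tree properH u du nbhd v cv p h r
    (trans ∑¬c (cong suc n-eq′)) (trans ∑c (cong suc m′≡)) (trans ∑¬d (cong suc n-eq′)) (trans ∑d (cong suc m′≡)) deg′
  where
  -- The quotient of n - 1, not of n: then 1 + r lies between 1 and m, and when m divides n all
  -- clusters of H have size h + 1.
  h = n′ / suc m′
  r = n′ % suc m′
  r≤m′ : r ≤ m′
  r≤m′ = s≤s⁻¹ (m%n<n n′ (suc m′))
  p = proj₁ (m≤n⇒∃[o]m+o≡n r≤m′)
  m′≡ : m′ ≡ r + p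
  m′≡ = sym (proj₂ (m≤n⇒∃[o]m+o≡n r≤m′))
  n-eq : suc n′ ≡ suc m′ * h + (1 + r)
  n-eq = trans (cong suc (m≡m%n+[m/n]*n n′ (suc m′)))
    (poly≡ (con 1 ⊕ (x₀ ⊕ x₁ ⊗ (con 1 ⊕ x₂))) ((con 1 ⊕ x₂) ⊗ x₁ ⊕ (con 1 ⊕ x₀)) (r ∷ h ∷ m′ ∷ []))
  n-eq′ : suc n′ ≡ (1 + (r + p)) * h + (1 + r)
  n-eq′ = trans n-eq (cong (λ a → suc a * h + (1 + r)) m′≡)
  deg′ : ∀ w → d w ≡ true → degree H w ≡ 1 + h ⊎ degree H w ≡ 2 + h
  deg′ w dw with deg w dw
  ... | inj₁ eq = inj₂ (trans eq (cong suc (trans (cong (λ a → ceilDiv a (suc m′)) n-eq) (ceilDiv-value m′ h r r≤m′))))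
  ... | inj₂ eq with floorDiv-value m′ h r r≤m′
  ...   | inj₁ fl = inj₁ (trans eq (cong suc (trans (cong (λ a → floorDiv a (suc m′)) n-eq) fl)))
  ...   | inj₂ fl = inj₂ (trans eq (cong suc (trans (cong (λ a → floorDiv a (suc m′)) n-eq) fl)))

theorem2 : (n₀ n₁ : ℕ) → 1 ≤ n₀ → 1 ≤ n₁ →
    {N : ℕ} (G : Graph N) (c : Fin N → Bool) →
    Connected G → IsBipartition G c n₀ n₁ →
    {M : ℕ} (H : Graph M) (d : Fin M → Bool) →
    IsTree H → IsBipartition H d n₀ n₁ →
    (u : Fin M) → d u ≡ false →
    (∀ w → (T (adj H u w) ⇔ (d w ≡ true))) →
    (∀ w → d w ≡ true →
      (degree H w ≡ 1 + ceilDiv (n₀ ∸ 1) n₁) ⊎ (degree H w ≡ 1 + floorDiv (n₀ ∸ 1) n₁)) →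
    (v : Fin N) → c v ≡ false →
    C₁ G v ℚ.≤ C₁ H u
theorem2 (suc n) (suc m′) _ _ G c connG (properG , #¬c , #c) H d tree (properH , #¬d , #d) u du nbhd deg v cv =
  equal-order n m′ G c connG properG ∑¬c ∑c v cv
    (trans (Roles.Sizes.N≡ c v cv ∑¬c ∑c) (sym (Roles.Sizes.N≡ d u du ∑¬d ∑d)))
    H d tree properH ∑¬d ∑d u du nbhd deg
  where
  ∑¬c = trans (sym (countV≡sum G (λ x → not (c x)))) #¬c
  ∑c  = trans (sym (countV≡sum G c)) #c
  ∑¬d = trans (sym (countV≡sum H (λ x → not (d x)))) #¬d
  ∑d  = trans (sym (countV≡sum H d)) #d
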